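{- Let $G$ be a graph with $kr$ edges, where $r$ is the rank of the cycle matroid $M(G)$ and $k \geq 3$ is an integer. Then the $k$-base graph $\mathfrak{G}_k(M(G))$ is connected.
   Context: Graphs may have loops and multiple edges. The cycle matroid $M(G)$ is the matroid on $E(G)$ whose bases are the edge sets of spanning forests of $G$; its rank is the number of vertices minus the number of connected components. For a matroid $M$ of rank $r$ on a ground set of size $rk$, the $k$-base graph $\mathfrak{G}_k(M)$ is the graph whose vertex set is the set of all sets $\{B_1,\dots,B_k\}$ of $k$ pairwise disjoint bases of $M$ (equivalently, $k$ bases whose union is the whole ground set), with an edge between $\{B_1,\dots,B_k\}$ and $\{D_1,\dots,D_k\}$ if and only if $B_i = D_j$ for some $i,j$. -}

module Defs where

open import Data.Nat using (ℕ)
open import Data.Fin using (Fin)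
open import Data.Fin.Subset using (Subset; _∈_; _-_; ∣_∣)
open import Data.Product using (Σ; _×_; ∃; ∃-syntax; proj₁)
open import Relation.Binary.PropositionalEquality using (_≡_)
open import Relation.Nullary using (¬_)
open import Relation.Binary.Construct.Closure.ReflexiveTransitive using (Star)

record Graph : Set where
  field
    n    : ℕ
    m    : ℕ
    ends : Fin m → Fin n × Fin n
open Graph public

EdgeSet : Graph → Set
EdgeSet G = Subset (m G)

data Reach (G : Graph) (S : EdgeSet G) : Fin (n G) → Fin (n G) → Set where
  here  : ∀ {u} → Reach G S u u
  fwd   : ∀ {u w} (e : Fin (m G)) → e ∈ S → ends G e ≡ (u Data.Product., w) →
          ∀ {v} → Reach G S w v → Reach G S u v
  bwd   : ∀ {u w} (e : Fin (m G)) → e ∈ S → ends G e ≡ (w Data.Product., u) →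
          ∀ {v} → Reach G S w v → Reach G S u v

AllEdges : (G : Graph) → EdgeSet G
AllEdges G = Data.Fin.Subset.⊤

-- S is a forest: no edge of S has its endpoints joined by a path in S ∖ {e}
-- (excludes loops and cycles, including 2-cycles from parallel edges).
Forest : (G : Graph) → EdgeSet G → Set
Forest G S = ∀ e → e ∈ S → ∀ {a b} → ends G e ≡ (a Data.Product., b) →
             ¬ Reach G (S - e) a b

Spanning : (G : Graph) → EdgeSet G → Set
Spanning G S = ∀ u v → Reach G (AllEdges G) u v → Reach G S u v

-- Bases of the cycle matroid M(G): edge sets of spanning forests.
IsBase : (G : Graph) → EdgeSet G → Set
IsBase G S = Forest G S × Spanning G S

-- r is the rank of M(G): the common size of its bases.
IsRank : Graph → ℕ → Set
IsRank G r = ∃[ B ] (IsBase G B × ∣ B ∣ ≡ r)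

-- Vertices of the k-base graph: k pairwise disjoint bases B₁,…,Bₖ
-- (presented as an indexed family; reorderings of a family are adjacent,
-- so connectivity is the same as for the unordered sets).
KBaseVertex : Graph → ℕ → Set
KBaseVertex G k =
  Σ (Fin k → EdgeSet G) λ B →
    (∀ i → IsBase G (B i)) ×
    (∀ i j e → e ∈ B i → e ∈ B j → i ≡ j)

KBaseAdj : (G : Graph) (k : ℕ) → KBaseVertex G k → KBaseVertex G k → Set
KBaseAdj G k X Y = ∃[ i ] ∃[ j ] (proj₁ X i ≡ proj₁ Y j)

KBaseConnected : Graph → ℕ → Set
KBaseConnected G k = ∀ X Y → Star (KBaseAdj G k) X Y

{-# OPTIONS --safe #-}
-- A k-base is treated as a colouring of the edges whose classes are spanning forests; colourings sharing a class
-- are adjacent, and as k ≥ 3 so are colourings that differ in two classes only.  The proof is by induction on the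
-- number of edges.  Since there are k r edges, some non-isolated vertex v has degree k + t with t < k.
-- Exchanges of two edges lead from every k-base to one in which all bases have degree 1 or 2 at v.  Its t bases
-- of degree 2 pair up 2 t edges at v; deleting v and joining the far ends of each pair gives a smaller graph whose
-- k-bases lift back to k-bases of G.  By induction, all lifts for a fixed pairing P are linked.
-- It remains to link the lifts for two pairings P and Q, which is done by making P agree with Q pair by pair.
-- Let {a, b} be a pair of Q with a free in P and b paired with c.  Either b c can be replaced by a b in some k-base
-- of the smaller graph, or there is a vertex set U containing a and b but not c on which every member of every
-- k-base is connected.  In the second case counting edges inside U yields a wrong pair x y of P inside U, and
-- after the replacements of x y by x a and of b c by y c the problem recurs for {b, a} with a smaller set U.
module Submission where

open import Defs
open import Data.Bool using (Bool; true; false; not)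
open import Data.Bool.Properties as Bool using (not-involutive)
open import Data.Empty using (⊥; ⊥-elim)
open import Data.Fin using (Fin; zero; suc)
import Data.Fin.Properties as Fin
open import Data.Fin.Subset as Subset using (Subset; _∈_; _-_; ∣_∣)
open import Data.Fin.Subset.Properties using (_∈?_; ∈⊤; ⊆-antisym; x∈p∧x≢y⇒x∈p-y; p─q⊆p)
open import Data.Nat using (ℕ; zero; suc; _+_; _*_; _∸_; _≤_; _<_; z≤n; s≤s; s≤s⁻¹; NonZero; >-nonZero)
open import Data.Nat.Properties as ℕ hiding (_≟_)
open import Data.Nat.Solver using (module +-*-Solver)
open import Data.Product using (Σ; _×_; ∃; ∃₂; _,_; proj₁; proj₂)
open import Data.Product.Properties using (,-injective)
open import Data.Sum using (_⊎_; inj₁; inj₂; [_,_]′)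
open import Data.Sum.Function.Propositional using (_⊎-↔_)
open import Data.Sum.Properties using (inj₁-injective)
open import Data.Unit using (⊤; tt)
import Data.Vec as Vec
import Data.Vec.Properties as Vec
open import Function using (_∘_; id; _↔_; case_of_)
open import Function.Bundles using (Inverse)
open import Function.Construct.Composition using (_↔-∘_)
open import Function.Construct.Identity using (↔-id)
open import Function.Construct.Symmetry using (↔-sym)
open import Relation.Binary.Construct.Closure.ReflexiveTransitive as Star using (Star; ε; _◅_; _◅◅_)
open import Relation.Binary.Definitions using (DecidableEquality)
open import Relation.Binary.PropositionalEquality using (_≡_; _≢_; refl; sym; trans; cong; cong₂; subst; subst₂; module ≡-Reasoning)
open import Relation.Nullary using (¬_; Dec; yes; no; does; contradiction)
open import Relation.Nullary.Decidable using (map′; ¬?; _×-dec_; _⊎-dec_; decidable-stable; dec-true)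
open import Relation.Unary using (Decidable)
open import Algebra.Properties.CommutativeMonoid.Sum +-0-commutativeMonoid using (sum; ∑-comm; ∑-distrib-+; sum-cong-≗)

-- The induction hypothesis speaks about one smaller graph at a time, while two `k`-bases usually
-- induce different pairings at `v`; the main work is therefore to move between pairings. A move
-- changes one end of one pair. It need be admissible only for a single `k`-base of the smaller
-- graph, because every lift for the old pairing is already linked to a lift of that one. This
-- freedom to choose the `k`-base is what the separation argument exploits, and tight vertex sets
-- survive the change of `k`-base because counting alone characterises them. The bound t < k comes
-- from the average degree. It has two effects: since 2 t < k + t, some edge at `v` lies in no pair,
-- and since there are only t pairs, some colour contains no pair. The vertex type never changes:
-- `v` stays behind as an isolated vertex, and the pairs form a new summand of the edge type. Graphs
-- with different edge types but the same vertices can thus be compared by counting edges of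
-- forests.

-- Finite types with decidable search

record Finite (A : Set) : Set where
  field
    {size} : ℕ
    enumeration : A ↔ Fin size
  index : A → Fin size
  index = Inverse.to enumeration
  elem : Fin size → A
  elem = Inverse.from enumeration
  elem-index : ∀ a → elem (index a) ≡ a
  elem-index = Inverse.strictlyInverseʳ enumeration
  index-elem : ∀ i → index (elem i) ≡ i
  index-elem = Inverse.strictlyInverseˡ enumeration

open Finite ⦃ ... ⦄ using (index; elem; elem-index; index-elem)

instance
  Fin-finite : ∀ {n} → Finite (Fin n)
  Fin-finite = record { enumeration = ↔-id _ }

  ⊎-finite : ∀ {A B} → ⦃ Finite A ⦄ → ⦃ Finite B ⦄ → Finite (A ⊎ B)
  ⊎-finite ⦃ a ⦄ ⦃ b ⦄ = record
    { enumeration = (↔-sym Fin.+↔⊎) ↔-∘ (Finite.enumeration a ⊎-↔ Finite.enumeration b) }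

module _ {A : Set} ⦃ fin : Finite A ⦄ where
 infix 4 _≟_
 opaque
  _≟_ : DecidableEquality A
  a ≟ b = map′ (λ eq → trans (sym (elem-index a)) (trans (cong elem eq) (elem-index b)))
               (cong index) (index a Fin.≟ index b)

  some? : {P : A → Set} → Decidable P → Dec (∃ P)
  some? {P} P? = map′ (λ (i , p) → elem i , p)
                      (λ (a , p) → index a , subst P (sym (elem-index a)) p)
                      (Fin.any? (λ i → P? (elem i)))

  every? : {P : A → Set} → Decidable P → Dec (∀ a → P a)
  every? P? with some? (λ a → ¬? (P? a))
  ... | yes (a , ¬p) = no λ all → ¬p (all a)
  ... | no none      = yes λ a → decidable-stable (P? a) (λ ¬p → none (a , ¬p))

  counterexample : {P : A → Set} → Decidable P → ¬ (∀ a → P a) → ∃ λ a → ¬ P a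
  counterexample P? ¬all with some? (λ a → ¬? (P? a))
  ... | yes found = found
  ... | no none   = contradiction (λ a → decidable-stable (P? a) (λ ¬p → none (a , ¬p))) ¬all

-- Sums and cardinalities

sum-mono-≤ : ∀ {n} {f g : Fin n → ℕ} → (∀ i → f i ≤ g i) → sum f ≤ sum g
sum-mono-≤ {zero}  f≤g = z≤n
sum-mono-≤ {suc n} f≤g = +-mono-≤ (f≤g zero) (sum-mono-≤ (λ i → f≤g (suc i)))

sum-mono-< : ∀ {n} {f g : Fin n → ℕ} → (∀ i → f i ≤ g i) → ∀ i → f i < g i → sum f < sum g
sum-mono-< f≤g zero    lt = +-mono-<-≤ lt (sum-mono-≤ (λ i → f≤g (suc i)))
sum-mono-< f≤g (suc i) lt = +-mono-≤-< (f≤g zero) (sum-mono-< (λ i → f≤g (suc i)) i lt)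

sum-const : ∀ n r → sum {n} (λ _ → r) ≡ n * r
sum-const zero    r = refl
sum-const (suc n) r = cong (r +_) (sum-const n r)

ind : {A : Set} → Dec A → ℕ
ind (yes _) = 1
ind (no _)  = 0

ind-mono : {A B : Set} → (A → B) → (a? : Dec A) (b? : Dec B) → ind a? ≤ ind b?
ind-mono f (yes a) (yes b) = ≤-refl
ind-mono f (yes a) (no ¬b) = contradiction (f a) ¬b
ind-mono f (no ¬a) b?      = z≤n

sum-single : ∀ {n} (i : Fin n) → sum (λ j → ind (i Fin.≟ j)) ≡ 1
sum-single {suc n} zero = cong suc (trans (sum-const n 0) (n*0 n))
  where
  n*0 : ∀ n → n * 0 ≡ 0
  n*0 zero    = refl
  n*0 (suc n) = n*0 n
sum-single {suc n} (suc i) = trans (sum-cong-≗ lemma) (sum-single i)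
  where
  lemma : ∀ j → ind (suc i Fin.≟ suc j) ≡ ind (i Fin.≟ j)
  lemma j = ≤-antisym (ind-mono Fin.suc-injective _ _) (ind-mono (cong suc) _ _)

opaque
  ∑ : {A : Set} ⦃ fin : Finite A ⦄ → (A → ℕ) → ℕ
  ∑ f = sum (λ i → f (elem i))

card : {A : Set} ⦃ fin : Finite A ⦄ {P : A → Set} → Decidable P → ℕ
card P? = ∑ (λ a → ind (P? a))

module _ {A : Set} ⦃ fin : Finite A ⦄ where
 opaque
  unfolding ∑ _≟_

  ∑-mono-≤ : {f g : A → ℕ} → (∀ a → f a ≤ g a) → ∑ f ≤ ∑ g
  ∑-mono-≤ f≤g = sum-mono-≤ (λ i → f≤g (elem i))

  ∑-cong : {f g : A → ℕ} → (∀ a → f a ≡ g a) → ∑ f ≡ ∑ g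
  ∑-cong f≡g = sum-cong-≗ (λ i → f≡g (elem i))

  ∑-+ : (f g : A → ℕ) → ∑ (λ a → f a + g a) ≡ ∑ f + ∑ g
  ∑-+ f g = ∑-distrib-+ (λ i → f (elem i)) (λ i → g (elem i))

  ∑-mono-< : {f g : A → ℕ} → (∀ a → f a ≤ g a) → ∀ a → f a < g a → ∑ f < ∑ g
  ∑-mono-< {f} {g} f≤g a lt = sum-mono-< (λ i → f≤g (elem i)) (index a)
    (subst (λ x → f x < g x) (sym (elem-index a)) lt)

  ∑-const : ∀ r → ∑ {A} (λ _ → r) ≡ Finite.size fin * r
  ∑-const = sum-const (Finite.size fin)

  ∑-squeeze : {f g : A → ℕ} → (∀ a → f a ≤ g a) → ∑ g ≤ ∑ f → ∀ a → f a ≡ g a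
  ∑-squeeze {f} {g} f≤g ge a = ≤-antisym (f≤g a) (≮⇒≥ λ lt → ≤⇒≯ ge (∑-mono-< f≤g a lt))

  ∑-<⇒∃< : {f g : A → ℕ} → ∑ f < ∑ g → ∃ λ a → f a < g a
  ∑-<⇒∃< {f} {g} lt with some? (λ a → f a <? g a)
  ... | yes found = found
  ... | no none   = contradiction lt (≤⇒≯ (∑-mono-≤ (λ a → ≮⇒≥ (λ l → none (a , l)))))

  ∑-balance : {f g : A → ℕ} → ∑ f ≡ ∑ g → ∀ a → f a < g a → ∃ λ b → g b < f b
  ∑-balance {f} {g} eq a lt with some? (λ b → g b <? f b)
  ... | yes found = found
  ... | no none   = contradiction (∑-mono-< (λ b → ≮⇒≥ (λ l → none (b , l))) a lt) (<-irrefl eq)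

  card-mono : {P Q : A → Set} (P? : Decidable P) (Q? : Decidable Q) →
              (∀ a → P a → Q a) → card P? ≤ card Q?
  card-mono P? Q? P⊆Q = ∑-mono-≤ (λ a → ind-mono (P⊆Q a) (P? a) (Q? a))

  card-mono-< : {P Q : A → Set} (P? : Decidable P) (Q? : Decidable Q) →
                (∀ a → P a → Q a) → ∀ a → Q a → ¬ P a → card P? < card Q?
  card-mono-< P? Q? P⊆Q a q ¬p =
    ∑-mono-< (λ a → ind-mono (P⊆Q a) (P? a) (Q? a)) a (strict (P? a) (Q? a) q ¬p)
    where
    strict : {P Q : Set} (p? : Dec P) (q? : Dec Q) → Q → ¬ P → ind p? < ind q?
    strict (yes p) q?      q ¬p = contradiction p ¬p
    strict (no _)  (yes _) q ¬p = s≤s z≤n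
    strict (no _)  (no ¬q) q ¬p = contradiction q ¬q

  card-singleton : (a : A) → card (a ≟_) ≡ 1
  card-singleton a = trans (∑-cong lemma) (single (index a))
    where
    lemma : ∀ b → ind (a ≟ b) ≡ ind (index a Fin.≟ index b)
    lemma b = ≤-antisym (ind-mono (cong index) _ _)
      (ind-mono (λ eq → trans (sym (elem-index a)) (trans (cong elem eq) (elem-index b))) _ _)
    single : ∀ i → ∑ {A} (λ b → ind (i Fin.≟ index b)) ≡ 1
    single i = trans (sum-cong-≗ (λ j → cong (λ x → ind (i Fin.≟ x)) (index-elem ⦃ fin ⦄ j))) (sum-single i)

  card-∪ : {P Q R : A → Set} (P? : Decidable P) (Q? : Decidable Q) (R? : Decidable R) →
           (∀ a → R a → P a ⊎ Q a) → card R? ≤ card P? + card Q?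
  card-∪ P? Q? R? cover = ≤-trans (∑-mono-≤ (λ a → lemma (P? a) (Q? a) (R? a) (cover a)))
                                  (≤-reflexive (∑-+ (ind ∘ P?) (ind ∘ Q?)))
    where
    lemma : {P Q R : Set} (p? : Dec P) (q? : Dec Q) (r? : Dec R) → (R → P ⊎ Q) → ind r? ≤ ind p? + ind q?
    lemma p?      q?      (no _)  _ = z≤n
    lemma (yes _) q?      (yes _) _ = s≤s z≤n
    lemma (no _)  (yes _) (yes _) _ = s≤s z≤n
    lemma (no ¬p) (no ¬q) (yes r) f = ⊥-elim ([ ¬p , ¬q ]′ (f r))

  card-≤suc : {P Q : A → Set} (P? : Decidable P) (Q? : Decidable Q) → ∀ a →
              (∀ b → Q b → P b ⊎ b ≡ a) → card Q? ≤ suc (card P?)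
  card-≤suc P? Q? a cover = ≤-trans (card-∪ (a ≟_) P? Q? (λ b q → [ inj₂ , (λ eq → inj₁ (sym eq)) ]′ (cover b q)))
    (≤-reflexive (cong (_+ card P?) (card-singleton a)))

  card-empty : {P : A → Set} (P? : Decidable P) → (∀ a → ¬ P a) → card P? ≡ 0
  card-empty P? none = trans (∑-cong (λ a → lemma (P? a) (none a))) (trans (sum-const (Finite.size fin) 0) (n*0 (Finite.size fin)))
    where
    lemma : {P : Set} (p? : Dec P) → ¬ P → ind p? ≡ 0
    lemma (yes p) ¬p = contradiction p ¬p
    lemma (no _)  ¬p = refl
    n*0 : ∀ n → n * 0 ≡ 0
    n*0 zero    = refl
    n*0 (suc n) = n*0 n

opaque
 unfolding ∑
 ∑-swap : {A B : Set} ⦃ fA : Finite A ⦄ ⦃ fB : Finite B ⦄ (f : A → B → ℕ) →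
          ∑ (λ a → ∑ (λ b → f a b)) ≡ ∑ (λ b → ∑ (λ a → f a b))
 ∑-swap f = ∑-comm (λ i j → f (elem i) (elem j))

∑-fibres : {A B : Set} ⦃ fA : Finite A ⦄ ⦃ fB : Finite B ⦄ {P : A → Set} (P? : Decidable P) (c : A → B) →
           ∑ (λ b → card (λ a → P? a ×-dec (c a ≟ b))) ≡ card P?
∑-fibres P? c = trans (∑-swap (λ b a → ind (P? a ×-dec (c a ≟ b)))) (∑-cong lemma)
  where
  lemma : ∀ a → ∑ (λ b → ind (P? a ×-dec (c a ≟ b))) ≡ ind (P? a)
  lemma a with P? a
  ... | yes p = trans (∑-cong (λ b → ≤-antisym (ind-mono proj₂ (yes p ×-dec (c a ≟ b)) (c a ≟ b))
                                               (ind-mono (p ,_) (c a ≟ b) (yes p ×-dec (c a ≟ b)))))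
                      (card-singleton (c a))
  ... | no ¬p = card-empty (λ b → no ¬p ×-dec (c a ≟ b)) (λ b q → ¬p (proj₁ q))

record Listing {A : Set} (P : A → Set) (n : ℕ) : Set where
  field
    at        : Fin n → A
    sound     : ∀ i → P (at i)
    injective : ∀ {i j} → at i ≡ at j → i ≡ j
    complete  : ∀ a → P a → ∃ λ i → at i ≡ a

list-Fin : ∀ {n} {P : Fin n → Set} (P? : Decidable P) → Listing P (sum (λ i → ind (P? i)))
list-Fin {zero} P? = record { at = λ () ; sound = λ () ; injective = λ {} ; complete = λ () }
list-Fin {suc n} {P} P? with P? zero | list-Fin (λ i → P? (suc i))
... | no ¬p | L = record
  { at = suc ∘ at ; sound = sound ; injective = injective ∘ Fin.suc-injective
  ; complete = λ { zero p → contradiction p ¬p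
                 ; (suc a) p → let i , eq = complete a p in i , cong suc eq } }
  where open Listing L
... | yes p | L = record { at = at′ ; sound = sound′ ; injective = inj′ _ _ ; complete = complete′ }
  where
  open Listing L
  at′ : Fin (suc _) → Fin (suc n)
  at′ zero    = zero
  at′ (suc i) = suc (at i)
  sound′ : ∀ i → P (at′ i)
  sound′ zero    = p
  sound′ (suc i) = sound i
  inj′ : ∀ i j → at′ i ≡ at′ j → i ≡ j
  inj′ zero    zero    _  = refl
  inj′ zero    (suc j) ()
  inj′ (suc i) zero    ()
  inj′ (suc i) (suc j) eq = cong suc (injective (Fin.suc-injective eq))
  complete′ : ∀ a → P a → ∃ λ i → at′ i ≡ a
  complete′ zero    _ = zero , refl
  complete′ (suc a) p = let i , eq = complete a p in suc i , cong suc eq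

opaque
 unfolding ∑
 list : {A : Set} ⦃ fin : Finite A ⦄ {P : A → Set} (P? : Decidable P) → Listing P (card P?)
 list {A = A} ⦃ fin ⦄ {P} P? = record
   { at        = elem ∘ at
   ; sound     = sound
   ; injective = λ {i} {j} eq → injective
       (trans (sym (index-elem ⦃ fin ⦄ (at i))) (trans (cong index eq) (index-elem ⦃ fin ⦄ (at j))))
   ; complete  = λ a p → let i , eq = complete (index a) (subst P (sym (elem-index a)) p)
                         in i , trans (cong elem eq) (elem-index a) }
   where open Listing (list-Fin (λ i → P? (elem i)))

-- Edge sets, connectivity and acyclicity

module _ {L : Set} where

  infixl 6 _∖_ _⊕_
  _∖_ _⊕_ : (L → Set) → L → (L → Set)
  (S ∖ e) f = S f × f ≢ e
  (S ⊕ e) f = S f ⊎ f ≡ e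

  infix 4 _⊆_
  _⊆_ : (L → Set) → (L → Set) → Set
  S ⊆ T = ∀ {e} → S e → T e

  module _ {V : Set} where

    data Link (E : L → V × V) (e : L) (u w : V) : Set where
      along   : E e ≡ (u , w) → Link E e u w
      against : E e ≡ (w , u) → Link E e u w

    data Conn (E : L → V × V) (S : L → Set) : V → V → Set where
      nil  : ∀ {u} → Conn E S u u
      cons : ∀ {e u w x} → S e → Link E e u w → Conn E S w x → Conn E S u x

    Acyc : (L → V × V) → (L → Set) → Set
    Acyc E S = ∀ {e u w} → S e → Link E e u w → ¬ Conn E (S ∖ e) u w

module _ {L V : Set} {E : L → V × V} where

  flip-link : ∀ {e u w} → Link E e u w → Link E e w u
  flip-link (along eq)   = against eq
  flip-link (against eq) = along eq

  link : ∀ e → Link E e (proj₁ (E e)) (proj₂ (E e))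
  link e = along refl

  link-unique : ∀ {e u w x y} → Link E e u w → Link E e x y → (u ≡ x × w ≡ y) ⊎ (u ≡ y × w ≡ x)
  link-unique (along p) (along q) = inj₁ (,-injective (trans (sym p) q))
  link-unique (along p) (against q) = inj₂ (,-injective (trans (sym p) q))
  link-unique (against p) (along q) = let a , b = ,-injective (trans (sym p) q) in inj₂ (b , a)
  link-unique (against p) (against q) = let a , b = ,-injective (trans (sym p) q) in inj₁ (b , a)

  infixr 5 _⋯_
  _⋯_ : ∀ {S u w x} → Conn E S u w → Conn E S w x → Conn E S u x
  nil        ⋯ ρ = ρ
  cons s l π ⋯ ρ = cons s l (π ⋯ ρ)

  single : ∀ {S e u w} → S e → Link E e u w → Conn E S u w
  single s l = cons s l nil

  rev : ∀ {S u w} → Conn E S u w → Conn E S w u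
  rev nil          = nil
  rev (cons s l π) = rev π ⋯ single s (flip-link l)

module _ {L V : Set} {E : L → V × V} where

  link-conn : ∀ {L′ : Set} {E′ : L′ → V × V} {e u w x y S} →
              Link E e u w → Link E e x y → Conn E′ S u w → Conn E′ S x y
  link-conn l l′ π with link-unique l l′
  ... | inj₁ (refl , refl) = π
  ... | inj₂ (refl , refl) = rev π

conn-map : ∀ {L L′ V : Set} {E : L → V × V} {E′ : L′ → V × V} {S T} →
           (∀ {e u w} → S e → Link E e u w → Conn E′ T u w) →
           ∀ {u w} → Conn E S u w → Conn E′ T u w
conn-map f nil          = nil
conn-map f (cons s l π) = f s l ⋯ conn-map f π

conn-⊆ : ∀ {L V : Set} {E : L → V × V} {S T} → S ⊆ T → ∀ {u w} → Conn E S u w → Conn E T u w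
conn-⊆ S⊆T = conn-map (λ s l → single (S⊆T s) l)

acyc-⊆ : ∀ {L V : Set} {E : L → V × V} {S T} → S ⊆ T → Acyc E T → Acyc E S
acyc-⊆ S⊆T acyc s l π = acyc (S⊆T s) l (conn-⊆ (λ (t , ne) → S⊆T t , ne) π)

SameEnds : {L V : Set} (S : L → Set) (E E′ : L → V × V) → Set
SameEnds S E E′ = ∀ {e} → S e → E e ≡ E′ e

same-link : ∀ {L V : Set} {E E′ : L → V × V} {e u w} → E e ≡ E′ e → Link E e u w → Link E′ e u w
same-link eq (along l)   = along (trans (sym eq) l)
same-link eq (against l) = against (trans (sym eq) l)

conn-same : ∀ {L V : Set} {E E′ : L → V × V} {S} → SameEnds S E E′ →
            ∀ {u w} → Conn E S u w → Conn E′ S u w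
conn-same same = conn-map (λ s l → single s (same-link (same s) l))

acyc-same : ∀ {L V : Set} {E E′ : L → V × V} {S} → SameEnds S E E′ → Acyc E S → Acyc E′ S
acyc-same same acyc s l π =
  acyc s (same-link (sym (same s)) l) (conn-same (λ (t , _) → sym (same t)) π)

module _ {L : Set} ⦃ fL : Finite L ⦄ where

  ∖-⊕ : ∀ {S : L → Set} e → S ⊆ S ∖ e ⊕ e
  ∖-⊕ e {f} s with f ≟ e
  ... | yes f≡e = inj₂ f≡e
  ... | no f≢e  = inj₁ (s , f≢e)

  ∖? : {S : L → Set} → Decidable S → ∀ e → Decidable (S ∖ e)
  ∖? S? e f = S? f ×-dec ¬? (f ≟ e)

  ⊕? : {S : L → Set} → Decidable S → ∀ e → Decidable (S ⊕ e)
  ⊕? S? e f = S? f ⊎-dec (f ≟ e)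

  card-∖ : {S : L → Set} (S? : Decidable S) {e : L} → S e → suc (card (∖? S? e)) ≤ card S?
  card-∖ S? {e} s = card-mono-< (∖? S? e) S? (λ _ → proj₁) e s (λ (_ , ne) → ne refl)

module _ {L V : Set} ⦃ fL : Finite L ⦄ {E : L → V × V} where

  Through : (L → Set) → L → V → V → Set
  Through S e u w = ∃₂ λ p q → Link E e p q × Conn E (S ∖ e) u p × Conn E (S ∖ e) q w

  -- The parts before the first and after the last passage through `e` avoid `e`. If these two
  -- passages run in opposite directions, the parts already meet and `e` is dispensable.
  split : ∀ {S} e {u w} → Conn E S u w → Conn E (S ∖ e) u w ⊎ Through S e u w
  split e nil = inj₁ nil
  split {S} e (cons {f} {u} {x} s l π) with f ≟ e | split e π
  ... | no ne    | inj₁ ρ                   = inj₁ (cons (s , ne) l ρ)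
  ... | no ne    | inj₂ (p , q , l′ , ρ , σ) = inj₂ (p , q , l′ , cons (s , ne) l ρ , σ)
  ... | yes refl | inj₁ ρ                   = inj₂ (u , x , l , nil , ρ)
  ... | yes refl | inj₂ (p , q , l′ , ρ , σ) with link-unique l l′
  ...   | inj₁ (refl , refl) = inj₂ (p , q , l′ , nil , σ)
  ...   | inj₂ (refl , refl) = inj₁ σ

  -- A new cycle through an old edge `f` must also use `e`; the rest of it, together with `f`, would
  -- join the ends of `e` inside `S`.
  acyc-⊕ : ∀ {S e p q} → Acyc E S → Link E e p q → ¬ Conn E S p q → Acyc E (S ⊕ e)
  acyc-⊕ {S} {e} acyc l ¬pq {f} {u} {w} s l′ π with f ≟ e
  ... | yes refl = ¬pq (link-conn l′ l (conn-⊆ (λ { (inj₁ s , _) → s ; (inj₂ eq , ne) → contradiction eq ne }) π))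
  ... | no f≢e with s
  ...   | inj₂ f≡e = f≢e f≡e
  ...   | inj₁ sf with split e π
  ...     | inj₁ ρ = acyc sf l′ (conn-⊆ (λ { ((inj₁ s , ne) , _) → s , ne ; ((inj₂ eq , _) , ne) → contradiction eq ne }) ρ)
  ...     | inj₂ (p′ , q′ , l″ , ρ , σ) =
    ¬pq (link-conn l″ l (rev (conn-⊆ drop ρ) ⋯ single sf l′ ⋯ rev (conn-⊆ drop σ)))
    where
    drop : ((S ⊕ e) ∖ f) ∖ e ⊆ S
    drop ((inj₁ s , _) , _)   = s
    drop ((inj₂ eq , _) , ne) = contradiction eq ne

  acyc-exchange : ∀ {S h e p q} → Acyc E S → Link E e p q → ¬ Conn E (S ∖ h) p q → Acyc E (S ∖ h ⊕ e)
  acyc-exchange acyc = acyc-⊕ (acyc-⊆ proj₁ acyc)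

  -- A walk without repeated edges, so that cutting it at an edge leaves two parts that avoid this
  -- edge.
  data Trail : (L → Set) → V → V → Set₁ where
    nil  : ∀ {S u} → Trail S u u
    cons : ∀ {S e u w x} → S e → Link E e u w → Trail (S ∖ e) w x → Trail S u x

  trail-⊆ : ∀ {S T u w} → S ⊆ T → Trail S u w → Trail T u w
  trail-⊆ S⊆T nil          = nil
  trail-⊆ S⊆T (cons s l τ) = cons (S⊆T s) l (trail-⊆ (λ (t , ne) → S⊆T t , ne) τ)

  opaque
    trail : ∀ {S} → Decidable S → ∀ {u w} → Conn E S u w → Trail S u w
    trail S? = go _ S? ≤-refl
      where
      go : ∀ n {S} (S? : Decidable S) → card S? ≤ n → ∀ {u w} → Conn E S u w → Trail S u w
      go n S? le nil = nil
      go zero S? le (cons s l π) = contradiction (≤-trans (card-∖ S? s) le) λ ()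
      go (suc n) S? le (cons {e} s l π) = case split e π of λ where
          (inj₁ ρ)                    → cons s l (go n (∖? S? e) smaller ρ)
          (inj₂ (p , q , l′ , _ , σ)) → case link-unique l l′ of λ where
            (inj₁ (refl , refl)) → cons s l (go n (∖? S? e) smaller σ)
            (inj₂ (refl , refl)) → trail-⊆ proj₁ (go n (∖? S? e) smaller σ)
        where smaller : card (∖? S? e) ≤ n
              smaller = s≤s⁻¹ (≤-trans (card-∖ S? s) le)

  -- Obtained at the first exit of a trail from `W`. Since `before` and `after` avoid the edge,
  -- deleting it from a forest separates `u` from `w`; exchange arguments rely on this.
  record Crossing (S : L → Set) (W : V → Set) (u w : V) : Set where
    field
      {edge}    : L
      {tip}     : V
      {tail}    : V
      member    : S edge
      ends      : Link E edge tip tail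
      inside    : W tip
      outside   : ¬ W tail
      before    : Conn E (S ∖ edge) u tip
      after     : Conn E (S ∖ edge) tail w

  trail-conn : ∀ {S u w} → Trail S u w → Conn E S u w
  trail-conn nil          = nil
  trail-conn (cons s l τ) = cons s l (conn-⊆ proj₁ (trail-conn τ))

  opaque
    crossing : ∀ {S W u w} → Decidable S → Decidable W → W u → ¬ W w → Conn E S u w → Crossing S W u w
    crossing {W = W} S? W? inU outW π = go (trail S? π) inU outW
      where
      go : ∀ {S u w} → Trail S u w → W u → ¬ W w → Crossing S W u w
      go nil inU outW = contradiction inU outW
      go (cons {w = x} s l τ) inU outW with W? x
      ... | no outX = record { member = s ; ends = l ; inside = inU ; outside = outX
                             ; before = nil ; after = trail-conn τ }
      ... | yes inX = record
        { member  = proj₁ C.member ; ends = C.ends ; inside = C.inside ; outside = C.outside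
        ; before  = cons (s , λ eq → proj₂ C.member (sym eq)) l (conn-⊆ (λ ((t , _) , ne) → t , ne) C.before)
        ; after   = conn-⊆ (λ ((t , _) , ne) → t , ne) C.after }
        where module C = Crossing (go τ inX outW)

    -- Paths in the forest `S` are unique: an edge of the path in `A` that is missing from `B` would
    -- close a cycle with the rest of that path and the path in `B`.
    conn-∩ : ∀ {S A B u w} → Acyc E S → Decidable A → Decidable B → A ⊆ S → B ⊆ S →
             Conn E A u w → Conn E B u w → Conn E (λ e → A e × B e) u w
    conn-∩ {S} {B = B} acyc A? B? A⊆S B⊆S α β = go A⊆S (trail A? α) β
      where
      go : ∀ {A u w} → A ⊆ S → Trail A u w → Conn E B u w → Conn E (λ e → A e × B e) u w
      go A⊆S nil β = nil
      go A⊆S (cons {e = e} a l τ) β with B? e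
      ... | yes b = cons (a , b) l (conn-⊆ (λ ((t , _) , b) → t , b)
                      (go (λ (t , _) → A⊆S t) τ (cons b (flip-link l) β)))
      ... | no ¬b = contradiction
        (conn-⊆ (λ b → B⊆S b , λ { refl → ¬b b }) β ⋯ rev (conn-⊆ (λ (t , ne) → A⊆S t , ne) (trail-conn τ)))
        (acyc (A⊆S a) l)

  module _ ⦃ fV : Finite V ⦄ where

    opaque
      conn? : ∀ {S} → Decidable S → ∀ u w → Dec (Conn E S u w)
      conn? S? = go _ S? ≤-refl
        where
        go : ∀ n {S} (S? : Decidable S) → card S? ≤ n → ∀ u w → Dec (Conn E S u w)
        go n S? le u w with some? S?
        go n S? le u w | no none = map′ (λ { refl → nil }) (λ { nil → refl ; (cons s _ _) → contradiction (_ , s) none }) (u ≟ w)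
        go zero S? le u w | yes (e , s) = contradiction (≤-trans (card-∖ S? s) le) λ ()
        go (suc n) {S} S? le u w | yes (e , s) =
          map′ [ conn-⊆ proj₁ , [ join (link e) , join (flip-link (link e)) ]′ ]′ analyse
               (rec u w ⊎-dec (rec u p ×-dec rec q w) ⊎-dec (rec u q ×-dec rec p w))
          where
          p q : V
          p = proj₁ (E e)
          q = proj₂ (E e)
          rec : ∀ u w → Dec (Conn E (S ∖ e) u w)
          rec = go n (∖? S? e) (s≤s⁻¹ (≤-trans (card-∖ S? s) le))
          join : ∀ {x y} → Link E e x y → Conn E (S ∖ e) u x × Conn E (S ∖ e) y w → Conn E S u w
          join l (π , ρ) = conn-⊆ proj₁ π ⋯ cons s l (conn-⊆ proj₁ ρ)
          analyse : Conn E S u w → Conn E (S ∖ e) u w ⊎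
                    (Conn E (S ∖ e) u p × Conn E (S ∖ e) q w) ⊎ (Conn E (S ∖ e) u q × Conn E (S ∖ e) p w)
          analyse π with split e π
          ... | inj₁ ρ = inj₁ ρ
          ... | inj₂ (x , y , l , ρ , σ) with link-unique l (link e)
          ...   | inj₁ (refl , refl) = inj₂ (inj₁ (ρ , σ))
          ...   | inj₂ (refl , refl) = inj₂ (inj₂ (ρ , σ))

      conn-cross : ∀ {S R u w} → Decidable R → Conn E S u w → ¬ Conn E R u w →
                   ∃ λ e → S e × ∀ {p q} → Link E e p q → ¬ Conn E R p q
      conn-cross R? nil ¬uw = contradiction nil ¬uw
      conn-cross R? (cons {e} {u} {x} s l π) ¬uw with conn? R? u x
      ... | no ¬ux = e , s , λ l′ ρ → ¬ux (link-conn l′ l ρ)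
      ... | yes ux = conn-cross R? π (λ ρ → ¬uw (ux ⋯ ρ))

-- Small cardinalities, Steinitz exchange and extension of forests

card-image : ∀ {A : Set} ⦃ fA : Finite A ⦄ {t} (f : Fin t → A) → card (λ a → some? (λ p → f p ≟ a)) ≤ t
card-image {t = zero}  f = ≤-reflexive (card-empty (λ a → some? (λ p → f p ≟ a)) λ { a (() , _) })
card-image {t = suc t} f = ≤-trans
  (card-≤suc (λ a → some? (λ p → f (suc p) ≟ a)) (λ a → some? (λ p → f p ≟ a)) (f zero)
    λ { a (zero , eq) → inj₂ (sym eq) ; a (suc p , eq) → inj₁ (p , eq) })
  (s≤s (card-image (λ p → f (suc p))))

module _ {A : Set} ⦃ fA : Finite A ⦄ {P : A → Set} (P? : Decidable P) where

  card-positive : ∀ {a} → P a → 1 ≤ card P?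
  card-positive {a} p = ≤-trans (s≤s z≤n) (card-mono-< {P = λ _ → ⊥} (λ _ → no id) P? (λ _ ()) a p id)

  card-pair : ∀ {a b} → P a → P b → a ≢ b → 2 ≤ card P?
  card-pair {a} {b} pa pb a≢b = ≤-trans
    (s≤s (≤-trans (s≤s z≤n) (card-mono-< {P = λ _ → ⊥} (λ _ → no id) (∖? P? a) (λ _ ()) b (pb , λ eq → a≢b (sym eq)) id)))
    (card-∖ P? pa)

  two-elements : 2 ≤ card P? → ∃₂ λ a b → P a × P b × a ≢ b
  two-elements le = go (list P?) le
    where
    go : ∀ {n} → Listing P n → 2 ≤ n → ∃₂ λ a b → P a × P b × a ≢ b
    go {suc (suc n)} l _ = l.at zero , l.at (suc zero) , l.sound _ , l.sound _ , λ eq → case l.injective eq of λ ()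
      where module l = Listing l
    go {suc zero} l (s≤s ())

  card<2⇒unique : card P? < 2 → ∀ {a b} → P a → P b → a ≡ b
  card<2⇒unique lt {a} {b} pa pb = decidable-stable (a ≟ b) λ ne → <⇒≱ lt (card-pair pa pb ne)

∑-scale : ∀ {A : Set} ⦃ fA : Finite A ⦄ (f : A → ℕ) r → ∑ (λ a → f a * r) ≡ ∑ f * r
∑-scale ⦃ fA ⦄ f zero    = trans (∑-cong (λ a → *-zeroʳ (f a))) (trans (trans (∑-const 0) (*-zeroʳ (Finite.size fA))) (sym (*-zeroʳ (∑ f))))
∑-scale f (suc r) = trans (∑-cong (λ a → *-suc (f a) r))
  (trans (∑-+ f (λ a → f a * r)) (trans (cong (∑ f +_) (∑-scale f r)) (sym (*-suc (∑ f) r))))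

-- The two sets may belong to different graphs that share only their vertices; the exchange takes
-- place in the disjoint union of the edge types. This generality serves to compare a graph with its
-- split graphs and with an auxiliary star.
steinitz : ∀ {L L′ V : Set} ⦃ fL : Finite L ⦄ ⦃ fL′ : Finite L′ ⦄ ⦃ fV : Finite V ⦄
           {E : L → V × V} {E′ : L′ → V × V} {S T} (S? : Decidable S) (T? : Decidable T) → Acyc E S →
           (∀ {e u w} → S e → Link E e u w → Conn E′ T u w) → card S? ≤ card T?
steinitz {L} {L′} {V} {E} {E′} {S} {T} S? T? acyc spanned =
  ≤-trans (m≤m+n _ _) (go _ S? (λ _ → no id) id ⊥-elim start ≤-refl)
  where
  ⟨_,_⟩ : (L → Set) → (L′ → Set) → (L ⊎ L′ → Set)
  ⟨ S′ , T′ ⟩ = [ S′ , T′ ]′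

  E⁺ : L ⊎ L′ → V × V
  E⁺ = [ E , E′ ]′

  lift₁ : ∀ {e u w} → Link E e u w → Link E⁺ (inj₁ e) u w
  lift₁ (along eq)   = along eq
  lift₁ (against eq) = against eq

  drop₁ : ∀ {e u w} → Link E⁺ (inj₁ e) u w → Link E e u w
  drop₁ (along eq)   = along eq
  drop₁ (against eq) = against eq

  lift₂ : ∀ {e u w} → Link E′ e u w → Link E⁺ (inj₂ e) u w
  lift₂ (along eq)   = along eq
  lift₂ (against eq) = against eq

  start : Acyc E⁺ ⟨ S , (λ _ → ⊥) ⟩
  start {inj₁ e} s l π = acyc s (drop₁ l)
    (conn-map (λ { {inj₁ f} (t , ne) l → single (t , λ eq → ne (cong inj₁ eq)) (drop₁ l)
                 ; {inj₂ f} (() , _) l }) π)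

  -- The edges of S are replaced one by one by edges of T, collected in T′.
  go : ∀ n {S′ T′} (S′? : Decidable S′) (T′? : Decidable T′) → S′ ⊆ S → T′ ⊆ T →
       Acyc E⁺ ⟨ S′ , T′ ⟩ → card S′? ≤ n → card S′? + card T′? ≤ card T?
  go n S′? T′? S′⊆S T′⊆T acyc′ le with some? S′?
  ... | no none rewrite card-empty S′? (λ e s → none (e , s)) = card-mono T′? T? (λ _ → T′⊆T)
  go zero S′? T′? S′⊆S T′⊆T acyc′ le | yes (e , s) = contradiction (≤-trans (card-∖ S′? s) le) λ ()
  go (suc n) {S′} {T′} S′? T′? S′⊆S T′⊆T acyc′ le | yes (e , s)
    with conn-cross R? (conn-map (λ t l → single {E = E⁺} {S = ⟨ (λ _ → ⊥) , T ⟩} t (lift₂ l)) (spanned (S′⊆S s) (link {E = E} e))) (acyc′ s (lift₁ (link e)))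
    where
    ⟨⟩? : Decidable ⟨ S′ , T′ ⟩
    ⟨⟩? (inj₁ f) = S′? f
    ⟨⟩? (inj₂ f) = T′? f
    R? = ∖? ⟨⟩? (inj₁ e)
  ... | inj₂ f , t , crosses = begin
    card S′? + card T′?                        ≤⟨ +-monoˡ-≤ _ (card-≤suc (∖? S′? e) S′? e (λ f s → ∖-⊕ {S = S′} e s)) ⟩
    suc (card (∖? S′? e) + card T′?)           ≡⟨ +-suc _ _ ⟨
    card (∖? S′? e) + suc (card T′?)           ≤⟨ +-monoʳ-≤ (card (∖? S′? e)) (card-mono-< T′? (⊕? T′? f) (λ _ → inj₁) f (inj₂ refl) f∉T′) ⟩
    card (∖? S′? e) + card (⊕? T′? f)          ≤⟨ go n (∖? S′? e) (⊕? T′? f) (λ (s , _) → S′⊆S s) (λ { (inj₁ t) → T′⊆T t ; (inj₂ refl) → t })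
                                                     (acyc-⊆ reorder (acyc-exchange acyc′ (link (inj₂ f)) (crosses (link (inj₂ f))))) (s≤s⁻¹ (≤-trans (card-∖ S′? s) le)) ⟩
    card T? ∎
    where
    open ≤-Reasoning
    f∉T′ : ¬ T′ f
    f∉T′ t′ = crosses (link (inj₂ f)) (single (t′ , λ ()) (link (inj₂ f)))
    reorder : ⟨ S′ ∖ e , T′ ⊕ f ⟩ ⊆ ⟨ S′ , T′ ⟩ ∖ inj₁ e ⊕ inj₂ f
    reorder {inj₁ x} (s , ne)    = inj₁ (s , λ eq → ne (inj₁-injective eq))
    reorder {inj₂ x} (inj₁ t)    = inj₁ (t , λ ())
    reorder {inj₂ x} (inj₂ refl) = inj₂ refl

-- Prescribing `F` controls what is left over: an edge of `S` missed by the maximal forest lies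
-- outside `F` and is redundant in `S`.
extend-acyclic : ∀ {L V : Set} ⦃ fL : Finite L ⦄ ⦃ fV : Finite V ⦄ {E : L → V × V} {F S}
  (F? : Decidable F) (S? : Decidable S) → F ⊆ S → Acyc E F →
  Σ (L → Set) λ B → Decidable B × F ⊆ B × B ⊆ S × Acyc E B × (∀ {e u w} → S e → Link E e u w → Conn E B u w)
extend-acyclic {L} {E = E} {F} {S} F? S? F⊆S acyc = go _ F? id F⊆S acyc ≤-refl
  where
  rest? : ∀ {B} → Decidable B → Decidable (λ e → S e × ¬ B e)
  rest? B? e = S? e ×-dec ¬? (B? e)
  shrink : ∀ {B e} (B? : Decidable B) → S e → ¬ Conn E B (proj₁ (E e)) (proj₂ (E e)) →
           card (rest? (⊕? B? e)) < card (rest? B?)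
  shrink {B} {e} B? s ¬π =
    card-mono-< (rest? (⊕? B? e)) (rest? B?) (λ _ (s , ¬b) → s , λ b → ¬b (inj₁ b)) e
      (s , λ b → ¬π (single b (link e))) (λ (_ , ¬b) → ¬b (inj₂ refl))
  go : ∀ n {B} (B? : Decidable B) → F ⊆ B → B ⊆ S → Acyc E B → card (rest? B?) ≤ n →
       Σ (L → Set) λ B → Decidable B × F ⊆ B × B ⊆ S × Acyc E B × (∀ {e u w} → S e → Link E e u w → Conn E B u w)
  go n {B} B? F⊆B B⊆S acyc le with some? (λ e → S? e ×-dec ¬? (conn? {E = E} B? (proj₁ (E e)) (proj₂ (E e))))
  ... | no none = B , B? , F⊆B , B⊆S , acyc , λ {e} s l →
          link-conn (link e) l (decidable-stable (conn? B? _ _) (λ ¬π → none (e , s , ¬π)))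
  go zero B? F⊆B B⊆S acyc le | yes (e , s , ¬π) = contradiction (≤-trans (shrink B? s ¬π) le) λ ()
  go (suc n) B? F⊆B B⊆S acyc le | yes (e , s , ¬π) =
    go n (⊕? B? e) (λ f → inj₁ (F⊆B f)) (λ { (inj₁ b) → B⊆S b ; (inj₂ refl) → s })
       (acyc-⊕ acyc (link e) ¬π) (s≤s⁻¹ (≤-trans (shrink B? s ¬π) le))

-- Every path from `p` to `q` in `S` passes through `ℓ`, so the old ends of `ℓ` stay joined: along
-- this path back to `p` and `q`, and across the moved `ℓ`.
conn-exchange : ∀ {L V : Set} ⦃ fL : Finite L ⦄ {E E′ : L → V × V} {S ℓ p q} →
  SameEnds (S ∖ ℓ) E E′ → S ℓ → Link E′ ℓ p q → Conn E S p q → ¬ Conn E (S ∖ ℓ) p q →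
  ∀ {u w} → Conn E S u w → Conn E′ S u w
conn-exchange {E = E} {E′} {S} {ℓ} same sℓ l′ π ¬π = conn-map step
  where
  move : ∀ {u w} → Conn E (S ∖ ℓ) u w → Conn E′ S u w
  move ρ = conn-⊆ proj₁ (conn-same same ρ)
  step : ∀ {e u w} → S e → Link E e u w → Conn E′ S u w
  step {e} s l with e ≟ ℓ
  ... | no e≢ℓ = move (single (s , e≢ℓ) l)
  ... | yes refl with split ℓ π
  ...   | inj₁ ρ                   = contradiction ρ ¬π
  ...   | inj₂ (x , y , lℓ , ρ , σ) =
    link-conn lℓ l (rev (move ρ) ⋯ single sℓ l′ ⋯ rev (move σ))

-- Partitions into bases as colourings of the edges

module KBases {V : Set} ⦃ fV : Finite V ⦄ (k : ℕ) (third : (i j : Fin k) → ∃ λ l → l ≢ i × l ≢ j) where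

  module _ {L : Set} ⦃ fL : Finite L ⦄ where

    cls : (L → Set) → (L → Fin k) → Fin k → L → Set
    cls A c j e = A e × c e ≡ j

    cls? : ∀ {A} → Decidable A → ∀ c j → Decidable (cls A c j)
    cls? A? c j e = A? e ×-dec (c e ≟ j)

    record KBase (E : L → V × V) (A : L → Set) (c : L → Fin k) : Set where
      field
        acyclic  : ∀ j → Acyc E (cls A c j)
        spanning : ∀ j {e u w} → A e → Link E e u w → Conn E (cls A c j) u w

      spanning-conn : ∀ j {u w} → Conn E A u w → Conn E (cls A c j) u w
      spanning-conn j = conn-map (spanning j)

    -- The edge sets of bases all have the same size, so a family with the right total size
    -- consists of bases as soon as all its members are acyclic, or all of them are spanning.
    module _ {E : L → V × V} {A : L → Set} (A? : Decidable A) {c₀ : L → Fin k} (kb : KBase E A c₀) where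
      open KBase kb

      base-size : ∀ i j → card (cls? A? c₀ i) ≡ card (cls? A? c₀ j)
      base-size i j = ≤-antisym (bound i j) (bound j i)
        where bound : ∀ i j → card (cls? A? c₀ i) ≤ card (cls? A? c₀ j)
              bound i j = steinitz (cls? A? c₀ i) (cls? A? c₀ j) (acyclic i) (λ (a , _) → spanning j a)

      acyclic⇒KBase : ∀ {c} → (∀ j → Acyc E (cls A c j)) → KBase E A c
      acyclic⇒KBase {c} acyc = record { acyclic = acyc ; spanning = span }
        where
        sizes : ∀ j → card (cls? A? c j) ≡ card (cls? A? c₀ j)
        sizes = ∑-squeeze (λ j → steinitz (cls? A? c j) (cls? A? c₀ j) (acyc j) (λ (a , _) → spanning j a))
                          (≤-reflexive (trans (∑-fibres A? c₀) (sym (∑-fibres A? c))))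
        span : ∀ j {e u w} → A e → Link E e u w → Conn E (cls A c j) u w
        span j {e} {u} {w} a l with conn? {E = E} (cls? A? c j) u w
        ... | yes π = π
        ... | no ¬π = contradiction (steinitz (⊕? (cls? A? c j) e) (cls? A? c₀ j) (acyc-⊕ (acyc j) l ¬π)
                                       (λ { (inj₁ (a , _)) l → spanning j a l ; (inj₂ refl) l → spanning j a l }))
            (<⇒≱ (≤-<-trans (≤-reflexive (sym (sizes j)))
              (card-mono-< (cls? A? c j) (⊕? (cls? A? c j) e) (λ _ → inj₁) e (inj₂ refl) (λ s → ¬π (single s l)))))

      spanning⇒KBase : ∀ {c} → (∀ j {e u w} → A e → Link E e u w → Conn E (cls A c j) u w) → KBase E A c
      spanning⇒KBase {c} span = record { acyclic = acyc ; spanning = span }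
        where
        sizes : ∀ j → card (cls? A? c₀ j) ≡ card (cls? A? c j)
        sizes = ∑-squeeze (λ j → steinitz (cls? A? c₀ j) (cls? A? c j) (acyclic j) (λ (a , _) → span j a))
                          (≤-reflexive (trans (∑-fibres A? c) (sym (∑-fibres A? c₀))))
        acyc : ∀ j → Acyc E (cls A c j)
        acyc j {e} s l π = contradiction
            (steinitz (cls? A? c₀ j) (∖? (cls? A? c j) e) (acyclic j) (λ (a , _) l → conn-map detour (span j a l)))
            (<⇒≱ (<-≤-trans (card-∖ (cls? A? c j) s) (≤-reflexive (sym (sizes j)))))
          where
          detour : ∀ {f u w} → cls A c j f → Link E f u w → Conn E (cls A c j ∖ e) u w
          detour {f} t l′ with f ≟ e
          ... | yes refl = link-conn l l′ π
          ... | no f≢e   = single (t , f≢e) l′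

    opaque
      swap : (L → Fin k) → L → L → (L → Fin k)
      swap c g h f with f ≟ g | f ≟ h
      ... | yes _ | _     = c h
      ... | no _  | yes _ = c g
      ... | no _  | no _  = c f

      swap-first : ∀ c g h → swap c g h g ≡ c h
      swap-first c g h with g ≟ g
      ... | yes _ = refl
      ... | no ne = contradiction refl ne

      swap-second : ∀ c g h → swap c g h h ≡ c g
      swap-second c g h with h ≟ g | h ≟ h
      ... | yes refl | _     = refl
      ... | no _     | yes _ = refl
      ... | no _     | no ne = contradiction refl ne

      swap-other : ∀ c {g h f} → f ≢ g → f ≢ h → swap c g h f ≡ c f
      swap-other c {g} {h} {f} f≢g f≢h with f ≟ g | f ≟ h
      ... | yes eq | _      = contradiction eq f≢g
      ... | no _   | yes eq = contradiction eq f≢h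
      ... | no _   | no _   = refl

    data SwapView (c : L → Fin k) (g h f : L) : Set where
      first  : f ≡ g → swap c g h f ≡ c h → SwapView c g h f
      second : f ≡ h → swap c g h f ≡ c g → SwapView c g h f
      other  : f ≢ g → f ≢ h → swap c g h f ≡ c f → SwapView c g h f

    opaque
      swap-view : ∀ c g h f → SwapView c g h f
      swap-view c g h f with f ≟ g
      ... | yes refl = first refl (swap-first c g h)
      ... | no f≢g with f ≟ h
      ...   | yes refl = second refl (swap-second c g h)
      ...   | no f≢h   = other f≢g f≢h (swap-other c f≢g f≢h)

    module _ {A : L → Set} {c : L → Fin k} {g h : L} (c≢ : c g ≢ c h) where

      swap-cls₁ : cls A (swap c g h) (c g) ⊆ cls A c (c g) ∖ g ⊕ h
      swap-cls₁ {f} (a , eq) with swap-view c g h f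
      ... | first refl eq′   = contradiction (trans (sym eq) eq′) c≢
      ... | second f≡h _     = inj₂ f≡h
      ... | other f≢g _ eq′  = inj₁ ((a , trans (sym eq′) eq) , f≢g)

      swap-cls₂ : cls A (swap c g h) (c h) ⊆ cls A c (c h) ∖ h ⊕ g
      swap-cls₂ {f} (a , eq) with swap-view c g h f
      ... | first f≡g _      = inj₂ f≡g
      ... | second refl eq′  = contradiction (trans (sym eq′) eq) c≢
      ... | other _ f≢h eq′  = inj₁ ((a , trans (sym eq′) eq) , f≢h)

      swap-cls-other : ∀ {j} → j ≢ c g → j ≢ c h → cls A (swap c g h) j ⊆ cls A c j
      swap-cls-other ≢g ≢h {f} (a , eq) with swap-view c g h f
      ... | first _ eq′     = contradiction (trans (sym eq) eq′) ≢h
      ... | second _ eq′    = contradiction (trans (sym eq) eq′) ≢g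
      ... | other _ _ eq′   = a , trans (sym eq′) eq

      swap-cls-other⁻ : ∀ {j} → j ≢ c g → j ≢ c h → cls A c j ⊆ cls A (swap c g h) j
      swap-cls-other⁻ ≢g ≢h {f} (a , eq) with swap-view c g h f
      ... | first refl _     = contradiction (sym eq) ≢g
      ... | second refl _    = contradiction (sym eq) ≢h
      ... | other _ _ eq′    = a , trans eq′ eq

      -- Only the two altered forests are tested, and only for cycles; that all members still span
      -- follows from their total size.
      swap-KBase : ∀ {E : L → V × V} → Decidable A → KBase E A c → ∀ {p q p′ q′} → Link E g p q → Link E h p′ q′ →
        ¬ Conn E (cls A c (c g) ∖ g) p′ q′ → ¬ Conn E (cls A c (c h) ∖ h) p q → KBase E A (swap c g h)
      swap-KBase {E} A? kb lg lh ¬π₁ ¬π₂ = acyclic⇒KBase A? kb acyc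
        where
        open KBase kb
        acyc : ∀ j → Acyc E (cls A (swap c g h) j)
        acyc j with j ≟ c g
        ... | yes refl = acyc-⊆ swap-cls₁ (acyc-exchange (acyclic j) lh ¬π₁)
        ... | no j≢g with j ≟ c h
        ...   | yes refl = acyc-⊆ swap-cls₂ (acyc-exchange (acyclic j) lg ¬π₂)
        ...   | no j≢h   = acyc-⊆ (swap-cls-other j≢g j≢h) (acyclic j)

    -- Tight vertex sets and separation

    In : (L → V × V) → (V → Set) → L → Set
    In E U e = U (proj₁ (E e)) × U (proj₂ (E e))

    in-link : ∀ {E U e u w} → Link E e u w → U u → U w → In E U e
    in-link {E} {e = e} l uU wU with link-unique l (link e)
    ... | inj₁ (refl , refl) = uU , wU
    ... | inj₂ (refl , refl) = wU , uU

    in-ends : ∀ {E U e u w} → Link E e u w → In E U e → U u × U w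
    in-ends {E} {e = e} l (uU , wU) with link-unique l (link e)
    ... | inj₁ (refl , refl) = uU , wU
    ... | inj₂ (refl , refl) = wU , uU

    within : (L → V × V) → (L → Set) → (V → Set) → L → Set
    within E A U e = A e × In E U e

    within? : ∀ E {A U} → Decidable A → Decidable U → Decidable (within E A U)
    within? E A? U? e = A? e ×-dec (U? _ ×-dec U? _)

    Tight : (L → V × V) → (L → Set) → (V → Set) → (L → Fin k) → Set
    Tight E A U c = ∀ j {u w} → U u → U w → Conn E (cls (within E A U) c j) u w

    within-stays : ∀ {E A U c j u w} → Conn E (cls (within E A U) c j) u w → U u → U w
    within-stays nil uU = uU
    within-stays (cons ((_ , i) , _) l π) uU = within-stays π (proj₂ (in-ends l i))

    reachable-within : ∀ {E : L → V × V} {S u w} → Conn E S u w → Conn E (λ e → S e × In E (Conn E S u) e) u w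
    reachable-within {E} {S} {u} = go nil
      where
      go : ∀ {x w} → Conn E S u x → Conn E S x w → Conn E (λ e → S e × In E (Conn E S u) e) x w
      go ρ nil = nil
      go ρ (cons s l π) = cons (s , in-link l ρ (ρ ⋯ single s l)) l (go (ρ ⋯ single s l) π)

    module _ {E : L → V × V} {A : L → Set} (A? : Decidable A) where

      tight-KBase : ∀ {U c} → KBase E A c → Tight E A U c → KBase E (within E A U) c
      tight-KBase kb tight = record
        { acyclic  = λ j → acyc-⊆ (λ ((a , _) , eq) → a , eq) (KBase.acyclic kb j)
        ; spanning = λ j (_ , i) l → let uU , wU = in-ends l i in tight j uU wU }

      -- Under `c` the edges inside `U` split into `k` bases. The classes of `c′` inside `U` are
      -- acyclic, and the same total number of edges forces them to span as well.
      tight-transfer : ∀ {U c c′} → Decidable U → KBase E A c → Tight E A U c → KBase E A c′ → Tight E A U c′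
      tight-transfer {U} U? kb tight kb′ j uU wU =
        KBase.spanning-conn (acyclic⇒KBase (within? E A? U?) (tight-KBase kb tight)
                              (λ j → acyc-⊆ (λ ((a , _) , eq) → a , eq) (KBase.acyclic kb′ j))) j
          (conn-⊆ proj₁ (tight j uU wU))

      -- Two points of the intersection are joined by a unique path of each forest, which therefore
      -- stays in both sets.
      tight-∩ : ∀ {U U′ c} → Decidable U → Decidable U′ → KBase E A c → Tight E A U c → Tight E A U′ c →
                Tight E A (λ x → U x × U′ x) c
      tight-∩ {U} {U′} {c} U? U′? kb tight tight′ j (uU , uU′) (wU , wU′) =
        conn-⊆ (λ (((a , i₁ , i₂) , eq) , ((_ , i₁′ , i₂′) , _)) → (a , (i₁ , i₁′) , (i₂ , i₂′)) , eq)
          (conn-∩ (KBase.acyclic kb j) (cls? (within? E A? U?) c j) (cls? (within? E A? U′?) c j)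
             (λ ((a , _) , eq) → a , eq) (λ ((a , _) , eq) → a , eq) (tight j uU wU) (tight′ j uU′ wU′))

      record TightBetween (c : L → Fin k) (a b d : V) : Set₁ where
        field
          {U}   : V → Set
          U?    : Decidable U
          tight : Tight E A U c
          a∈U   : U a
          b∈U   : U b
          d∉U   : ¬ U d

      Side : (L → Fin k) → Fin k → L → V → V → Set
      Side c i ℓ b = Conn E (cls A c i ∖ ℓ) b

      side? : ∀ c i ℓ b → Decidable (Side c i ℓ b)
      side? c i ℓ b = conn? (∖? (cls? A? c i) ℓ) b

      -- `g` lies on the path of `T` from the tip of `h` to `b`, so its removal cuts the tip off
      -- from `b`. The edge `h` taken in its place only joins the part cut off to a vertex outside
      -- `U`; the side of `b` loses the tip and gains nothing.
      exchange-crossings : ∀ {c ℓ b d i j u} → KBase E A c → A ℓ → c ℓ ≡ i → Link E ℓ b d → Side c i ℓ b u →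
        j ≢ i → (X : Crossing (cls A c j) (Conn E (cls (within E A (Side c i ℓ b)) c j) u) u b) →
        Crossing (cls A c i ∖ ℓ) (Conn E (cls A c j ∖ Crossing.edge X) (Crossing.tip X)) (Crossing.tip X) b →
        ∃ λ c′ → c′ ℓ ≡ i × KBase E A c′ × card (side? c′ i ℓ b) < card (side? c i ℓ b)
      exchange-crossings {c} {ℓ} {b} {d} {i} {j} {u} kb aℓ cℓ lℓ uU j≢i X Y = c′ , c′ℓ , kb′ , smaller
        where
        open KBase kb
        T = cls A c i ∖ ℓ
        U = Conn E T b

        module X = Crossing X
        h = X.edge
        tip∈U : U X.tip
        tip∈U = within-stays X.inside uU
        -- Otherwise `h` would run inside `U` and enlarge the component that it leaves.
        tail∉U : ¬ U X.tail
        tail∉U tU = X.outside (X.inside ⋯ single ((proj₁ X.member , in-link {U = U} X.ends tip∈U tU) , proj₂ X.member) X.ends)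
        module Y = Crossing Y
        g = Y.edge
        cg : c g ≡ i
        cg = proj₂ (proj₁ Y.member)
        ch : c h ≡ j
        ch = proj₂ X.member
        c≢ : c g ≢ c h
        c≢ eq = j≢i (trans (sym ch) (trans (sym eq) cg))
        g-cuts : ¬ Conn E (T ∖ g) b X.tip
        g-cuts π = acyclic i (proj₁ Y.member) Y.ends
          (conn-⊆ (λ ((t , _) , ne) → t , ne) (rev Y.before ⋯ rev π ⋯ rev Y.after))

        fits₁ : ¬ Conn E (cls A c i ∖ g) X.tip X.tail
        fits₁ π with split ℓ π
        ... | inj₁ ρ = tail∉U (tip∈U ⋯ conn-⊆ (λ ((t , _) , ne) → t , ne) ρ)
        ... | inj₂ (x , y , l , ρ , _) with link-unique l lℓ
        ...   | inj₁ (refl , refl) = g-cuts (rev (conn-⊆ (λ ((t , ne) , ne′) → (t , ne′) , ne) ρ))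
        ...   | inj₂ (refl , refl) = acyclic i (aℓ , cℓ) lℓ (tip∈U ⋯ conn-⊆ (λ ((t , _) , ne) → t , ne) ρ)

        fits₂ : ¬ Conn E (cls A c j ∖ h) Y.tip Y.tail
        fits₂ π = Y.outside (Y.inside ⋯ π)

        c′ = swap c g h
        kb′ : KBase E A c′
        kb′ = swap-KBase c≢ A? kb Y.ends X.ends
          (subst (λ x → ¬ Conn E (cls A c x ∖ g) X.tip X.tail) (sym cg) fits₁)
          (subst (λ x → ¬ Conn E (cls A c x ∖ h) Y.tip Y.tail) (sym ch) fits₂)
        c′ℓ : c′ ℓ ≡ i
        c′ℓ = trans (swap-other c (λ ℓ≡g → proj₂ Y.member (sym ℓ≡g)) (λ ℓ≡h → j≢i (trans (sym ch) (trans (cong c (sym ℓ≡h)) cℓ)))) cℓ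

        shrinks : ∀ {x} → Conn E (cls A c′ i ∖ ℓ) b x → Conn E (T ∖ g) b x
        shrinks π with split h (conn-⊆ lemma π)
          where
          lemma : cls A c′ i ∖ ℓ ⊆ (T ∖ g) ⊕ h
          lemma {f} (s , ne) with swap-cls₁ {A = A} {c = c} {g = g} {h = h} c≢ (subst (λ x → cls A c′ x f) (sym cg) s)
          ... | inj₁ ((a , eq) , ne′) = inj₁ (((a , trans eq cg) , ne) , ne′)
          ... | inj₂ eq               = inj₂ eq
        ... | inj₁ ρ = conn-⊆ (λ { (inj₁ t , _) → t ; (inj₂ eq , ne) → contradiction eq ne }) ρ
        ... | inj₂ (x , y , l , ρ , σ) with link-unique l X.ends | conn-⊆ (λ { (inj₁ t , _) → t ; (inj₂ eq , ne) → contradiction eq ne }) ρ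
        ...   | inj₁ (refl , refl) | τ = contradiction τ g-cuts
        ...   | inj₂ (refl , refl) | τ = contradiction (conn-⊆ proj₁ τ) tail∉U

        smaller : card (side? c′ i ℓ b) < card (side? c i ℓ b)
        smaller = card-mono-< (side? c′ i ℓ b) (side? c i ℓ b) (λ _ π → conn-⊆ proj₁ (shrinks π)) X.tip tip∈U (λ π → g-cuts (shrinks π))

      -- If the base of colour j is not connected inside the side U, some h in it leaves U with b beyond h,
      -- and exchanging h with an edge g of the base of ℓ makes the side smaller.
      shrink-side : ∀ {c ℓ b d i j u} → KBase E A c → A ℓ → c ℓ ≡ i → Link E ℓ b d → Side c i ℓ b u →
        ¬ Conn E (cls (within E A (Side c i ℓ b)) c j) b u →
        ∃ λ c′ → c′ ℓ ≡ i × KBase E A c′ × card (side? c′ i ℓ b) < card (side? c i ℓ b)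
      shrink-side {c} {ℓ} {b} {d} {i} {j} {u} kb aℓ cℓ lℓ uU ¬bu = exchange-crossings kb aℓ cℓ lℓ uU j≢i X
        (crossing (∖? (cls? A? c i) ℓ) (conn? (∖? (cls? A? c j) X.edge) X.tip) nil
           (λ π → acyclic j X.member X.ends (π ⋯ rev X.after)) (rev (within-stays X.inside uU)))
        where
        open KBase kb
        j≢i : j ≢ i
        j≢i refl = ¬bu (conn-⊆ (λ (((a , eq) , _) , inside) → (a , inside) , eq) (reachable-within uU))
        X : Crossing (cls A c j) (Conn E (cls (within E A (Side c i ℓ b)) c j) u) u b
        X = crossing (cls? A? c j) (conn? (cls? (within? E A? (side? c i ℓ b)) c j) u) nil (λ π → ¬bu (rev π))
              (rev (conn-map (λ ((a , _) , _) l → spanning j a l) uU))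
        module X = Crossing X

      -- The side of `b` is shrunk until `a` drops out of it or no exchange is left; in the latter
      -- case every base is connected on it, so it is tight. The first outcome is the condition for
      -- moving `ℓ` from `b d` to `b a`.
      separate : ∀ {c ℓ b d} → KBase E A c → A ℓ → Link E ℓ b d → ∀ a →
        ∃ λ c′ → KBase E A c′ × (¬ Conn E (cls A c′ (c′ ℓ) ∖ ℓ) b a ⊎ TightBetween c′ a b d)
      separate {c₀} {ℓ} {b} {d} kb₀ aℓ lℓ a = go _ c₀ refl kb₀ ≤-refl
        where
        i = c₀ ℓ
        go : ∀ n c → c ℓ ≡ i → KBase E A c → card (side? c i ℓ b) ≤ n →
             ∃ λ c′ → KBase E A c′ × (¬ Conn E (cls A c′ (c′ ℓ) ∖ ℓ) b a ⊎ TightBetween c′ a b d)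
        go n c cℓ kb le = case side? c i ℓ b a of λ where
            (no ¬ba) → c , kb , inj₁ (subst (λ j → ¬ Conn E (cls A c j ∖ ℓ) b a) (sym cℓ) ¬ba)
            (yes ba) → case disconnected? of λ where
              (no none) → c , kb , inj₂ (stuck none ba)
              (yes (j , u , uU , ¬bu)) → recurse n le (shrink-side kb aℓ cℓ lℓ uU ¬bu)
          where
          disconnected? = some? λ j → some? λ u →
            side? c i ℓ b u ×-dec ¬? (conn? {E = E} (cls? (within? E A? (side? c i ℓ b)) c j) b u)
          stuck : ¬ (∃₂ λ j u → Side c i ℓ b u × ¬ Conn E (cls (within E A (Side c i ℓ b)) c j) b u) →
                  Side c i ℓ b a → TightBetween c a b d
          stuck none ba = record
            { U? = side? c i ℓ b ; tight = λ j uU wU → rev (conn j uU) ⋯ conn j wU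
            ; a∈U = ba ; b∈U = nil ; d∉U = λ bd → KBase.acyclic kb i (aℓ , cℓ) lℓ bd }
            where
            conn : ∀ j {u} → Side c i ℓ b u → Conn E (cls (within E A (Side c i ℓ b)) c j) b u
            conn j {u} uU = decidable-stable (conn? (cls? (within? E A? (side? c i ℓ b)) c j) b u)
                                             (λ ¬π → none (j , u , uU , ¬π))
          recurse : ∀ n → card (side? c i ℓ b) ≤ n →
            (∃ λ c′ → c′ ℓ ≡ i × KBase E A c′ × card (side? c′ i ℓ b) < card (side? c i ℓ b)) →
            ∃ λ c′ → KBase E A c′ × (¬ Conn E (cls A c′ (c′ ℓ) ∖ ℓ) b a ⊎ TightBetween c′ a b d)
          recurse zero    le (_  , _   , _   , smaller) = contradiction (≤-trans smaller le) λ ()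
          recurse (suc n) le (c′ , cℓ′ , kb′ , smaller) = go n c′ cℓ′ kb′ (s≤s⁻¹ (≤-trans smaller le))

  -- Adjacency of colourings

  module _ {L : Set} ⦃ fL : Finite L ⦄ where

    Adj : (L → Set) → (L → Fin k) → (L → Fin k) → Set
    Adj A c c′ = ∃₂ λ i j → ∀ {e} → A e → (c e ≡ i → c′ e ≡ j) × (c′ e ≡ j → c e ≡ i)

    record Step (E : L → V × V) (A : L → Set) (c c′ : L → Fin k) : Set where
      constructor step
      field
        source   : KBase E A c
        target   : KBase E A c′
        adjacent : Adj A c c′

    Linked : (L → V × V) → (L → Set) → (L → Fin k) → (L → Fin k) → Set
    Linked E A = Star (Step E A)

    linked-sym : ∀ {E A c c′} → Linked E A c c′ → Linked E A c′ c
    linked-sym = Star.reverse λ (step s t (i , j , f)) →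
      step t s (j , i , λ a → proj₂ (f a) , proj₁ (f a))

    -- A third colour is untouched by the swap; this is where k ≥ 3 enters.
    swap-adj : ∀ {A} (c : L → Fin k) g h → c g ≢ c h → Adj A c (swap c g h)
    swap-adj {A} c g h c≢ with third (c g) (c h)
    ... | l , l≢g , l≢h = l , l , λ a →
      (λ eq → proj₂ (swap-cls-other⁻ {A = A} {c = c} {g = g} {h = h} c≢ l≢g l≢h (a , eq))) ,
      (λ eq → proj₂ (swap-cls-other {A = A} {c = c} {g = g} {h = h} c≢ l≢g l≢h (a , eq)))

    opaque
      recolour : (L → Fin k) → L → Fin k → (L → Fin k)
      recolour c g j f with f ≟ g
      ... | yes _ = j
      ... | no _  = c f

      recolour-at : ∀ c g j → recolour c g j g ≡ j
      recolour-at c g j with g ≟ g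
      ... | yes _ = refl
      ... | no ne = contradiction refl ne

      recolour-other : ∀ c {g j f} → f ≢ g → recolour c g j f ≡ c f
      recolour-other c {g} {j} {f} f≢g with f ≟ g
      ... | yes eq = contradiction eq f≢g
      ... | no _   = refl

  first-edge : ∀ {L : Set} {E : L → V × V} {S u w} → Conn E S u w → u ≢ w → ∃₂ λ e z → S e × Link E e u z
  first-edge nil u≢w          = contradiction refl u≢w
  first-edge (cons s l _) u≢w = _ , _ , s , l

  -- Splitting off a vertex and lifting k-bases

  module AtVertex {L : Set} ⦃ fL : Finite L ⦄ (E : L → V × V) {A : L → Set} (A? : Decidable A)
    {X₀ : L → Fin k} (kb₀ : KBase E A X₀) (v : V) where

    loopless : ∀ {e u w} → A e → Link E e u w → u ≢ w
    loopless {e} a l refl = KBase.acyclic kb₀ (X₀ e) (a , refl) l nil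

    Star-v : L → Set
    Star-v e = A e × (proj₁ (E e) ≡ v ⊎ proj₂ (E e) ≡ v)

    star? : Decidable Star-v
    star? e = A? e ×-dec ((_ ≟ v) ⊎-dec (_ ≟ v))

    Off : L → Set
    Off e = A e × ¬ Star-v e

    off? : Decidable Off
    off? e = A? e ×-dec ¬? (star? e)

    opaque
      far : L → V
      far e with proj₁ (E e) ≟ v
      ... | yes _ = proj₂ (E e)
      ... | no _  = proj₁ (E e)

      far-link : ∀ {e} → Star-v e → Link E e v (far e)
      far-link {e} (a , eqs) with proj₁ (E e) ≟ v
      ... | yes refl = along refl
      ... | no ne    = case eqs of λ where
        (inj₁ eq)   → contradiction eq ne
        (inj₂ refl) → against refl

    star-intro : ∀ {e w} → A e → Link E e v w → Star-v e
    star-intro a (along eq)   = a , inj₁ (cong proj₁ eq)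
    star-intro a (against eq) = a , inj₂ (cong proj₂ eq)

    far≢v : ∀ {e} → Star-v e → far e ≢ v
    far≢v s eq = loopless (proj₁ s) (far-link s) (sym eq)

    off-ends : ∀ {e u w} → Off e → Link E e u w → u ≢ v × w ≢ v
    off-ends (a , ¬s) l = (λ { refl → ¬s (star-intro a l) }) , (λ { refl → ¬s (star-intro a (flip-link l)) })

    isolated : ∀ {S w} → S ⊆ A → (∀ {e} → S e → ¬ Star-v e) → w ≢ v → ¬ Conn E S v w
    isolated S⊆A none w≢v π with first-edge π (λ eq → w≢v (sym eq))
    ... | e , _ , s , l = none s (star-intro (S⊆A s) l)

    far-far : ∀ {a b} → Star-v a → Star-v b → Conn E A (far a) (far b)
    far-far a b = cons (proj₁ a) (flip-link (far-link a)) (single (proj₁ b) (far-link b))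

    meets-star : ∀ {X e₀} → KBase E A X → Star-v e₀ → ∀ i → ∃ λ f → Star-v f × X f ≡ i
    meets-star kb s i with first-edge (KBase.spanning kb i (proj₁ s) (far-link s)) (λ eq → far≢v s (sym eq))
    ... | f , _ , (a , eq) , l = f , star-intro a l , eq

    module Pairings (t : ℕ) where

      Pairing : Set
      Pairing = Fin t → Bool → L

      record Matching (P : Pairing) : Set where
        field
          at-star   : ∀ p x → Star-v (P p x)
          injective : ∀ {p q x y} → P p x ≡ P q y → p ≡ q × x ≡ y

      Free : Pairing → L → Set
      Free P e = Star-v e × ∀ p x → P p x ≢ e

      Split-ends : Pairing → L ⊎ Fin t → V × V
      Split-ends P = [ E , (λ p → far (P p false) , far (P p true)) ]′

      Split-edges : L ⊎ Fin t → Set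
      Split-edges = [ Off , (λ _ → ⊤) ]′

      split-edges? : Decidable Split-edges
      split-edges? (inj₁ e) = off? e
      split-edges? (inj₂ p) = yes tt

      drop₁ : ∀ {P e u w} → Link (Split-ends P) (inj₁ e) u w → Link E e u w
      drop₁ (along eq)   = along eq
      drop₁ (against eq) = against eq

      lift₁ : ∀ {P e u w} → Link E e u w → Link (Split-ends P) (inj₁ e) u w
      lift₁ (along eq)   = along eq
      lift₁ (against eq) = against eq

      pair-link : ∀ P p x → Link (Split-ends P) (inj₂ p) (far (P p x)) (far (P p (not x)))
      pair-link P p false = along refl
      pair-link P p true  = against refl

      -- The graph obtained from G by deleting v and joining the far ends of each pair of P, together with
      -- a family D of spanning forests of it.
      record Splitting (P : Pairing) (D : L ⊎ Fin t → Fin k) : Set where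
        field
          acyclic  : ∀ j → Acyc (Split-ends P) (cls Split-edges D j)
          spanning : ∀ j {u w} → u ≢ v → w ≢ v → Conn E A u w → Conn (Split-ends P) (cls Split-edges D j) u w

      module _ {P : Pairing} (mP : Matching P) where
        open Matching mP

        splitting⇒KBase : ∀ {D} → Splitting P D → KBase (Split-ends P) Split-edges D
        splitting⇒KBase sp = record { acyclic = Splitting.acyclic sp ; spanning = span }
          where
          span : ∀ j {e u w} → Split-edges e → Link (Split-ends P) e u w → Conn (Split-ends P) (cls Split-edges _ j) u w
          span j {inj₁ e} o l = let u≢v , w≢v = off-ends o (drop₁ {P} l) in
            Splitting.spanning sp j u≢v w≢v (single (proj₁ o) (drop₁ {P} l))
          span j {inj₂ p} _ l = link-conn (pair-link P p false) l
            (Splitting.spanning sp j (far≢v (at-star p false)) (far≢v (at-star p true))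
               (far-far (at-star p false) (at-star p true)))

        -- `Splitting` measures spanning against connections in the whole graph, passages through
        -- `v` included. The given splitting shows that the split edges realise all of these, so
        -- another `k`-base of the split graph does too.
        KBase⇒splitting : ∀ {D D′} → Splitting P D → KBase (Split-ends P) Split-edges D′ → Splitting P D′
        KBase⇒splitting sp kb = record
          { acyclic  = KBase.acyclic kb
          ; spanning = λ j u≢v w≢v π → conn-map (λ (a , _) l → KBase.spanning kb j a l) (Splitting.spanning sp j u≢v w≢v π) }

      -- X arises from D by replacing the pairs in each D_j by star edges of those pairs; the remaining star
      -- edges extend the members of D without pairs.
      record Lift (P : Pairing) (D : L ⊎ Fin t → Fin k) (X : L → Fin k) : Set where
        field
          off : ∀ {e} → Off e → X e ≡ D (inj₁ e)
          at  : ∀ {e} → Star-v e → (∃₂ λ p x → P p x ≡ e × D (inj₂ p) ≡ X e) ⊎ (∀ p → D (inj₂ p) ≢ X e)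

      -- Named after `v`: in a lift that is a `k`-base, `v` meets only one edge of such a colour.
      Leaf : (L ⊎ Fin t → Fin k) → Fin k → Set
      Leaf D i = ∀ p → D (inj₂ p) ≢ i

      leaf? : ∀ D → Decidable (Leaf D)
      leaf? D i = every? (λ p → ¬? (D (inj₂ p) ≟ i))

      not-leaf : ∀ {D i} → ¬ Leaf D i → ∃ λ p → D (inj₂ p) ≡ i
      not-leaf {D} {i} ¬leaf with counterexample (λ p → ¬? (D (inj₂ p) ≟ i)) ¬leaf
      ... | p , ¬¬eq = p , decidable-stable (D (inj₂ p) ≟ i) ¬¬eq

      module _ {P D X} (lf : Lift P D X) where
        open Lift lf

        leaf-conn : ∀ {i S u w} → Leaf D i → (∀ {e} → Off e → X e ≡ i → S e) →
                    Conn (Split-ends P) (cls Split-edges D i) u w → Conn E S u w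
        leaf-conn {i} {S} leaf into = conn-map move
          where
          move : ∀ {e u w} → cls Split-edges D i e → Link (Split-ends P) e u w → Conn E S u w
          move {inj₁ e} (o , eq) l = single (into o (trans (off o) eq)) (drop₁ {P} l)
          move {inj₂ p} (_ , eq) l = contradiction eq (leaf p)

        -- Without pairs, this member of `D` connects the far ends by edges off `v`, so a second
        -- edge at `v` would close a cycle.
        leaf-unique : ∀ {i e f} → Splitting P D → KBase E A X → Leaf D i →
                      Star-v e → Star-v f → X e ≡ i → X f ≡ i → e ≡ f
        leaf-unique {i} {e} {f} sp kb leaf se sf refl Xf with e ≟ f
        ... | yes e≡f = e≡f
        ... | no e≢f  = contradiction
          (cons ((proj₁ sf , Xf) , λ f≡e → e≢f (sym f≡e)) (far-link sf)
            (leaf-conn leaf (λ o eq → (proj₁ o , eq) , λ { refl → proj₂ o se })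
              (Splitting.spanning sp i (far≢v sf) (far≢v se) (far-far sf se))))
          (KBase.acyclic kb i (proj₁ se , refl) (far-link se))

        free-leaf : ∀ {e} → Free P e → Leaf D (X e)
        free-leaf (s , free) = case at s of λ where
          (inj₁ (p , x , eq , _)) → contradiction eq (free p x)
          (inj₂ leaf)             → leaf

        -- Removing `e` isolates `v` in its forest, so `b` can always enter there; only the
        -- condition on the forest of `b` remains.
        leaf-swap : ∀ {b e} → Splitting P D → KBase E A X → Star-v b → Star-v e → X b ≢ X e → Leaf D (X e) →
                    ¬ Conn E (cls A X (X b) ∖ b) v (far e) → KBase E A (swap X b e) × Linked E A X (swap X b e)
        leaf-swap {b} {e} sp kb sb se X≢ leaf ¬π = kb′ , step kb kb′ (swap-adj X b e X≢) ◅ ε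
          where
          kb′ = swap-KBase X≢ A? kb (far-link sb) (far-link se) ¬π
            (isolated (λ ((a , _) , _) → a)
              (λ ((_ , eq) , ne) s → ne (leaf-unique sp kb leaf s se eq refl)) (far≢v sb))

        swap-off : ∀ {b e f} → Star-v b → Star-v e → Off f → swap X b e f ≡ D (inj₁ f)
        swap-off sb se o = trans (swap-other X (λ { refl → proj₂ o sb }) (λ { refl → proj₂ o se })) (off o)

        lift-swap : ∀ {b e} → Star-v b → Star-v e →
          (∃₂ λ p x → P p x ≡ b × D (inj₂ p) ≡ X e) ⊎ Leaf D (X e) →
          (∃₂ λ p x → P p x ≡ e × D (inj₂ p) ≡ X b) ⊎ Leaf D (X b) → Lift P D (swap X b e)
        lift-swap {b} {e} sb se b-ok e-ok = record { off = swap-off sb se ; at = at′ }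
          where
          Ok : L → Fin k → Set
          Ok f i = (∃₂ λ p x → P p x ≡ f × D (inj₂ p) ≡ i) ⊎ Leaf D i
          at′ : ∀ {f} → Star-v f → Ok f (swap X b e f)
          at′ {f} s with swap-view X b e f
          ... | first refl eq   = subst (Ok f) (sym eq) b-ok
          ... | second refl eq  = subst (Ok f) (sym eq) e-ok
          ... | other _ _ eq    = subst (Ok f) (sym eq) (at s)

        -- A free edge has a leaf colour in every lift, and two leaf colours can trade their only
        -- edges at `v`.
        to-leaf : ∀ {e i} → Splitting P D → KBase E A X → Free P e → Leaf D i →
                  ∃ λ X′ → KBase E A X′ × Lift P D X′ × X′ e ≡ i × Linked E A X X′
        to-leaf {e} {i} sp kb free leaf with X e ≟ i
        ... | yes eq = X , kb , lf , eq , ε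
        ... | no ne with meets-star kb (proj₁ free) i
        ...   | f , sf , refl = _ , proj₁ swapped , lift-swap (proj₁ free) sf (inj₂ leaf) (inj₂ (free-leaf free))
                              , swap-first X e f , proj₂ swapped
          where
          swapped = leaf-swap sp kb (proj₁ free) sf ne leaf
            (isolated (λ ((a , _) , _) → a)
              (λ ((_ , eq) , ne) s → ne (leaf-unique sp kb (free-leaf free) s (proj₁ free) eq refl)) (far≢v sf))

      -- Some edge of `B` rejoins the two parts into which the forest of `b` falls without `b`. Off
      -- `v`, `B` runs inside that forest, so the edge found lies at `v`.
      exchange-edge : ∀ {X b B} → KBase E A X → Star-v b → Conn E B v (far b) → B ⊆ A →
        (∀ {f} → B f → ¬ Star-v f → X f ≡ X b) →
        ∃ λ f → B f × Star-v f × (X f ≡ X b → f ≡ b) × ¬ Conn E (cls A X (X b) ∖ b) v (far f)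
      exchange-edge {X} {b} kb sb π B⊆A same
        with conn-cross (∖? (cls? A? X (X b)) b) π (KBase.acyclic kb (X b) (proj₁ sb , refl) (far-link sb))
      ... | f , bf , crosses = f , bf , sf , f≡b , crosses (far-link sf)
        where
        f≡b : X f ≡ X b → f ≡ b
        f≡b eq = decidable-stable (f ≟ b) λ ne → crosses (link f) (single ((B⊆A bf , eq) , ne) (link f))
        sf : Star-v f
        sf = decidable-stable (star? f) λ ¬s → ¬s (subst Star-v (sym (f≡b (same bf ¬s))) sb)

      -- Lifts for a fixed pairing

      module _ {P D D′} (mP : Matching P) (sp : Splitting P D) (sp′ : Splitting P D′) {e₀} (free : Free P e₀) where

        -- The class shared by `D` and `D′` is shared by the lifts as soon as its edges at `v`
        -- agree. If it has no pair, its only edge at `v` is made `e₀` in both lifts; otherwise the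
        -- second lift is aligned with the first.
        link-adjacent : Adj Split-edges D D′ → ∀ {X X′} → KBase E A X → KBase E A X′ →
                        Lift P D X → Lift P D′ X′ → Linked E A X X′
        link-adjacent (i , j , same) {X} {X′} kb kb′ lf lf′ with leaf? D i
        ... | yes leaf = leaf-case (to-leaf lf sp kb free leaf) (to-leaf lf′ sp′ kb′ free leaf′)
          where
          leaf′ : Leaf D′ j
          leaf′ p eq = leaf p (proj₂ (same {inj₂ p} tt) eq)
          leaf-case : (∃ λ Y → KBase E A Y × Lift P D Y × Y e₀ ≡ i × Linked E A X Y) →
                      (∃ λ Y → KBase E A Y × Lift P D′ Y × Y e₀ ≡ j × Linked E A X′ Y) → Linked E A X X′
          leaf-case (Y , kY , lY , eqY , XY) (Y′ , kY′ , lY′ , eqY′ , XY′) =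
            XY ◅◅ step kY kY′ (i , j , λ a → there a , back a) ◅ linked-sym XY′
            where
            there : ∀ {e} → A e → Y e ≡ i → Y′ e ≡ j
            there {e} a eq with star? e
            ... | yes s = trans (cong Y′ (leaf-unique lY sp kY leaf s (proj₁ free) eq eqY)) eqY′
            ... | no ¬s = trans (Lift.off lY′ (a , ¬s)) (proj₁ (same (a , ¬s)) (trans (sym (Lift.off lY (a , ¬s))) eq))
            back : ∀ {e} → A e → Y′ e ≡ j → Y e ≡ i
            back {e} a eq with star? e
            ... | yes s = trans (cong Y (leaf-unique lY′ sp′ kY′ leaf′ s (proj₁ free) eq eqY′)) eqY
            ... | no ¬s = trans (Lift.off lY (a , ¬s)) (proj₂ (same (a , ¬s)) (trans (sym (Lift.off lY′ (a , ¬s))) eq))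
        ... | no ¬leaf = align _ kb′ lf′ ≤-refl
          where
          wrong? : ∀ Y → Decidable (λ e → Star-v e × Y e ≡ j × X e ≢ i)
          wrong? Y e = star? e ×-dec (Y e ≟ j) ×-dec ¬? (X e ≟ i)

          -- The star edges of the j-th base of Y are exchanged, one at a time, for those of the i-th base of X.
          align : ∀ n {Y} → KBase E A Y → Lift P D′ Y → card (wrong? Y) ≤ n → Linked E A X Y
          align n {Y} kY lY le with some? (wrong? Y)
          ... | no none = step kb kY (i , j , λ a → there a , back a) ◅ ε
            where
            back : ∀ {e} → A e → Y e ≡ j → X e ≡ i
            back {e} a eq with star? e
            ... | yes s = decidable-stable (X e ≟ i) λ ne → none (e , s , eq , ne)
            ... | no ¬s = trans (Lift.off lf (a , ¬s)) (proj₂ (same (a , ¬s)) (trans (sym (Lift.off lY (a , ¬s))) eq))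
            -- By `back` the base in `Y` is contained in the one in `X`, and a spanning subset of a
            -- forest omits no edge.
            there : ∀ {e} → A e → X e ≡ i → Y e ≡ j
            there {e} a eq = decidable-stable (Y e ≟ j) λ ne →
              KBase.acyclic kb i (a , eq) (link e)
                (conn-⊆ (λ (a , eqY) → (a , back a eqY) , λ { refl → ne eqY }) (KBase.spanning kY j a (link e)))
          ... | yes (b , sb , refl , Xb) with exchange-edge kY sb (KBase.spanning kb i (proj₁ sb) (far-link sb)) proj₁
              (λ (a , eq) ¬s → trans (Lift.off lY (a , ¬s)) (proj₁ (same (a , ¬s)) (trans (sym (Lift.off lf (a , ¬s))) eq)))
          ...   | f , (_ , Xf) , sf , f≡b , ¬π with Lift.at lf sf | Lift.at lY sf
          ...     | inj₂ leaf | _ = contradiction (subst (Leaf D) Xf leaf) ¬leaf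
          -- `f` is an end of a pair with colour `i` in `D`, hence `j` in `D′`. If `Y` gave it the
          -- colour of that pair, it would be `b`, but `b` does not have colour `i` in `X`. So `f`
          -- has a leaf colour in `Y`.
          ...     | inj₁ (p , x , refl , Dp) | inj₁ (p′ , x′ , eq , D′p′)
                  with refl ← proj₁ (Matching.injective mP eq) =
                  contradiction (trans (sym (cong X (f≡b (trans (sym D′p′) (proj₁ (same {inj₂ p} tt) (trans Dp Xf)))))) Xf) Xb
          ...     | inj₁ (p , x , refl , Dp) | inj₂ leaf = recurse n le
            where
            Yf≢ : Y b ≢ Y (P p x)
            Yf≢ eq = Xb (trans (sym (cong X (f≡b (sym eq)))) Xf)
            swapped = leaf-swap lY sp′ kY sb sf Yf≢ leaf ¬π
            lift′ : Lift P D′ (swap Y b (P p x))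
            lift′ = lift-swap lY sb sf (inj₂ leaf) (inj₁ (p , x , refl , proj₁ (same {inj₂ p} tt) (trans Dp Xf)))
            smaller : card (wrong? (swap Y b (P p x))) < card (wrong? Y)
            smaller = card-mono-< (wrong? (swap Y b (P p x))) (wrong? Y) shrink b (sb , refl , Xb)
                        (λ (_ , eq , _) → Yf≢ (sym (trans (sym (swap-first Y b (P p x))) eq)))
              where
              shrink : ∀ e → Star-v e × swap Y b (P p x) e ≡ Y b × X e ≢ i → Star-v e × Y e ≡ Y b × X e ≢ i
              shrink e (s , eq , ne) with swap-view Y b (P p x) e
              ... | first refl _     = s , refl , ne
              ... | second refl _    = contradiction Xf ne
              ... | other _ _ eq′    = s , trans (sym eq′) eq , ne
            recurse : ∀ n → card (wrong? Y) ≤ n → Linked E A X Y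
            recurse zero    le = contradiction (≤-trans smaller le) λ ()
            recurse (suc n) le = align n (proj₁ swapped) lift′ (s≤s⁻¹ (≤-trans smaller le))
                                   ◅◅ linked-sym (proj₂ swapped)

  -- Existence of lifts

  module WithPairs {L : Set} ⦃ fL : Finite L ⦄ (E : L → V × V) {A : L → Set} (A? : Decidable A)
    {X₀ : L → Fin k} (kb₀ : KBase E A X₀) (v : V) (t : ℕ)
    (degree : card (AtVertex.star? E A? kb₀ v) ≡ k + t) (t<k : t < k) where

    open AtVertex E A? kb₀ v
    open Pairings t

    covered? : (P : Pairing) → ∀ e → Dec (∃₂ λ p x → P p x ≡ e)
    covered? P e = map′ (λ { (p , inj₁ eq) → p , false , eq ; (p , inj₂ eq) → p , true , eq })
                        (λ { (p , false , eq) → p , inj₁ eq ; (p , true , eq) → p , inj₂ eq })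
                        (some? (λ p → (P p false ≟ e) ⊎-dec (P p true ≟ e)))

    -- The pairs cover at most 2 t of the k + t edges at `v`.
    free-exists : ∀ P → ∃ (Free P)
    free-exists P with some? (λ e → star? e ×-dec ¬? (covered? P e))
    ... | yes (e , s , ¬c) = e , s , λ p x eq → ¬c (p , x , eq)
    ... | no none = contradiction t<k (≤⇒≯ (+-cancelʳ-≤ t k t (begin
      k + t                                      ≡⟨ degree ⟨
      card star?                                 ≤⟨ card-∪ (image? false) (image? true) star? cover ⟩
      card (image? false) + card (image? true)   ≤⟨ +-mono-≤ (card-image _) (card-image _) ⟩
      t + t                                      ∎)))
      where
      open ≤-Reasoning
      image? : ∀ x → Decidable (λ e → ∃ λ p → P p x ≡ e)
      image? x e = some? (λ p → P p x ≟ e)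
      cover : ∀ e → Star-v e → (∃ λ p → P p false ≡ e) ⊎ (∃ λ p → P p true ≡ e)
      cover e s with covered? P e
      ... | yes (p , false , eq) = inj₁ (p , eq)
      ... | yes (p , true  , eq) = inj₂ (p , eq)
      ... | no ¬c                = contradiction (e , s , ¬c) none

    leaf-exists : ∀ D → ∃ (Leaf D)
    leaf-exists D with some? (leaf? D)
    ... | yes found = found
    ... | no none   = contradiction t<k (≤⇒≯ (Fin.injective⇒≤ {f = λ i → proj₁ (pair i)}
        λ {i} {j} eq → trans (sym (proj₂ (pair i))) (trans (cong (D ∘ inj₂) eq) (proj₂ (pair j)))))
      where
      pair : ∀ i → ∃ λ p → D (inj₂ p) ≡ i
      pair i = not-leaf {D = D} (λ leaf → none (i , leaf))

    module Existence {P D} (mP : Matching P) (sp : Splitting P D) where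
      open Matching mP

      -- An intermediate stage: a class may contain cycles through `v` or may miss `v`, but a class
      -- that meets `v` already spans.
      record Cover (X : L → Fin k) : Set where
        field
          lift   : Lift P D X
          joined : ∀ p x → Conn E (cls A X (D (inj₂ p))) v (far (P p x))
        open Lift lift public

      Met : (L → Fin k) → Fin k → Set
      Met X i = ∃ λ f → Star-v f × X f ≡ i

      met? : ∀ X → Decidable (Met X)
      met? X i = some? (λ f → star? f ×-dec (X f ≟ i))

      met-spanning : ∀ {X i} → Cover X → Met X i → ∀ {e u w} → A e → Link E e u w → Conn E (cls A X i) u w
      met-spanning {X} {i} cov (f , sf , Xf) a l = go a l
        where
        off-v : ∀ {u w} → u ≢ v → w ≢ v → Conn E A u w → Conn E (cls A X i) u w
        off-v u≢v w≢v π = conn-map move (Splitting.spanning sp i u≢v w≢v π)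
          where
          move : ∀ {e u w} → cls Split-edges D i e → Link (Split-ends P) e u w → Conn E (cls A X i) u w
          move {inj₁ e} (o , eq) l    = single (proj₁ o , trans (Cover.off cov o) eq) (drop₁ {P} l)
          move {inj₂ p} (_ , refl) l  = link-conn (pair-link P p false) l
            (rev (Cover.joined cov p false) ⋯ Cover.joined cov p true)
        from-v : ∀ {w} → w ≢ v → Conn E A v w → Conn E (cls A X i) v w
        from-v w≢v π = cons (proj₁ sf , Xf) (far-link sf)
          (off-v (far≢v sf) w≢v (cons (proj₁ sf) (flip-link (far-link sf)) π))
        go : ∀ {e u w} → A e → Link E e u w → Conn E (cls A X i) u w
        go {u = u} {w} a l with u ≟ v | w ≟ v
        ... | yes refl | _        = from-v (λ eq → loopless a l (sym eq)) (single a l)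
        ... | no u≢v   | yes refl = rev (from-v u≢v (single a (flip-link l)))
        ... | no u≢v   | no w≢v   = off-v u≢v w≢v (single a l)

      cover-acyclic : ∀ {X i} → Cover X → Acyc E (λ e → cls A X i e × ¬ Star-v e)
      cover-acyclic {X} {i} cov {e} ((a , eq) , ¬s) l π = Splitting.acyclic sp i {inj₁ e} ((a , ¬s) , inD a eq ¬s) (lift₁ {P} l)
        (conn-map (λ (((a , eq) , ¬s) , ne) l → single (((a , ¬s) , inD a eq ¬s) , λ eq → ne (inj₁-injective eq)) (lift₁ {P} l)) π)
        where
        inD : ∀ {f} → A f → X f ≡ i → ¬ Star-v f → D (inj₁ f) ≡ i
        inD a eq ¬s = trans (sym (Cover.off cov (a , ¬s))) eq

      start : L → Fin k
      start e with star? e | covered? P e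
      ... | no _  | _           = D (inj₁ e)
      ... | yes _ | yes (p , _) = D (inj₂ p)
      -- All free edges start with one common leaf colour, as a lift permits; the colours that still
      -- miss `v` receive an edge later.
      ... | yes _ | no _        = proj₁ (leaf-exists D)

      start-cover : Cover start
      start-cover = record { lift = record { off = off ; at = at } ; joined = joined }
        where
        off : ∀ {e} → Off e → start e ≡ D (inj₁ e)
        off {e} o with star? e
        ... | yes s = contradiction s (proj₂ o)
        ... | no _  = refl
        at : ∀ {e} → Star-v e → (∃₂ λ p x → P p x ≡ e × D (inj₂ p) ≡ start e) ⊎ Leaf D (start e)
        at {e} s with star? e | covered? P e
        ... | no ¬s | _                  = contradiction s ¬s
        ... | yes _ | yes (p , x , eq)   = inj₁ (p , x , eq , refl)
        ... | yes _ | no _               = inj₂ (proj₂ (leaf-exists D))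
        colour : ∀ p x → start (P p x) ≡ D (inj₂ p)
        colour p x with star? (P p x) | covered? P (P p x)
        ... | no ¬s | _                 = contradiction (at-star p x) ¬s
        ... | yes _ | yes (q , y , eq)  = cong (D ∘ inj₂) (proj₁ (injective eq))
        ... | yes _ | no ¬c             = contradiction (p , x , refl) ¬c
        joined : ∀ p x → Conn E (cls A start (D (inj₂ p))) v (far (P p x))
        joined p x = single (proj₁ (at-star p x) , colour p x) (far-link (at-star p x))

      unmet-leaf : ∀ {X i} → Cover X → ¬ Met X i → Leaf D i
      unmet-leaf cov unmet p refl with first-edge (Cover.joined cov p false) (λ eq → far≢v (at-star p false) (sym eq))
      ... | f , _ , (a , eq) , l = unmet (f , star-intro a l , eq)

      -- A class without star edges is smaller than a base, so some other class is larger than one and can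
      -- spare a star edge.
      spare-edge : ∀ {X i} → Cover X → ¬ Met X i →
        ∃ λ e → Star-v e × Conn E (cls A X (X e) ∖ e) (proj₁ (E e)) (proj₂ (E e))
      spare-edge {X} {i} cov unmet = large (∑-balance (trans (∑-fibres A? X) (sym (∑-fibres A? X₀))) i small)
        where
        e₀ = proj₁ (free-exists P)
        s₀ = proj₁ (proj₂ (free-exists P))
        base? : ∀ j → Decidable (cls A X j)
        base? = cls? A? X
        class-off : cls A X i ⊆ (λ e → cls A X i e × ¬ Star-v e)
        class-off (a , eq) = (a , eq) , λ s → unmet (_ , s , eq)
        small : card (base? i) < card (cls? A? X₀ i)
        small = <-≤-trans
          (card-mono-< (base? i) (⊕? (base? i) e₀) (λ _ → inj₁) e₀ (inj₂ refl) (λ (_ , eq) → unmet (e₀ , s₀ , eq)))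
          (steinitz (⊕? (base? i) e₀) (cls? A? X₀ i)
            (acyc-⊕ (acyc-⊆ class-off (cover-acyclic cov)) (far-link s₀)
              (isolated proj₁ (λ (_ , eq) s → unmet (_ , s , eq)) (far≢v s₀)))
            λ { (inj₁ (a , _)) l → KBase.spanning kb₀ i a l ; (inj₂ refl) l → KBase.spanning kb₀ i (proj₁ s₀) l })
        large : (∃ λ j → card (cls? A? X₀ j) < card (base? j)) →
          ∃ λ e → Star-v e × Conn E (cls A X (X e) ∖ e) (proj₁ (E e)) (proj₂ (E e))
        -- Extending from the edges off `v` forces the redundant edge to lie at `v`.
        large (j , lt) with extend-acyclic {E = E} (λ e → base? j e ×-dec ¬? (star? e)) (base? j) proj₁ (cover-acyclic cov)
        ... | B , B? , F⊆B , B⊆S , acycB , spans with some? (λ e → base? j e ×-dec ¬? (B? e))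
        ...   | no none = contradiction lt (≤⇒≯ (≤-trans
                  (card-mono (base? j) B? (λ e s → decidable-stable (B? e) (λ ¬b → none (e , s , ¬b))))
                  (steinitz B? (cls? A? X₀ j) acycB (λ b l → KBase.spanning kb₀ j (proj₁ (B⊆S b)) l))))
        ...   | yes (e , (a , refl) , ¬b) = e , s , conn-⊆ (λ b → B⊆S b , λ { refl → ¬b b }) (spans (a , refl) (link e))
          where
          s : Star-v e
          s = decidable-stable (star? e) (λ ¬s → ¬b (F⊆B ((a , refl) , ¬s)))

      module _ {X i e} (cov : Cover X) (leaf : Leaf D i) (s : Star-v e)
               (π : Conn E (cls A X (X e) ∖ e) (proj₁ (E e)) (proj₂ (E e))) where

        recolour-keeps : ∀ {j} → cls A X j ∖ e ⊆ cls A (recolour X e i) j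
        recolour-keeps ((a , eq) , ne) = a , trans (recolour-other X ne) eq

        recolour-detour : ∀ {j f u w} → cls A X j f → Link E f u w → Conn E (cls A (recolour X e i) j) u w
        recolour-detour {f = f} t l = case f ≟ e of λ where
          (yes refl) → link-conn (link e) l
            (conn-⊆ (λ ((a , eq) , ne) → recolour-keeps ((a , trans eq (proj₂ t)) , ne)) π)
          (no f≢e)   → single (recolour-keeps (t , f≢e)) l

        recolour-cover : Cover (recolour X e i)
        recolour-cover = record { lift = record { off = off ; at = at }
                                ; joined = λ p x → conn-map recolour-detour (Cover.joined cov p x) }
          where
          off : ∀ {f} → Off f → recolour X e i f ≡ D (inj₁ f)
          off o = trans (recolour-other X (λ { refl → proj₂ o s })) (Cover.off cov o)
          at : ∀ {f} → Star-v f →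
               (∃₂ λ p x → P p x ≡ f × D (inj₂ p) ≡ recolour X e i f) ⊎ Leaf D (recolour X e i f)
          at {f} sf = case f ≟ e of λ where
            (yes refl) → inj₂ (subst (Leaf D) (sym (recolour-at X e i)) leaf)
            (no f≢e)   → subst (λ j → (∃₂ λ p x → P p x ≡ f × D (inj₂ p) ≡ j) ⊎ Leaf D j)
                               (sym (recolour-other X f≢e)) (Cover.at cov sf)

        -- The class that loses `e` still meets `v`, since the detour around `e` leaves `v` along
        -- another edge.
        recolour-met : ∀ {j} → Met X j → Met (recolour X e i) j
        recolour-met {j} (f , sf , Xf) =
          met (first-edge (recolour-detour (proj₁ sf , Xf) (far-link sf)) (λ eq → far≢v sf (sym eq)))
          where
          met : (∃₂ λ g z → cls A (recolour X e i) j g × Link E g v z) → Met (recolour X e i) j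
          met (g , _ , (a , eq) , l) = g , star-intro a l , eq

      meet-leaf : ∀ {X i} → Cover X → ¬ Met X i →
                  ∃ λ X′ → Cover X′ × Met X′ i × (∀ {j} → Met X j → Met X′ j)
      meet-leaf {X} {i} cov unmet =
        let e , s , π = spare-edge cov unmet
            leaf = unmet-leaf cov unmet
        in recolour X e i , recolour-cover cov leaf s π , (e , s , recolour-at X e i) , recolour-met cov leaf s π

      lift-exists : ∃ λ X → KBase E A X × Lift P D X
      lift-exists = go _ start-cover ≤-refl
        where
        unmet? : ∀ X → Decidable (λ i → ¬ Met X i)
        unmet? X i = ¬? (met? X i)
        go : ∀ n {X} → Cover X → card (unmet? X) ≤ n → ∃ λ X → KBase E A X × Lift P D X
        smaller : ∀ {X i} → ¬ Met X i → (found : ∃ λ X′ → Cover X′ × Met X′ i × (∀ {j} → Met X j → Met X′ j)) →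
                  card (unmet? (proj₁ found)) < card (unmet? X)
        smaller {X} {i} unmet (X′ , _ , met , mono) =
          card-mono-< (unmet? X′) (unmet? X) (λ j ¬m m → ¬m (mono m)) i unmet (λ ¬m → ¬m met)
        recurse : ∀ n {X i} → Cover X → ¬ Met X i → card (unmet? X) ≤ n →
                  (∃ λ X′ → Cover X′ × Met X′ i × (∀ {j} → Met X j → Met X′ j)) → ∃ λ X → KBase E A X × Lift P D X
        go n {X} cov le = case some? (unmet? X) of λ where
          (no none)         → X , spanning⇒KBase A? kb₀ (λ i a l →
            met-spanning cov (decidable-stable (met? X i) (λ ¬m → none (i , ¬m))) a l) , Cover.lift cov
          (yes (i , unmet)) → recurse n cov unmet le (meet-leaf cov unmet)
        recurse zero {X} cov unmet le found = contradiction (≤-trans (smaller {X} unmet found) le) λ ()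
        recurse (suc n) {X} cov unmet le found@(X′ , cov′ , _) = go n cov′ (s≤s⁻¹ (≤-trans (smaller {X} unmet found) le))

    -- Replacing one end of a pair

    data ReplaceView (P : Pairing) (p : Fin t) (x : Bool) (c : L) (q : Fin t) (y : Bool) (r : L) : Set where
      new : q ≡ p → y ≡ x → r ≡ c → ReplaceView P p x c q y r
      old : ¬ (q ≡ p × y ≡ x) → r ≡ P q y → ReplaceView P p x c q y r

    opaque
      replace : Pairing → Fin t → Bool → L → Pairing
      replace P p x c q y with q ≟ p | y Bool.≟ x
      ... | yes _ | yes _ = c
      ... | yes _ | no _  = P q y
      ... | no _  | _     = P q y

      replace-view : ∀ P p x c q y → ReplaceView P p x c q y (replace P p x c q y)
      replace-view P p x c q y with q ≟ p | y Bool.≟ x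
      ... | yes q≡p | yes y≡x = new q≡p y≡x refl
      ... | yes _   | no y≢x  = old (λ (_ , eq) → y≢x eq) refl
      ... | no q≢p  | _       = old (λ (eq , _) → q≢p eq) refl

    replace-at : ∀ P p x c → replace P p x c p x ≡ c
    replace-at P p x c with replace-view P p x c p x
    ... | new _ _ eq = eq
    ... | old ne _   = contradiction (refl , refl) ne

    replace-old : ∀ P p x c {q y} → ¬ (q ≡ p × y ≡ x) → replace P p x c q y ≡ P q y
    replace-old P p x c {q} {y} ne with replace-view P p x c q y
    ... | new eq eq′ _ = contradiction (eq , eq′) ne
    ... | old _ eq     = eq

    replace-other : ∀ P p x c {q} → q ≢ p → ∀ y → replace P p x c q y ≡ P q y
    replace-other P p x c q≢p y = replace-old P p x c (λ (eq , _) → q≢p eq)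

    not≢ : ∀ {x} → not x ≢ x
    not≢ {false} ()
    not≢ {true} ()

    replace-partner : ∀ P p x c → replace P p x c p (not x) ≡ P p (not x)
    replace-partner P p x c = replace-old P p x c (λ (_ , eq) → not≢ eq)

    module _ {P : Pairing} {p : Fin t} {x : Bool} {c : L} (mP : Matching P) (free : Free P c) where
      open Matching mP

      matching-replace : Matching (replace P p x c)
      matching-replace = record { at-star = star ; injective = inj }
        where
        star : ∀ q y → Star-v (replace P p x c q y)
        star q y with replace-view P p x c q y
        ... | new _ _ eq = subst Star-v (sym eq) (proj₁ free)
        ... | old _ eq   = subst Star-v (sym eq) (at-star q y)
        inj : ∀ {q r y z} → replace P p x c q y ≡ replace P p x c r z → q ≡ r × y ≡ z
        inj {q} {r} {y} {z} eq with replace-view P p x c q y | replace-view P p x c r z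
        ... | new refl refl _ | new refl refl _ = refl , refl
        ... | new _ _ eq₁     | old _ eq₂       = contradiction (trans (sym eq₂) (trans (sym eq) eq₁)) (proj₂ free r z)
        ... | old _ eq₁       | new _ _ eq₂     = contradiction (trans (sym eq₁) (trans eq eq₂)) (proj₂ free q y)
        ... | old _ eq₁       | old _ eq₂       = injective (trans (sym eq₁) (trans eq eq₂))

      free-replaced : Free (replace P p x c) (P p x)
      free-replaced = at-star p x , avoid
        where
        avoid : ∀ q y → replace P p x c q y ≢ P p x
        avoid q y eq with replace-view P p x c q y
        ... | new _ _ eq′ = proj₂ free p x (trans (sym eq) eq′)
        ... | old ne eq′  = ne (injective (trans (sym eq′) eq))

      free-stays : ∀ {e} → Free P e → e ≢ c → Free (replace P p x c) e
      free-stays {e} (s , avoid) e≢c = s , avoid′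
        where
        avoid′ : ∀ q y → replace P p x c q y ≢ e
        avoid′ q y eq with replace-view P p x c q y
        ... | new _ _ eq′ = e≢c (trans (sym eq) eq′)
        ... | old _ eq′   = avoid q y (trans (sym eq′) eq)

      lift-replaced : ∀ {D X} → Lift P D X → X (P p x) ≢ D (inj₂ p) → Lift (replace P p x c) D X
      lift-replaced {D} {X} lf ne = record { off = Lift.off lf ; at = at }
        where
        at : ∀ {e} → Star-v e → (∃₂ λ q y → replace P p x c q y ≡ e × D (inj₂ q) ≡ X e) ⊎ Leaf D (X e)
        at s with Lift.at lf s
        ... | inj₂ leaf              = inj₂ leaf
        ... | inj₁ (q , y , refl , Dq) = inj₁ (q , y
                , replace-old P p x c (λ { (refl , refl) → ne (sym Dq) }) , Dq)

      -- `X` fails to be a lift for the new pairing only if `b` has the colour of its old pair. Then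
      -- a lift `Y` for the new pairing points to an edge `f` that can take over from `b`. Its
      -- colour in `X` is a leaf, so after the swap `b` has a leaf colour, as a free edge must.
      link-replaced : ∀ {D X} → Splitting P D → Splitting (replace P p x c) D → KBase E A X → Lift P D X →
                      ∃ λ X′ → KBase E A X′ × Lift (replace P p x c) D X′ × Linked E A X X′
      link-replaced {D} {X} sp sp′ kb lf = case X b ≟ D (inj₂ p) of λ where
          (no ne)  → X , kb , lift-replaced lf ne , ε
          (yes Xb) → with-lift Xb (Existence.lift-exists matching-replace sp′)
        where
        b = P p x
        P′ = replace P p x c
        sb = at-star p x
        Goal = ∃ λ X′ → KBase E A X′ × Lift P′ D X′ × Linked E A X X′
        module _ (Xb : X b ≡ D (inj₂ p)) {Y} (kY : KBase E A Y) (lY : Lift P′ D Y) where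
          Yb≢ : Y b ≢ X b
          Yb≢ eq with Lift.at lY sb
          ... | inj₁ (q , y , eq′ , _) = proj₂ free-replaced q y eq′
          ... | inj₂ leaf              = leaf p (sym (trans eq Xb))
          module _ {f} (Yf : Y f ≡ X b) (sf : Star-v f) (f≡b : X f ≡ X b → f ≡ b)
                   (¬π : ¬ Conn E (cls A X (X b) ∖ b) v (far f)) where
            f≢b : f ≢ b
            f≢b refl = Yb≢ Yf
            Xf≢ : X b ≢ X f
            Xf≢ eq = f≢b (f≡b (sym eq))
            from-pair : ∃₂ λ q y → P′ q y ≡ f × D (inj₂ q) ≡ X b
            from-pair with Lift.at lY sf
            ... | inj₁ (q , y , eq , Dq) = q , y , eq , trans Dq Yf
            ... | inj₂ leaf              = contradiction (sym (trans Yf Xb)) (leaf p)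
            leaf-f : (∃₂ λ q y → P′ q y ≡ f × D (inj₂ q) ≡ X b) → Leaf D (X f)
            leaf-f (q , y , eq , Dq) with Lift.at lf sf | replace-view P p x c q y
            ... | inj₂ leaf                | _             = leaf
            ... | inj₁ (r , z , eq₂ , Dr)  | new _ _ eq₁   =
                  contradiction (trans eq₂ (trans (sym eq) eq₁)) (proj₂ free r z)
            ... | inj₁ (r , z , eq₂ , Dr)  | old _ eq₁     =
                  contradiction (trans (sym Dq) (trans (cong (D ∘ inj₂) (proj₁ (injective (trans (sym eq₁) (trans eq (sym eq₂)))))) Dr)) Xf≢
            exchange : (∃₂ λ q y → P′ q y ≡ f × D (inj₂ q) ≡ X b) → Leaf D (X f) → Goal
            exchange (q , y , eq , Dq) leaf = swap X b f , proj₁ swapped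
                , record { off = swap-off lf sb sf ; at = at } , proj₂ swapped
              where
              swapped = leaf-swap lf sp kb sb sf Xf≢ leaf ¬π
              Ok : L → Fin k → Set
              Ok e i = (∃₂ λ q y → P′ q y ≡ e × D (inj₂ q) ≡ i) ⊎ Leaf D i
              at : ∀ {e} → Star-v e → Ok e (swap X b f e)
              at {e} s with swap-view X b f e
              ... | first refl eq′    = inj₂ (subst (Leaf D) (sym eq′) leaf)
              ... | second refl eq′   = inj₁ (q , y , eq , trans Dq (sym eq′))
              ... | other e≢b _ eq′ with Lift.at lf s
              ...   | inj₂ leaf′               = inj₂ (subst (Leaf D) (sym eq′) leaf′)
              ...   | inj₁ (r , z , refl , Dr) = inj₁ (r , z
                      , replace-old P p x c (λ { (refl , refl) → e≢b refl }) , trans Dr (sym eq′))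
          exchanged : (∃ λ f → cls A Y (X b) f × Star-v f × (X f ≡ X b → f ≡ b) ×
                       ¬ Conn E (cls A X (X b) ∖ b) v (far f)) → Goal
          exchanged (f , (_ , Yf) , sf , f≡b , ¬π) =
            let pair = from-pair Yf sf f≡b ¬π in exchange Yf sf f≡b ¬π pair (leaf-f Yf sf f≡b ¬π pair)
        with-lift : X b ≡ D (inj₂ p) → (∃ λ Y → KBase E A Y × Lift P′ D Y) → Goal
        with-lift Xb (Y , kY , lY) = exchanged Xb kY lY
          (exchange-edge {X} {b} {cls A Y (X b)} kb sb (KBase.spanning kY (X b) (proj₁ sb) (far-link sb)) proj₁
            λ (a , eq) ¬s → trans (Lift.off lf (a , ¬s)) (trans (sym (Lift.off lY (a , ¬s))) eq))

      module _ {D} (sp : Splitting P D)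
               (¬π : ¬ Conn (Split-ends P) (cls Split-edges D (D (inj₂ p)) ∖ inj₂ p) (far (P p (not x))) (far c)) where

        new-link : Link (Split-ends (replace P p x c)) (inj₂ p) (far (P p (not x))) (far c)
        new-link = subst₂ (λ a b → Link (Split-ends (replace P p x c)) (inj₂ p) (far a) (far b))
          (replace-partner P p x c) (trans (cong (replace P p x c p) (not-involutive x)) (replace-at P p x c))
          (pair-link (replace P p x c) p (not x))

        same-ends : ∀ {S} → SameEnds (S ∖ inj₂ p) (Split-ends P) (Split-ends (replace P p x c))
        same-ends {e = inj₁ e} _        = refl
        same-ends {e = inj₂ q} (_ , ne) = cong₂ (λ a b → far a , far b) (sym (unmoved false)) (sym (unmoved true))
          where unmoved = replace-other P p x c {q} (λ eq → ne (cong inj₂ eq))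

        same-ends⁻ : ∀ {S} → SameEnds (S ∖ inj₂ p) (Split-ends (replace P p x c)) (Split-ends P)
        same-ends⁻ {S} s = sym (same-ends {S} s)

        conn-replaced : ∀ {S} → S ⊆ cls Split-edges D (D (inj₂ p)) → S (inj₂ p) →
          Conn (Split-ends P) S (far (P p (not x))) (far c) →
          ∀ {u w} → Conn (Split-ends P) S u w → Conn (Split-ends (replace P p x c)) S u w
        conn-replaced {S} S⊆ s π = conn-exchange (same-ends {S}) s new-link π
          (λ ρ → ¬π (conn-⊆ (λ (s , ne) → S⊆ s , ne) ρ))

        conn-kept : ∀ {S} → ¬ S (inj₂ p) →
          ∀ {u w} → Conn (Split-ends P) S u w → Conn (Split-ends (replace P p x c)) S u w
        conn-kept {S} ¬s π = conn-⊆ proj₁ (conn-same (same-ends {S}) (conn-⊆ (λ s → s , λ { refl → ¬s s }) π))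

        -- Only the forest of pair `p` changes, and by hypothesis the moved edge closes no cycle.
        -- Since `D` joins the partner to `far c`, necessarily through `p`, the moved edge restores
        -- every connection that the old one gave.
        splitting-replaced : Splitting (replace P p x c) D
        splitting-replaced = record { acyclic = acyc ; spanning = span }
          where
          acyc : ∀ j → Acyc (Split-ends (replace P p x c)) (cls Split-edges D j)
          acyc j with D (inj₂ p) ≟ j
          ... | yes refl = acyc-⊆ (∖-⊕ {S = cls Split-edges D j} (inj₂ p))
                (acyc-⊕ (acyc-same (same-ends {cls Split-edges D j}) (acyc-⊆ proj₁ (Splitting.acyclic sp j))) new-link
                  (λ π → ¬π (conn-same (same-ends⁻ {cls Split-edges D j}) π)))
          ... | no ne    = acyc-⊆ {T = cls Split-edges D j ∖ inj₂ p} (λ (a , eq) → (a , eq) , λ { refl → ne eq })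
                (acyc-same (same-ends {cls Split-edges D j}) (acyc-⊆ proj₁ (Splitting.acyclic sp j)))
          span : ∀ j {u w} → u ≢ v → w ≢ v → Conn E A u w → Conn (Split-ends (replace P p x c)) (cls Split-edges D j) u w
          span j u≢v w≢v π with D (inj₂ p) ≟ j
          ... | yes refl = conn-replaced id (tt , refl)
                (Splitting.spanning sp j (far≢v (at-star p (not x))) (far≢v (proj₁ free)) (far-far (at-star p (not x)) (proj₁ free)))
                (Splitting.spanning sp j u≢v w≢v π)
          ... | no ne    = conn-kept (λ (_ , eq) → ne eq) (Splitting.spanning sp j u≢v w≢v π)

    -- If both ends of the pair reached `w` without it, the pair would lie on a cycle. So a free
    -- edge can enter any given pair at one end at least.
    separated-end : ∀ {P D} → Splitting P D → ∀ p (w : V) →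
      ∃ λ x → ¬ Conn (Split-ends P) (cls Split-edges D (D (inj₂ p)) ∖ inj₂ p) (far (P p (not x))) w
    separated-end {P} {D} sp p w
      with conn? {E = Split-ends P} (∖? (cls? split-edges? D (D (inj₂ p))) (inj₂ p)) (far (P p true)) w
    ... | no ¬π = false , ¬π
    ... | yes π = true , λ ρ → Splitting.acyclic sp (D (inj₂ p)) {inj₂ p} (tt , refl) (pair-link P p true) (π ⋯ rev ρ)

    Member : Pairing → (L → Fin k) → Set
    Member P X = ∃ λ D → Splitting P D × KBase E A X × Lift P D X

    -- Reaching some member is enough, because all members for one pairing turn out to be linked.
    _⇛_ : Pairing → Pairing → Set
    P ⇛ Q = ∀ {X} → Member P X → ∃ λ Y → Member Q Y × Linked E A X Y

    ⇛-trans : ∀ {P Q R} → P ⇛ Q → Q ⇛ R → P ⇛ R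
    ⇛-trans f g m = let Y , m′ , l = f m ; Z , m″ , l′ = g m′ in Z , m″ , l ◅◅ l′

  -- Linking the lifts for different pairings

  module Alignment {L : Set} ⦃ fL : Finite L ⦄ (E : L → V × V) {A : L → Set} (A? : Decidable A)
    {X₀ : L → Fin k} (kb₀ : KBase E A X₀) (v : V) (t : ℕ)
    (degree : card (AtVertex.star? E A? kb₀ v) ≡ k + t) (t<k : t < k)
    (connected : ∀ {P} → AtVertex.Pairings.Matching E A? kb₀ v t P → ∀ {D D′} →
      KBase (AtVertex.Pairings.Split-ends E A? kb₀ v t P) (AtVertex.Pairings.Split-edges E A? kb₀ v t) D →
      KBase (AtVertex.Pairings.Split-ends E A? kb₀ v t P) (AtVertex.Pairings.Split-edges E A? kb₀ v t) D′ →
      Linked (AtVertex.Pairings.Split-ends E A? kb₀ v t P) (AtVertex.Pairings.Split-edges E A? kb₀ v t) D D′) where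

    open AtVertex E A? kb₀ v
    open Pairings t
    open WithPairs E A? kb₀ v t degree t<k

    members-linked : ∀ {P X Y} → Matching P → Member P X → Member P Y → Linked E A X Y
    members-linked {P} mP (D , sp , kX , lX) (D′ , sp′ , kY , lY) =
      go (connected mP (splitting⇒KBase mP sp) (splitting⇒KBase mP sp′)) sp kX lX
      where
      free = proj₂ (free-exists P)
      go : ∀ {D X} → Linked (Split-ends P) Split-edges D D′ → Splitting P D → KBase E A X → Lift P D X → Linked E A X _
      -- Two lifts of the same splitting may still differ. A splitting shares every class with
      -- itself, so any colour serves here.
      go {X = X} ε sp kX lX = link-adjacent mP sp sp′ free (i , i , λ _ → id , id) kX kY lX lY
        where i = X (proj₁ (free-exists P))
      go (step _ kD adj ◅ rest) sp kX lX =
        let sp₁ = KBase⇒splitting mP sp kD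
            Z , kZ , lZ = Existence.lift-exists mP sp₁
        in link-adjacent mP sp sp₁ free adj kX kZ lX lZ ◅◅ go rest sp₁ kZ lZ

    -- A single lift for `P` suffices as target: it moves to some member of `Q`, to which every
    -- other member of `Q` is linked.
    ⇛-sym : ∀ {P D Q} → Matching P → Splitting P D → Matching Q → P ⇛ Q → Q ⇛ P
    ⇛-sym mP sp mQ P⇛Q m =
      let X , kX , lX = Existence.lift-exists mP sp
          Y , m′ , XY = P⇛Q (_ , sp , kX , lX)
      in X , (_ , sp , kX , lX) , members-linked mQ m m′ ◅◅ linked-sym XY

    -- One splitting `D` that admits the replacement is enough, since every member of `P` is linked
    -- to a lift of this `D`.
    ⇛-replace : ∀ {P D p x c} → Matching P → (sp : Splitting P D) → (free : Free P c) →
      ¬ Conn (Split-ends P) (cls Split-edges D (D (inj₂ p)) ∖ inj₂ p) (far (P p (not x))) (far c) →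
      P ⇛ replace P p x c
    ⇛-replace mP sp free ¬π m =
      let sp′ = splitting-replaced mP free sp ¬π
          X , kX , lX = Existence.lift-exists mP sp
          Y , kY , lY , XY = link-replaced mP free sp sp′ kX lX
      in Y , (_ , sp′ , kY , lY) , members-linked mP m (_ , sp , kX , lX) ◅◅ XY

    module _ (π : Fin t → Fin t) (involutive : ∀ q → π (π q) ≡ q) where

      -- A `Pairing` labels and orients its pairs, which are unordered by nature; this relates two
      -- presentations of the same set of pairs. As `π` is an involution, one map serves both
      -- directions.
      Reordered : Pairing → Pairing → Set
      Reordered P P′ = ∀ q → (∀ x → P′ q x ≡ P (π q) x) ⊎ (∀ x → P′ q x ≡ P (π q) (not x))

      reordered-sym : ∀ {P P′} → Reordered P P′ → Reordered P′ P
      reordered-sym {P} r q with r (π q)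
      ... | inj₁ eq = inj₁ λ x → sym (trans (eq x) (cong (λ r → P r x) (involutive q)))
      ... | inj₂ eq = inj₂ λ x → sym (trans (eq (not x)) (cong₂ P (involutive q) (not-involutive x)))

      φ : L ⊎ Fin t → L ⊎ Fin t
      φ = [ inj₁ , inj₂ ∘ π ]′

      φ-involutive : ∀ e → φ (φ e) ≡ e
      φ-involutive (inj₁ e) = refl
      φ-involutive (inj₂ p) = cong inj₂ (involutive p)

      φ-split : ∀ {e} → Split-edges e → Split-edges (φ e)
      φ-split {inj₁ e} o = o
      φ-split {inj₂ p} _ = tt

      φ-link : ∀ {P P′} → Reordered P P′ → ∀ {e u w} → Link (Split-ends P′) e u w → Link (Split-ends P) (φ e) u w
      φ-link {P} {P′} r {inj₁ e} l = lift₁ {P} (drop₁ {P′} l)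
      φ-link {P} {P′} r {inj₂ q} l = case l of λ where
          (along refl)   → moved (r q)
          (against refl) → flip-link (moved (r q))
        where
        moved : (∀ x → P′ q x ≡ P (π q) x) ⊎ (∀ x → P′ q x ≡ P (π q) (not x)) →
                Link (Split-ends P) (inj₂ (π q)) (far (P′ q false)) (far (P′ q true))
        moved (inj₁ eq) = subst₂ (λ a b → Link (Split-ends P) (inj₂ (π q)) (far a) (far b))
                            (sym (eq false)) (sym (eq true)) (pair-link P (π q) false)
        moved (inj₂ eq) = subst₂ (λ a b → Link (Split-ends P) (inj₂ (π q)) (far a) (far b))
                            (sym (eq false)) (sym (eq true)) (pair-link P (π q) true)

      module _ {P P′} (r : Reordered P P′) where

        reordered-matching : Matching P → Matching P′
        reordered-matching mP = record { at-star = star ; injective = inj }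
          where
          open Matching mP
          star : ∀ q x → Star-v (P′ q x)
          star q x with r q
          ... | inj₁ eq = subst Star-v (sym (eq x)) (at-star (π q) x)
          ... | inj₂ eq = subst Star-v (sym (eq x)) (at-star (π q) (not x))
          π-injective : ∀ {q s} → π q ≡ π s → q ≡ s
          π-injective {q} {s} eq = trans (sym (involutive q)) (trans (cong π eq) (involutive s))
          not-injective′ : ∀ {x y} → not x ≡ not y → x ≡ y
          not-injective′ {x} {y} eq = trans (sym (not-involutive x)) (trans (cong not eq) (not-involutive y))
          inj : ∀ {q s x y} → P′ q x ≡ P′ s y → q ≡ s × x ≡ y
          inj {q} {s} {x} {y} eq with r q | r s
          ... | inj₁ f | inj₁ g with injective (trans (sym (f x)) (trans eq (g y)))
          ...   | πeq , xeq = π-injective πeq , xeq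
          inj {q} {s} {x} {y} eq | inj₂ f | inj₂ g with injective (trans (sym (f x)) (trans eq (g y)))
          ...   | πeq , xeq = π-injective πeq , not-injective′ xeq
          inj {q} {s} {x} {y} eq | inj₁ f | inj₂ g with injective (trans (sym (f x)) (trans eq (g y)))
          ...   | πeq , xeq with refl ← π-injective πeq =
                  contradiction (sym (proj₂ (injective (trans (sym (f x)) (g x))))) not≢
          inj {q} {s} {x} {y} eq | inj₂ f | inj₁ g with injective (trans (sym (f x)) (trans eq (g y)))
          ...   | πeq , xeq with refl ← π-injective πeq =
                  contradiction (proj₂ (injective (trans (sym (f x)) (g x)))) not≢

        reordered-splitting : ∀ {D} → Splitting P D → Splitting P′ (D ∘ φ)
        reordered-splitting {D} sp = record { acyclic = acyc ; spanning = span }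
          where
          acyc : ∀ j → Acyc (Split-ends P′) (cls Split-edges (D ∘ φ) j)
          acyc j {e} (s , eq) l π = Splitting.acyclic sp j (φ-split {e} s , eq) (φ-link {P} {P′} r l)
            (conn-map (λ {f} ((s , eq) , ne) l → single ((φ-split {f} s , eq) , λ φeq →
               ne (trans (sym (φ-involutive f)) (trans (cong φ φeq) (φ-involutive e)))) (φ-link {P} {P′} r l)) π)
          span : ∀ j {u w} → u ≢ v → w ≢ v → Conn E A u w → Conn (Split-ends P′) (cls Split-edges (D ∘ φ) j) u w
          span j u≢v w≢v π = conn-map (λ {f} (s , eq) l →
              single (φ-split {f} s , trans (cong D (φ-involutive f)) eq) (φ-link {P′} {P} (reordered-sym {P} {P′} r) l))
            (Splitting.spanning sp j u≢v w≢v π)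

        reordered-lift : ∀ {D X} → Lift P D X → Lift P′ (D ∘ φ) X
        reordered-lift {D} {X} lf = record { off = Lift.off lf ; at = at }
          where
          at : ∀ {e} → Star-v e → (∃₂ λ p x → P′ p x ≡ e × D (inj₂ (π p)) ≡ X e) ⊎ (∀ p → D (inj₂ (π p)) ≢ X e)
          at s with Lift.at lf s
          ... | inj₂ leaf = inj₂ (λ p → leaf (π p))
          ... | inj₁ (p , x , eq , Dp) with reordered-sym {P} {P′} r p
          ...   | inj₁ f = inj₁ (π p , x , trans (sym (f x)) eq , trans (cong (D ∘ inj₂) (involutive p)) Dp)
          ...   | inj₂ f = inj₁ (π p , not x , trans (sym (f x)) eq , trans (cong (D ∘ inj₂) (involutive p)) Dp)

        ⇛-reordered : P ⇛ P′
        ⇛-reordered (D , sp , kX , lX) = _ , (D ∘ φ , reordered-splitting sp , kX , reordered-lift lX) , ε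

    opaque
      transpose : Fin t → Fin t → Fin t → Fin t
      transpose p j q with q ≟ p | q ≟ j
      ... | yes _ | _     = j
      ... | no _  | yes _ = p
      ... | no _  | no _  = q

      transpose-left : ∀ p j → transpose p j p ≡ j
      transpose-left p j with p ≟ p
      ... | yes _ = refl
      ... | no ne = contradiction refl ne

      transpose-right : ∀ p j → transpose p j j ≡ p
      transpose-right p j with j ≟ p | j ≟ j
      ... | yes refl | _     = refl
      ... | no _     | yes _ = refl
      ... | no _     | no ne = contradiction refl ne

      transpose-other : ∀ {p j q} → q ≢ p → q ≢ j → transpose p j q ≡ q
      transpose-other {p} {j} {q} q≢p q≢j with q ≟ p | q ≟ j
      ... | yes eq | _      = contradiction eq q≢p
      ... | no _   | yes eq = contradiction eq q≢j
      ... | no _   | no _   = refl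

    transpose-involutive : ∀ p j q → transpose p j (transpose p j q) ≡ q
    transpose-involutive p j q with q ≟ p
    ... | yes refl = trans (cong (transpose p j) (transpose-left p j)) (transpose-right p j)
    ... | no q≢p with q ≟ j
    ...   | yes refl = trans (cong (transpose p j) (transpose-right p j)) (transpose-left p j)
    ...   | no q≢j   = trans (cong (transpose p j) (transpose-other q≢p q≢j)) (transpose-other q≢p q≢j)

    Agree : Pairing → Pairing → Fin t → Set
    Agree P Q p = ∀ x → P p x ≡ Q p x

    agree? : ∀ P Q → Decidable (Agree P Q)
    agree? P Q p = map′ (λ { (f , g) false → f ; (f , g) true → g }) (λ eq → eq false , eq true)
                        ((P p false ≟ Q p false) ×-dec (P p true ≟ Q p true))

    in-replaced : ∀ {P p x c U} → U (far c) → ∀ {e} → In (Split-ends P) U e → In (Split-ends (replace P p x c)) U e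
    in-replaced {P} {p} {x} {c} {U} uc {inj₁ e} i       = i
    in-replaced {P} {p} {x} {c} {U} uc {inj₂ q} (i , i′) = entry false i , entry true i′
      where
      entry : ∀ y → U (far (P q y)) → U (far (replace P p x c q y))
      entry y u with replace-view P p x c q y
      ... | new _ _ eq = subst (U ∘ far) (sym eq) uc
      ... | old _ eq   = subst (U ∘ far) (sym eq) u

    both : ∀ {P : Pairing} {U : V → Set} {p} x → U (far (P p x)) → U (far (P p (not x))) →
           ∀ y → U (far (P p y))
    both false u w false = u
    both false u w true  = w
    both true  u w false = w
    both true  u w true  = u

    TightIn : Pairing → (V → Set) → (L ⊎ Fin t → Fin k) → Set
    TightIn P = Tight (Split-ends P) Split-edges

    module _ {P D p x c} (mP : Matching P) (free : Free P c) (sp : Splitting P D)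
      (¬π : ¬ Conn (Split-ends P) (cls Split-edges D (D (inj₂ p)) ∖ inj₂ p) (far (P p (not x))) (far c))
      {U : V → Set} (tight : TightIn P U D) (uc : U (far c)) where

      private
        P′ : Pairing
        P′ = replace P p x c

        inside : Fin k → L ⊎ Fin t → Set
        inside = cls (within (Split-ends P) Split-edges U) D

        grown : ∀ {j} → inside j ⊆ cls (within (Split-ends P′) Split-edges U) D j
        grown {j} {e} ((a , i) , eq) = (a , in-replaced {P} {p} {x} {c} {U} uc {e} i) , eq

      -- Tightness joins the partner to `far c` inside `U`, so moving the pair costs no connection
      -- inside `U`.
      tight-replaced-inside : (∀ y → U (far (P p y))) → TightIn P′ U D
      tight-replaced-inside up j {u} {w} uU wU = case D (inj₂ p) ≟ j of λ where
        (yes refl) → conn-⊆ (λ {e} → grown {j} {e}) (conn-replaced mP free sp ¬π {inside j}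
            (λ ((a , _) , eq) → a , eq) ((tt , up false , up true) , refl) (tight j (up (not x)) uc) (tight j uU wU))
        (no ne)    → conn-⊆ (λ {e} → grown {j} {e}) (conn-kept mP free sp ¬π {inside j} (λ (_ , eq) → ne eq) (tight j uU wU))

      -- A pair that leaves `U` takes no part in the connections inside `U`.
      tight-replaced-across : ∀ {y} → ¬ U (far (P p y)) → TightIn P′ U D
      tight-replaced-across {y} ¬u j {u} {w} uU wU = conn-⊆ (λ {e} → grown {j} {e})
        (conn-kept mP free sp ¬π {inside j} (λ ((_ , i , i′) , _) → ¬u (end y i i′)) (tight j uU wU))
        where
        end : ∀ y → U (far (P p false)) → U (far (P p true)) → U (far (P p y))
        end false i _ = i
        end true  _ i = i

    module Toward {Q DQ} (mQ : Matching Q) (spQ : Splitting Q DQ) where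

      record Gain (P : Pairing) (j : Fin t) : Set where
        field
          {P⁺} : Pairing
          {D⁺} : L ⊎ Fin t → Fin k
          matching⁺  : Matching P⁺
          splitting⁺ : Splitting P⁺ D⁺
          reach      : P ⇛ P⁺
          keeps      : ∀ {q} → Agree P Q q → Agree P⁺ Q q
          gains      : Agree P⁺ Q j

      gain-after : ∀ {P P′ j} → P ⇛ P′ → (∀ {q} → Agree P Q q → Agree P′ Q q) → Gain P′ j → Gain P j
      gain-after P⇛P′ keep g = record
        { matching⁺ = G.matching⁺ ; splitting⁺ = G.splitting⁺ ; reach = ⇛-trans P⇛P′ G.reach
        ; keeps = G.keeps ∘ keep ; gains = G.gains }
        where module G = Gain g

      replace-keeps : ∀ {P p x c q} → ¬ Agree P Q p → Agree P Q q → Agree (replace P p x c) Q q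
      replace-keeps {P} {p} {x} {c} ¬agree agree y =
        trans (replace-other P p x c (λ { refl → ¬agree agree }) y) (agree y)

      -- Pair `j` of `Q` is present at index `p`, perhaps reversed. Exchanging the two indices
      -- spoils no agreement: `p` can agree with `Q` only if it is `j`.
      finish : ∀ {P D p z j x} → Matching P → Splitting P D →
               P p z ≡ Q j x → P p (not z) ≡ Q j (not x) → Gain P j
      finish {P} {D} {p} {z} {j} {x} mP sp eq eq′ = record
        { matching⁺ = reordered-matching π inv r mP ; splitting⁺ = reordered-splitting π inv r sp
        ; reach = ⇛-reordered π inv r ; keeps = keeps ; gains = at-j }
        where
        π = transpose p j
        inv = transpose-involutive p j
        choose : ∀ q → Dec (q ≡ j) → Bool → L
        choose q (yes _) = Q q
        choose q (no _)  = P (π q)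
        P′ : Pairing
        P′ q = choose q (q ≟ j)
        at-j : Agree P′ Q j
        at-j y with j ≟ j
        ... | yes _ = refl
        ... | no ne = contradiction refl ne
        at-other : ∀ {q} → q ≢ j → ∀ y → P′ q y ≡ P (π q) y
        at-other {q} ne y with q ≟ j
        ... | yes eq = contradiction eq ne
        ... | no _   = refl
        oriented : ∀ z x → P p z ≡ Q j x → P p (not z) ≡ Q j (not x) →
                   (∀ y → Q j y ≡ P p y) ⊎ (∀ y → Q j y ≡ P p (not y))
        oriented false false e e′ = inj₁ λ { false → sym e ; true → sym e′ }
        oriented false true  e e′ = inj₂ λ { false → sym e′ ; true → sym e }
        oriented true  false e e′ = inj₂ λ { false → sym e ; true → sym e′ }
        oriented true  true  e e′ = inj₁ λ { false → sym e′ ; true → sym e }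
        r : Reordered π inv P P′
        r q with q ≟ j
        ... | no _     = inj₁ (λ _ → refl)
        ... | yes refl = subst (λ s → (∀ y → Q q y ≡ P s y) ⊎ (∀ y → Q q y ≡ P s (not y)))
                           (sym (transpose-right p q)) (oriented z x eq eq′)
        keeps : ∀ {q} → Agree P Q q → Agree P′ Q q
        keeps {q} agree y with q ≟ j | q ≟ p
        ... | yes refl | _      = refl
        ... | no q≢j | no q≢p   = trans (cong (λ s → P s y) (transpose-other q≢p q≢j)) (agree y)
        ... | no q≢j | yes refl = contradiction (proj₁ (Matching.injective mQ (trans (sym (agree z)) eq))) q≢j

      -- Tightness makes the number of edges inside `U` as large for `P` as forests allow, so `Q`
      -- has no more of them. If all pairs of `P` inside `U` agreed with `Q`, then `Q` would have
      -- all those edges and its pair `j` in addition.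
      pair-inside : ∀ {P D U j} → Decidable U → Splitting P D → TightIn P U D → ¬ Agree P Q j →
                    (∀ x → U (far (Q j x))) → ∃ λ p → ¬ Agree P Q p × ∀ z → U (far (P p z))
      pair-inside {P} {D} {U} {j} U? sp tight ¬agree uQ
        with some? (λ p → ¬? (agree? P Q p) ×-dec U? (far (P p false)) ×-dec U? (far (P p true)))
      ... | yes (p , ¬a , u , u′) = p , ¬a , λ { false → u ; true → u′ }
      ... | no none = contradiction bound (<⇒≱ strict)
        where
        inP? = within? (Split-ends P) {Split-edges} {U} split-edges? U?
        inQ? = within? (Split-ends Q) {Split-edges} {U} split-edges? U?
        bound : card inQ? ≤ card inP?
        bound = ≤-trans (≤-reflexive (sym (∑-fibres inQ? DQ))) (≤-trans (∑-mono-≤ λ i →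
            steinitz {E = Split-ends Q} {Split-ends P} (cls? inQ? DQ i) (cls? inP? D i)
              (acyc-⊆ (λ ((a , _) , eq) → a , eq) (Splitting.acyclic spQ i))
              λ {e} ((_ , ins) , _) l → let uU , wU = in-ends {E = Split-ends Q} {U} l ins in tight i uU wU)
          (≤-reflexive (∑-fibres inP? D)))
        P⊆Q : ∀ e → within (Split-ends P) Split-edges U e → within (Split-ends Q) Split-edges U e
        P⊆Q (inj₁ e) s = s
        P⊆Q (inj₂ p) (_ , u , u′) =
          let agree = decidable-stable (agree? P Q p) (λ ¬a → none (p , ¬a , u , u′))
          in tt , subst (U ∘ far) (agree false) u , subst (U ∘ far) (agree true) u′
        strict : card inP? < card inQ?
        strict = card-mono-< inP? inQ? P⊆Q (inj₂ j) (tt , uQ false , uQ true) (λ (_ , u , u′) → none (j , ¬agree , u , u′))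

      free-disagrees : ∀ {P q x} → Free P (Q q x) → ¬ Agree P Q q
      free-disagrees {x = x} free agree = proj₂ free _ x (agree x)

      -- A pair of `P` that agrees with `Q` and contains one end of pair `j` is pair `j`, and would
      -- contain the free end too.
      partner-disagrees : ∀ {P j x i y} → Free P (Q j x) → P i y ≡ Q j (not x) → ¬ Agree P Q i
      partner-disagrees {P} {j} {x} {i} {y} free eq agree =
        proj₂ free j x (trans (sym (cong (λ q → P q x) i≡j)) (trans (agree x) (cong (λ q → Q q x) i≡j)))
        where i≡j = proj₁ (Matching.injective mQ (trans (sym (agree y)) eq))

      -- One round of the exchange: the pair p inside the tight set U gives up its end P p z to the pair i leaving U
      -- and takes a = Q j x instead; then b = Q j (not x) is free.
      module Round {P D} (mP : Matching P) (sp : Splitting P D) {j x i y}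
        (free : Free P (Q j x)) (eq : P i y ≡ Q j (not x))
        {U : V → Set} (tight : TightIn P U D) (ua : U (far (Q j x))) (ub : U (far (Q j (not x))))
        (¬uc : ¬ U (far (P i (not y)))) {p} (¬agree : ¬ Agree P Q p) (inside : ∀ z → U (far (P p z))) {z}
        (¬π : ¬ Conn (Split-ends P) (cls Split-edges D (D (inj₂ p)) ∖ inj₂ p) (far (P p (not z))) (far (Q j x))) where

        P₁ : Pairing
        P₁ = replace P p z (Q j x)

        m₁ : Matching P₁
        m₁ = matching-replace mP free

        sp₁ : Splitting P₁ D
        sp₁ = splitting-replaced mP free sp ¬π

        free₁ : Free P₁ (P p z)
        free₁ = free-replaced mP free

        tight₁ : TightIn P₁ U D
        tight₁ = tight-replaced-inside mP free sp ¬π tight ua inside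

        i≢p : i ≢ p
        i≢p refl = ¬uc (inside (not y))

        P₁i : ∀ w → P₁ i w ≡ P i w
        P₁i = replace-other P p z (Q j x) i≢p

        ¬uc₁ : ¬ U (far (P₁ i (not y)))
        ¬uc₁ u = ¬uc (subst (U ∘ far) (P₁i (not y)) u)

        outside-i : ∀ y → ¬ U (far (P₁ i y)) → ¬ In (Split-ends P₁) U (inj₂ i)
        outside-i false ¬u (u , _) = ¬u u
        outside-i true  ¬u (_ , u) = ¬u u

        -- Tightness joins `far (P p z)` inside `U` to the end of pair `i` in `U`, and not through
        -- pair `i`, which leaves `U`. A connection to its other end would close a cycle through
        -- pair `i`.
        ¬π₁ : ¬ Conn (Split-ends P₁) (cls Split-edges D (D (inj₂ i)) ∖ inj₂ i) (far (P₁ i (not y))) (far (P p z))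
        ¬π₁ ρ = Splitting.acyclic sp₁ (D (inj₂ i)) {inj₂ i} (tt , refl) (pair-link P₁ i (not y))
          (ρ ⋯ conn-⊆ (λ ((a , ins) , eq) → (a , eq) , λ { refl → outside-i (not y) ¬uc₁ ins })
                 (tight₁ (D (inj₂ i)) (inside z)
                   (subst (U ∘ far) (sym (trans (P₁i (not (not y))) (trans (cong (P i) (not-involutive y)) eq))) ub)))

        P₂ : Pairing
        P₂ = replace P₁ i y (P p z)

        m₂ : Matching P₂
        m₂ = matching-replace m₁ free₁

        sp₂ : Splitting P₂ D
        sp₂ = splitting-replaced m₁ free₁ sp₁ ¬π₁

        free₂ : Free P₂ (Q j (not x))
        free₂ = subst (Free P₂) (trans (P₁i y) eq) (free-replaced m₁ free₁)

        tight₂ : TightIn P₂ U D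
        tight₂ = tight-replaced-across m₁ free₁ sp₁ ¬π₁ tight₁ (inside z) {y = not y} ¬uc₁

        P₂p : ∀ w → P₂ p w ≡ P₁ p w
        P₂p = replace-other P₁ i y (P p z) (λ eq → i≢p (sym eq))

        P₂pz : P₂ p z ≡ Q j x
        P₂pz = trans (P₂p z) (replace-at P p z (Q j x))

        P₂pz′ : P₂ p z ≡ Q j (not (not x))
        P₂pz′ = trans P₂pz (cong (Q j) (sym (not-involutive x)))

        P₂p-not-z : P₂ p (not z) ≡ P p (not z)
        P₂p-not-z = trans (P₂p (not z)) (replace-partner P p z (Q j x))

        reach₂ : P ⇛ P₂
        reach₂ = ⇛-trans (⇛-replace mP sp free ¬π) (⇛-replace m₁ sp₁ free₁ ¬π₁)

        keeps₂ : ∀ {q} → Agree P Q q → Agree P₂ Q q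
        keeps₂ agree = replace-keeps
          (λ agree-i → partner-disagrees free eq (λ w → trans (sym (P₁i w)) (agree-i w))) (replace-keeps ¬agree agree)

        succeed : ∀ {D′} → Splitting P₂ D′ →
          ¬ Conn (Split-ends P₂) (cls Split-edges D′ (D′ (inj₂ p)) ∖ inj₂ p) (far (P₂ p z)) (far (Q j (not x))) → Gain P₂ j
        succeed {D′} sp′ ¬ρ = gain-after (⇛-replace m₂ sp′ free₂ ¬ρ′) (replace-keeps (partner-disagrees free₂ P₂pz′))
          (finish (matching-replace m₂ free₂) (splitting-replaced m₂ free₂ sp′ ¬ρ′)
            (trans (replace-old P₂ p (not z) _ (λ (_ , eq) → not≢ (sym eq))) P₂pz) (replace-at P₂ p (not z) _))
          where
          ¬ρ′ : ¬ Conn (Split-ends P₂) (cls Split-edges D′ (D′ (inj₂ p)) ∖ inj₂ p) (far (P₂ p (not (not z)))) (far (Q j (not x)))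
          ¬ρ′ = subst (λ w → ¬ Conn (Split-ends P₂) (cls Split-edges D′ (D′ (inj₂ p)) ∖ inj₂ p) (far (P₂ p w)) (far (Q j (not x))))
                  (sym (not-involutive z)) ¬ρ

      -- The bound `n` on the size of `U` drives the recursion. A round exchanges the roles of
      -- `Q j x` and `Q j (not x)`. If it yields another tight set instead of success, its
      -- intersection with `U` is strictly smaller, because the new set excludes a vertex of `U`.
      gain-tight : ∀ n {P D} → Matching P → Splitting P D → ∀ {j x i y} → Free P (Q j x) → P i y ≡ Q j (not x) →
        ∀ {U : V → Set} (U? : Decidable U) → TightIn P U D → U (far (Q j x)) → U (far (Q j (not x))) →
        ¬ U (far (P i (not y))) → card U? ≤ n → Gain P j
      gain-tight zero mP sp {j} {x} free eq {U} U? tight ua ub ¬uc le =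
        contradiction (≤-trans (card-mono-< {P = λ _ → ⊥} (λ _ → no id) U? (λ _ ()) (far (Q j x)) ua id) le) λ ()
      gain-tight (suc n) {P} {D} mP sp {j} {x} {i} {y} free eq {U} U? tight ua ub ¬uc le =
        let p , ¬agree , inside = pair-inside U? sp tight (free-disagrees {P} {j} {x} free) (both {Q} {U} {j} x ua ub)
            z , ¬π = separated-end sp p (far (Q j x))
        in round ¬agree inside ¬π
        where
        module _ {p} (¬agree : ¬ Agree P Q p) (inside : ∀ z → U (far (P p z))) {z}
          (¬π : ¬ Conn (Split-ends P) (cls Split-edges D (D (inj₂ p)) ∖ inj₂ p) (far (P p (not z))) (far (Q j x))) where
          open Round mP sp {j} {x} {i} {y} free eq {U} tight ua ub ¬uc {p} ¬agree inside {z} ¬π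

          kD : KBase (Split-ends P₂) Split-edges D
          kD = splitting⇒KBase m₂ sp₂

          recurse : ∀ {D′} → KBase (Split-ends P₂) Split-edges D′ →
            TightBetween {E = Split-ends P₂} split-edges? D′ (far (Q j (not x))) (far (P₂ p z)) (far (P₂ p (not z))) → Gain P₂ j
          recurse {D′} kD′ between = gain-tight n m₂ (KBase⇒splitting m₂ sp₂ kD′) {j} {not x} {p} {z} free₂ P₂pz′
              -- The new set is tight for `D′`, so the tightness of `U` is first carried over from
              -- `D`.
              U∩W? (tight-∩ split-edges? U? B.U? kD′ (tight-transfer split-edges? U? kD tight₂ kD′) B.tight)
              (ub , B.a∈U) (subst (λ w → U (far w) × B.U (far w)) P₂pz′ (subst (U ∘ far) (sym P₂pz) ua , B.b∈U))
              (λ (_ , w) → B.d∉U w) (s≤s⁻¹ (≤-trans smaller le))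
            where
            module B = TightBetween between
            U∩W? : Decidable (λ u → U u × B.U u)
            U∩W? u = U? u ×-dec B.U? u
            smaller : card U∩W? < card U?
            smaller = card-mono-< U∩W? U? (λ _ → proj₁) (far (P₂ p (not z)))
              (subst (U ∘ far) (sym P₂p-not-z) (inside (not z))) (λ (_ , w) → B.d∉U w)

          conclude : (∃ λ D′ → KBase (Split-ends P₂) Split-edges D′ ×
              (¬ Conn (Split-ends P₂) (cls Split-edges D′ (D′ (inj₂ p)) ∖ inj₂ p) (far (P₂ p z)) (far (Q j (not x))) ⊎
               TightBetween {E = Split-ends P₂} split-edges? D′ (far (Q j (not x))) (far (P₂ p z)) (far (P₂ p (not z))))) → Gain P j
          conclude (D′ , kD′ , inj₁ ¬ρ)      = gain-after reach₂ keeps₂ (succeed (KBase⇒splitting m₂ sp₂ kD′) ¬ρ)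
          conclude (D′ , kD′ , inj₂ between) = gain-after reach₂ keeps₂ (recurse kD′ between)

          round : Gain P j
          round = conclude (separate split-edges? {ℓ = inj₂ p} kD tt (pair-link P₂ p z) (far (Q j (not x))))

      gain-covered : ∀ {P D} → Matching P → Splitting P D → ∀ {j x i y} → Free P (Q j x) → P i y ≡ Q j (not x) → Gain P j
      gain-covered {P} {D} mP sp {j} {x} {i} {y} free eq =
        conclude (separate split-edges? {ℓ = inj₂ i} (splitting⇒KBase mP sp) tt (pair-link P i y) (far (Q j x)))
        where
        conclude : (∃ λ D′ → KBase (Split-ends P) Split-edges D′ ×
            (¬ Conn (Split-ends P) (cls Split-edges D′ (D′ (inj₂ i)) ∖ inj₂ i) (far (P i y)) (far (Q j x)) ⊎
             TightBetween {E = Split-ends P} split-edges? D′ (far (Q j x)) (far (P i y)) (far (P i (not y))))) → Gain P j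
        conclude (D′ , kD′ , inj₂ between) = gain-tight _ mP (KBase⇒splitting mP sp kD′) free eq B.U? B.tight B.a∈U
            (subst (B.U ∘ far) eq B.b∈U) B.d∉U ≤-refl
          where module B = TightBetween between
        conclude (D′ , kD′ , inj₁ ¬ρ) = gain-after (⇛-replace mP sp′ free ¬ρ′) (replace-keeps (partner-disagrees free eq))
            (finish {z = not y} {x = x} (matching-replace mP free) (splitting-replaced mP free sp′ ¬ρ′) (replace-at P i (not y) _)
              (trans (cong (replace P i (not y) (Q j x) i) (not-involutive y))
                (trans (replace-old P i (not y) _ (λ (_ , eq) → not≢ (sym eq))) eq)))
          where
          sp′ = KBase⇒splitting mP sp kD′
          ¬ρ′ : ¬ Conn (Split-ends P) (cls Split-edges D′ (D′ (inj₂ i)) ∖ inj₂ i) (far (P i (not (not y)))) (far (Q j x))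
          ¬ρ′ = subst (λ w → ¬ Conn (Split-ends P) (cls Split-edges D′ (D′ (inj₂ i)) ∖ inj₂ i) (far (P i w)) (far (Q j x)))
                  (sym (not-involutive y)) ¬ρ

      -- If both ends of pair `j` of `Q` are free in `P`, one of them is put into pair `j` of `P`.
      -- That pair disagrees with `Q` anyway, so no agreement is lost.
      gain-free : ∀ {P D} → Matching P → Splitting P D → ∀ {j x} → Free P (Q j x) → Gain P j
      gain-free {P} {D} mP sp {j} {x} free = case covered? P (Q j (not x)) of λ where
          (yes (i , y , eq)) → gain-covered mP sp {j} {x} free eq
          (no ¬c)            → take-partner (Matching.at-star mQ j (not x) , λ p y eq → ¬c (p , y , eq))
        where
        take-partner : Free P (Q j (not x)) → Gain P j
        take-partner free′ =
          let z , ¬π = separated-end sp j (far (Q j (not x)))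
          in gain-after (⇛-replace mP sp free′ ¬π) (replace-keeps (free-disagrees {P} {j} {x} free))
               (gain-covered (matching-replace mP free′) (splitting-replaced mP free′ sp ¬π) {j} {x} {j} {z}
                 (free-stays mP free′ free (λ eq → not≢ (sym (proj₂ (Matching.injective mQ eq)))))
                 (replace-at P j z (Q j (not x))))

    Wrong? : ∀ P Q → Decidable (λ p → ¬ Agree P Q p)
    Wrong? P Q p = ¬? (agree? P Q p)

    -- Induction on the number of wrong pairs. Both pairings vary, since a lack of free ends is
    -- cured by changing `Q`.
    pairings-linked : ∀ {P D Q DQ} → Matching P → Splitting P D → Matching Q → Splitting Q DQ → P ⇛ Q
    pairings-linked mP sp mQ spQ = go _ mP sp mQ spQ ≤-refl
      where
      Available : Pairing → Pairing → Set
      Available P Q = ∃₂ λ j x → ¬ Agree P Q j × Free P (Q j x)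

      available? : ∀ P Q → Dec (Available P Q)
      available? P Q = map′
        (λ { (j , ¬a , inj₁ f) → j , false , ¬a , f ; (j , ¬a , inj₂ f) → j , true , ¬a , f })
        (λ { (j , false , ¬a , f) → j , ¬a , inj₁ f ; (j , true , ¬a , f) → j , ¬a , inj₂ f })
        (some? λ j → Wrong? P Q j ×-dec (free? (Q j false) ⊎-dec free? (Q j true)))
        where
        free? : Decidable (Free P)
        free? e = map′ (λ (s , ¬c) → s , λ p x eq → ¬c (p , x , eq)) (λ (s , f) → s , λ (p , x , eq) → f p x eq)
                       (star? e ×-dec ¬? (covered? P e))

      go : ∀ n {P D Q DQ} → Matching P → Splitting P D → Matching Q → Splitting Q DQ → card (Wrong? P Q) ≤ n → P ⇛ Q
      advance : ∀ n {P D Q DQ} → Matching P → Splitting P D → (mQ : Matching Q) → Splitting Q DQ →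
                card (Wrong? P Q) ≤ n → Available P Q → P ⇛ Q

      advance zero {P} {D} {Q} mP sp mQ spQ le (j , _ , ¬a , _) =
        contradiction (≤-trans (card-mono-< {P = λ _ → ⊥} (λ _ → no id) (Wrong? P Q) (λ _ ()) j ¬a id) le) λ ()
      advance (suc n) {P} {D} {Q} mP sp mQ spQ le (j , x , ¬a , free) =
        ⇛-trans G.reach (go n G.matching⁺ G.splitting⁺ mQ spQ (s≤s⁻¹ (≤-trans smaller le)))
        where
        module G = Toward.Gain (Toward.gain-free mQ spQ mP sp {j} {x} free)
        smaller : card (Wrong? G.P⁺ Q) < card (Wrong? P Q)
        smaller = card-mono-< (Wrong? G.P⁺ Q) (Wrong? P Q) (λ _ ¬a a → ¬a (G.keeps a)) j ¬a (λ ¬a → ¬a G.gains)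

      go n {P} {D} {Q} {DQ} mP sp mQ spQ le = case available? P Q of λ where
          (yes av) → advance n mP sp mQ spQ le av
          (no ¬av) → case some? (Wrong? P Q) of λ where
            (no none)    → ⇛-reordered id (λ _ → refl) λ q → inj₁ λ x →
              sym (decidable-stable (agree? P Q q) (λ ¬a → none (q , ¬a)) x)
            (yes (j , ¬a)) → detour ¬av ¬a (separated-end spQ j (far z))
        where
        z = proj₁ (free-exists P)
        freeP = proj₂ (free-exists P)
        -- All ends of the wrong pairs of Q are covered by P; giving one of these pairs the end z, which P leaves free,
        -- makes an end available.
        detour : ¬ Available P Q → ∀ {j} → ¬ Agree P Q j →
          (∃ λ x → ¬ Conn (Split-ends Q) (cls Split-edges DQ (DQ (inj₂ j)) ∖ inj₂ j) (far (Q j (not x))) (far z)) → P ⇛ Q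
        detour ¬av {j} ¬a (x , ¬π) =
          ⇛-trans (advance n mP sp mQ₁ spQ₁ (≤-trans fewer le)
                    (j , x , (λ a → proj₂ freeP j x (trans (a x) (replace-at Q j x z))) , subst (Free P) (sym (replace-at Q j x z)) freeP))
                  (⇛-sym mQ spQ mQ₁ (⇛-replace mQ spQ freeQ ¬π))
          where
          -- In a right pair of `Q`, `z` would be covered by `P` too; in a wrong one it would be an
          -- available end.
          freeQ : Free Q z
          freeQ = proj₁ freeP , λ q y eq → case agree? P Q q of λ where
            (yes a) → proj₂ freeP q y (trans (a y) eq)
            (no ¬a) → ¬av (q , y , ¬a , subst (Free P) (sym eq) freeP)
          mQ₁ = matching-replace mQ freeQ
          spQ₁ = splitting-replaced mQ freeQ spQ ¬π
          fewer : card (Wrong? P (replace Q j x z)) ≤ card (Wrong? P Q)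
          fewer = card-mono (Wrong? P (replace Q j x z)) (Wrong? P Q) λ q ¬a₁ a → ¬a₁ λ y →
            trans (a y) (sym (replace-other Q j x z (λ { refl → ¬a a }) y))

  -- Lowering the degrees at the vertex

  module Degrees {L : Set} ⦃ fL : Finite L ⦄ (E : L → V × V) {A : L → Set} (A? : Decidable A)
    {X₀ : L → Fin k} (kb₀ : KBase E A X₀) (v : V) {e₀ : L} (s₀ : AtVertex.Star-v E A? kb₀ v e₀)
    (t : ℕ) (degree : card (AtVertex.star? E A? kb₀ v) ≡ k + t) (t<k : t < k) where

    open AtVertex E A? kb₀ v
    open Pairings t
    open WithPairs E A? kb₀ v t degree t<k

    At : (L → Fin k) → Fin k → L → Set
    At X i e = Star-v e × X e ≡ i

    at? : ∀ X i → Decidable (At X i)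
    at? X i e = star? e ×-dec (X e ≟ i)

    deg : (L → Fin k) → Fin k → ℕ
    deg X i = card (at? X i)

    deg-positive : ∀ {X} → KBase E A X → ∀ i → 1 ≤ deg X i
    deg-positive {X} kb i = let f , s = meets-star kb s₀ i in card-positive (at? X i) {f} s

    -- The degrees add up to k + t < 2 k.
    leaf-class : ∀ X → ∃ λ j → deg X j < 2
    leaf-class X = ∑-<⇒∃< (begin-strict
      ∑ (deg X)     ≡⟨ ∑-fibres star? X ⟩
      card star?    ≡⟨ degree ⟩
      k + t         <⟨ +-monoʳ-< k t<k ⟩
      k + k         ≡⟨ cong (k +_) (+-identityʳ k) ⟨
      2 * k         ≡⟨ *-comm 2 k ⟩
      k * 2         ≡⟨ ∑-const 2 ⟨
      ∑ {Fin k} (λ _ → 2) ∎)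
      where open ≤-Reasoning

    -- A path that starts at `v` uses only one edge at `v`, so it avoids `e₁` or `e₂`.
    removable : ∀ {X i e₁ e₂ f} → KBase E A X → At X i e₁ → At X i e₂ → e₁ ≢ e₂ → Star-v f →
      ∃ λ e → At X i e × Conn E (cls A X i ∖ e) v (far f)
    removable {X} {i} {e₁} {e₂} {f} kb (s₁ , refl) (s₂ , X₂) e₁≢e₂ sf =
      case conn? {E = E} (∖? (cls? A? X i) e₁) v (far f) of λ where
        (yes π) → e₁ , (s₁ , refl) , π
        (no ¬π) → e₂ , (s₂ , X₂) , second-choice ¬π (split e₁ (KBase.spanning kb i (proj₁ sf) (far-link sf)))
      where
      S = cls A X i
      second-choice : ¬ Conn E (S ∖ e₁) v (far f) → Conn E (S ∖ e₁) v (far f) ⊎ Through {E = E} S e₁ v (far f) →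
                      Conn E (S ∖ e₂) v (far f)
      second-choice ¬π (inj₁ π) = contradiction π ¬π
      second-choice ¬π (inj₂ (p , q , l , _ , σ)) with link-unique l (far-link s₁)
      ... | inj₂ (refl , refl) = contradiction σ ¬π
      ... | inj₁ (refl , refl) with split e₂ σ
      ...   | inj₁ τ = cons ((proj₁ s₁ , refl) , e₁≢e₂) (far-link s₁) (conn-⊆ (λ ((a , _) , ne) → a , ne) τ)
      ...   | inj₂ (p , q , l′ , τ , τ′) with link-unique l′ (far-link s₂)
      ...     | inj₁ (refl , refl) = contradiction (rev (conn-⊆ proj₁ τ)) (KBase.acyclic kb i (proj₁ s₁ , refl) (far-link s₁))
      ...     | inj₂ (refl , refl) = contradiction (conn-⊆ proj₁ τ′) ¬π

    few? : ∀ X → Decidable (λ i → deg X i < 2)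
    few? X i = deg X i ℕ.<? 2

    -- By `π` the far end of `f` lies in the component of `v` in colour `i` without `e`. The path of
    -- colour `j` from there to the far end of `e` leaves this component at an edge `g` off `v`;
    -- trading `e` for `g` moves one degree at `v` from `i` to `j`.
    module Rebalance {X i e j f} (kb : KBase E A X) (e∈ : At X i e) (f∈ : At X j f)
      (unique : ∀ {g} → At X j g → g ≡ f) (i≢j : i ≢ j) (π : Conn E (cls A X i ∖ e) v (far f)) where

      se = proj₁ e∈
      sf = proj₁ f∈

      no-star : ∀ {S w} → S ⊆ cls A X j ∖ f → w ≢ v → ¬ Conn E S v w
      no-star S⊆ = isolated (λ s → proj₁ (proj₁ (S⊆ s))) λ s sg → proj₂ (S⊆ s) (unique (sg , proj₂ (proj₁ (S⊆ s))))

      outer : Conn E (cls A X j ∖ f) (far f) (far e)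
      outer with split f (KBase.spanning-conn kb j (far-far sf se))
      ... | inj₁ ρ = ρ
      ... | inj₂ (p , q , l , ρ , σ) with link-unique l (far-link sf)
      ...   | inj₁ (refl , refl) = contradiction (rev ρ) (no-star id (far≢v sf))
      ...   | inj₂ (refl , refl) = contradiction σ (no-star id (far≢v se))

      module _ (C : Crossing {E = E} (cls A X j ∖ f) (Conn E (cls A X i ∖ e) v) (far f) (far e)) where
        private
          module C = Crossing C
          g = C.edge

        Xg : X g ≡ j
        Xg = proj₂ (proj₁ C.member)

        ¬sg : ¬ Star-v g
        ¬sg s = proj₂ C.member (unique (s , Xg))

        Xe≢ : X e ≢ X g
        Xe≢ eq = i≢j (trans (sym (proj₂ e∈)) (trans eq Xg))

        X′ : L → Fin k
        X′ = swap X e g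

        -- In colour `j`, `far e` is reached from `v` only through `f`, and `g` lies on the path
        -- from `far f` to `far e`.
        fits-j : ¬ Conn E (cls A X j ∖ g) v (far e)
        fits-j ρ with split f ρ
        ... | inj₁ σ = no-star (λ ((s , _) , ne) → s , ne) (far≢v se) σ
        ... | inj₂ (p , q , l , _ , σ) with link-unique l (far-link sf)
        ...   | inj₂ (refl , refl) = no-star (λ ((s , _) , ne) → s , ne) (far≢v se) σ
        ...   | inj₁ (refl , refl) = KBase.acyclic kb j (proj₁ C.member) C.ends
                (conn-⊆ (λ ((s , _) , ne) → s , ne) (rev C.before) ⋯ conn-⊆ proj₁ σ
                  ⋯ rev (conn-⊆ (λ ((s , _) , ne) → s , ne) C.after))

        kb′ : KBase E A X′
        kb′ = swap-KBase Xe≢ A? kb (far-link se) C.ends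
          (subst (λ l → ¬ Conn E (cls A X l ∖ e) C.tip C.tail) (sym (proj₂ e∈)) (λ ρ → C.outside (C.inside ⋯ ρ)))
          (subst (λ l → ¬ Conn E (cls A X l ∖ g) v (far e)) (sym Xg) fits-j)

        linked : Linked E A X X′
        linked = step kb kb′ (swap-adj X e g Xe≢) ◅ ε

        at-e : X′ e ≡ j
        at-e = trans (swap-first X e g) Xg

        at-other : ∀ {h} → Star-v h → h ≢ e → X′ h ≡ X h
        at-other s h≢e = swap-other X h≢e (λ { refl → ¬sg s })

        deg-j : 2 ≤ deg X′ j
        deg-j = card-pair (at? X′ j) (se , at-e) (sf , trans (at-other sf f≢e) (proj₂ f∈)) (λ eq → f≢e (sym eq))
          where f≢e : f ≢ e
                f≢e refl = i≢j (trans (sym (proj₂ e∈)) (proj₂ f∈))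

        deg-i : deg X i ≤ suc (deg X′ i)
        deg-i = card-≤suc (at? X′ i) (at? X i) e λ h (s , eq) → case h ≟ e of λ where
          (yes h≡e) → inj₂ h≡e
          (no h≢e)  → inj₁ (s , trans (at-other s h≢e) eq)

        deg-other : ∀ {l} → l ≢ i → deg X l ≤ deg X′ l
        deg-other {l} l≢i = card-mono (at? X l) (at? X′ l) λ h (s , eq) → case h ≟ e of λ where
          (yes refl) → contradiction (trans (sym eq) (proj₂ e∈)) l≢i
          (no h≢e)   → s , trans (at-other s h≢e) eq

        fewer : 3 ≤ deg X i → deg X j < 2 → card (few? X′) < card (few? X)
        fewer big few = card-mono-< (few? X′) (few? X) shrink j few (λ lt → <⇒≱ lt deg-j)
          where
          shrink : ∀ l → deg X′ l < 2 → deg X l < 2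
          shrink l lt = case l ≟ i of λ where
            -- Colour `i` had degree at least 3, so it keeps at least 2.
            (yes refl) → contradiction lt (≤⇒≯ (s≤s⁻¹ (≤-trans big deg-i)))
            (no l≢i)   → ≤-<-trans (deg-other l≢i) lt

      rebalance : 3 ≤ deg X i → deg X j < 2 →
                  ∃ λ X′ → KBase E A X′ × Linked E A X X′ × card (few? X′) < card (few? X)
      rebalance big few = X′ C , kb′ C , linked C , fewer C big few
        where
        C : Crossing {E = E} (cls A X j ∖ f) (Conn E (cls A X i ∖ e) v) (far f) (far e)
        C = crossing (∖? (cls? A? X j) f) (conn? (∖? (cls? A? X i) e) v) π
              (KBase.acyclic kb i (proj₁ se , proj₂ e∈) (far-link se)) outer

    lower : ∀ {X i} → KBase E A X → 3 ≤ deg X i →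
            ∃ λ X′ → KBase E A X′ × Linked E A X X′ × card (few? X′) < card (few? X)
    lower {X} {i} kb big =
      let j , few = leaf-class X
          f , f∈  = meets-star kb s₀ j
          _ , _ , a₁ , a₂ , ne = two-elements (at? X i) (≤-trans (s≤s (s≤s z≤n)) big)
          e , e∈ , π = removable kb a₁ a₂ ne (proj₁ f∈)
          i≢j = λ eq → <⇒≱ few (≤-trans (s≤s (s≤s z≤n)) (≤-trans big (≤-reflexive (cong (deg X) eq))))
      in Rebalance.rebalance {X} {i} {e} {j} {f} kb e∈ f∈ (λ a → card<2⇒unique (at? X j) few a f∈) i≢j π big few

    lower-all : ∀ {X} → KBase E A X → ∃ λ X′ → KBase E A X′ × Linked E A X X′ × ∀ i → deg X′ i ≤ 2
    lower-all kb = go _ kb ≤-refl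
      where
      go : ∀ n {X} → KBase E A X → card (few? X) ≤ n → ∃ λ X′ → KBase E A X′ × Linked E A X X′ × ∀ i → deg X′ i ≤ 2
      recurse : ∀ n {X} → card (few? X) ≤ n →
        (∃ λ X′ → KBase E A X′ × Linked E A X X′ × card (few? X′) < card (few? X)) →
        ∃ λ X′ → KBase E A X′ × Linked E A X X′ × ∀ i → deg X′ i ≤ 2
      go n {X} kb le = case some? (λ i → 3 ℕ.≤? deg X i) of λ where
        (no none)       → X , kb , ε , λ i → s≤s⁻¹ (≰⇒> (λ big → none (i , big)))
        (yes (i , big)) → recurse n le (lower kb big)
      recurse zero    le (_  , _   , _ , smaller) = contradiction (≤-trans smaller le) λ ()
      recurse (suc n) le (X′ , kb′ , l , smaller) =
        let Y , kY , l′ , small = go n kb′ (s≤s⁻¹ (≤-trans smaller le)) in Y , kY , l ◅◅ l′ , small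

    -- Reading off the pairing from the degrees

    module _ {X} (kb : KBase E A X) (small : ∀ i → deg X i ≤ 2) where

      double? : Decidable (λ i → deg X i ≡ 2)
      double? i = deg X i ℕ.≟ 2

      double-count : card double? ≡ t
      double-count = +-cancelˡ-≡ k _ _ (begin
        k + card double?                            ≡⟨ cong (_+ card double?) (trans (sym (*-identityʳ k)) (sym (∑-const 1))) ⟩
        ∑ {Fin k} (λ _ → 1) + card double?          ≡⟨ ∑-+ (λ _ → 1) (λ i → ind (double? i)) ⟨
        ∑ (λ i → 1 + ind (double? i))               ≡⟨ ∑-cong (λ i → sym (degree-of (deg X i) (deg-positive kb i) (small i) (double? i))) ⟩
        ∑ (deg X)                                   ≡⟨ ∑-fibres star? X ⟩
        card star?                                  ≡⟨ degree ⟩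
        k + t                                       ∎)
        where
        open ≡-Reasoning
        degree-of : ∀ n → 1 ≤ n → n ≤ 2 → (d? : Dec (n ≡ 2)) → n ≡ 1 + ind d?
        degree-of 1 _ _ (no _)  = refl
        degree-of 2 _ _ (yes _) = refl
        degree-of 2 _ _ (no ne) = contradiction refl ne
        degree-of (suc (suc (suc _))) _ (s≤s (s≤s ())) _

    module FromListing {X} (kb : KBase E A X) (small : ∀ i → deg X i ≤ 2) (doubles : Listing (λ i → deg X i ≡ 2) t)
      (ends-of : ∀ p → Listing (At X (Listing.at doubles p)) 2) where

      private
        module C = Listing doubles

      side : Bool → Fin 2
      side false = zero
      side true  = suc zero

      side-injective : ∀ {x y} → side x ≡ side y → x ≡ y
      side-injective {false} {false} _ = refl
      side-injective {true}  {true}  _ = refl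

      side-surjective : ∀ i → ∃ λ x → side x ≡ i
      side-surjective zero       = false , refl
      side-surjective (suc zero) = true , refl

      P : Pairing
      P p x = Listing.at (ends-of p) (side x)

      P-star : ∀ p x → At X (C.at p) (P p x)
      P-star p x = Listing.sound (ends-of p) (side x)

      P-matching : Matching P
      P-matching = record { at-star = λ p x → proj₁ (P-star p x) ; injective = inj }
        where
        inj : ∀ {p q x y} → P p x ≡ P q y → p ≡ q × x ≡ y
        inj {p} {q} {x} {y} eq with C.injective {p} {q} (trans (sym (proj₂ (P-star p x))) (trans (cong X eq) (proj₂ (P-star q y))))
        ... | refl = refl , side-injective (Listing.injective (ends-of p) eq)

      D : L ⊎ Fin t → Fin k
      D = [ X , C.at ]′

      pair-of : ∀ {i e} → deg X i ≡ 2 → At X i e → ∃₂ λ p x → C.at p ≡ i × P p x ≡ e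
      pair-of {i} {e} two a with C.complete i two
      ... | p , refl with Listing.complete (ends-of p) e a
      ...   | n , eq with side-surjective n
      ...     | x , refl = p , x , refl , eq

      D-off : Fin k → L ⊎ Fin t → Set
      D-off j = [ (λ e → Off e × X e ≡ j) , (λ _ → ⊥) ]′

      off-conn : ∀ {j S u w} → (∀ {e} → Off e → X e ≡ j → S e) → Conn (Split-ends P) (D-off j) u w → Conn E S u w
      off-conn {j} {S} into = conn-map move
        where
        move : ∀ {e u w} → D-off j e → Link (Split-ends P) e u w → Conn E S u w
        move {inj₁ e} (o , eq) l = single (into o eq) (drop₁ {P} l)

      D-off-acyclic : ∀ j → Acyc (Split-ends P) (D-off j)
      D-off-acyclic j {inj₁ e} (o , eq) l π = KBase.acyclic kb j (proj₁ o , eq) (drop₁ {P} l)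
        (conn-map (λ { {inj₁ f} ((o , eq) , ne) l → single ((proj₁ o , eq) , λ eq → ne (cong inj₁ eq)) (drop₁ {P} l)
                     ; {inj₂ p} (() , _) l }) π)

      -- A path off `v` between the far ends of the pair would close a cycle with its two edges at
      -- `v` in the original base.
      double-acyclic : ∀ p → Acyc (Split-ends P) (cls Split-edges D (C.at p))
      double-acyclic p = acyc-⊆ {T = D-off j ⊕ inj₂ p}
          (λ { {inj₁ e} s → inj₁ s ; {inj₂ q} (_ , eq) → inj₂ (cong inj₂ (C.injective eq)) })
          (acyc-⊕ (D-off-acyclic j) (pair-link P p false) λ π → KBase.acyclic kb j a∈ (far-link sa)
            (cons (b∈ , b≢a) (far-link sb) (rev (off-conn (λ o eq → (proj₁ o , eq) , λ { refl → proj₂ o sa }) π))))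
        where
        j : Fin k
        j = C.at p
        sa : Star-v (P p false)
        sa = proj₁ (P-star p false)
        sb : Star-v (P p true)
        sb = proj₁ (P-star p true)
        a∈ : cls A X j (P p false)
        a∈ = proj₁ sa , proj₂ (P-star p false)
        b∈ : cls A X j (P p true)
        b∈ = proj₁ sb , proj₂ (P-star p true)
        b≢a : P p true ≢ P p false
        b≢a eq = case proj₂ (Matching.injective P-matching {p} {p} {true} {false} eq) of λ ()

      D-acyclic : ∀ j → Acyc (Split-ends P) (cls Split-edges D j)
      D-acyclic j = case deg X j ℕ.≟ 2 of λ where
        (no ne)   → acyc-⊆ {T = D-off j} (λ { {inj₁ e} s → s ; {inj₂ p} (_ , eq) →
                      contradiction (subst (λ i → deg X i ≡ 2) eq (C.sound p)) ne }) (D-off-acyclic j)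
        (yes two) → let p , eq = C.complete j two
                    in subst (λ j → Acyc (Split-ends P) (cls Split-edges D j)) eq (double-acyclic p)

      link-sides : ∀ p x y → P p x ≢ P p y → Conn (Split-ends P) (cls Split-edges D (C.at p)) (far (P p x)) (far (P p y))
      link-sides p false false ne = contradiction refl ne
      link-sides p false true  ne = single (tt , refl) (pair-link P p false)
      link-sides p true  false ne = single (tt , refl) (pair-link P p true)
      link-sides p true  true  ne = contradiction refl ne

      same-pair : ∀ {p q} → p ≡ q → ∀ x y → P p x ≢ P q y →
                  Conn (Split-ends P) (cls Split-edges D (C.at p)) (far (P p x)) (far (P q y))
      same-pair {p} refl = link-sides p

      joined : ∀ {j e f} → At X j e → At X j f → Conn (Split-ends P) (cls Split-edges D j) (far e) (far f)
      joined {j} {e} {f} a b = case e ≟ f of λ where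
        (yes refl) → nil
        (no e≢f)   →
          let two = ≤-antisym (small j) (card-pair (at? X j) a b e≢f)
              p , x , eq , eq′ = pair-of two a
              q , y , eq″ , eq‴ = pair-of two b
          in subst₂ (λ a b → Conn (Split-ends P) (cls Split-edges D j) (far a) (far b)) eq′ eq‴
               (subst (λ j → Conn (Split-ends P) (cls Split-edges D j) (far (P p x)) (far (P q y))) eq
                 (same-pair (C.injective (trans eq (sym eq″))) x y (λ same → e≢f (trans (sym eq′) (trans same eq‴)))))

      -- Each passage through `v` is replaced by the pair of colour `j`. The second component treats
      -- paths that start at `v` and leaves open by which edge `v` was entered.
      bypass : ∀ {j u w} → w ≢ v → Conn E (cls A X j) u w →
        (u ≢ v → Conn (Split-ends P) (cls Split-edges D j) u w) ×
        (u ≡ v → ∀ {e} → At X j e → Conn (Split-ends P) (cls Split-edges D j) (far e) w)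
      bypass w≢v nil = (λ _ → nil) , (λ eq → contradiction eq w≢v)
      bypass w≢v (cons {e} (a , eq) l π) with bypass w≢v π | star? e
      ... | away , _ | no ¬s =
        (λ _ → cons {e = inj₁ e} ((a , ¬s) , eq) (lift₁ {P} l) (away (proj₂ (off-ends (a , ¬s) l)))) ,
        (λ u≡v → contradiction u≡v (proj₁ (off-ends (a , ¬s) l)))
      ... | away , through | yes s with link-unique l (far-link s)
      ...   | inj₁ (refl , refl) = contradiction refl , λ _ b → joined b (s , eq) ⋯ away (far≢v s)
      ...   | inj₂ (refl , refl) = (λ _ → through refl (s , eq)) , λ eq → contradiction eq (far≢v s)

      P-member : Member P X
      P-member = D , record { acyclic = D-acyclic
                          ; spanning = λ j u≢v w≢v π → proj₁ (bypass w≢v (KBase.spanning-conn kb j π)) u≢v }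
                 , kb , record { off = λ _ → refl ; at = at }
        where
        at : ∀ {e} → Star-v e → (∃₂ λ p x → P p x ≡ e × C.at p ≡ X e) ⊎ (∀ p → C.at p ≢ X e)
        at {e} s with deg X (X e) ℕ.≟ 2
        ... | yes two = let p , x , eq , eq′ = pair-of two (s , refl) in inj₁ (p , x , eq′ , eq)
        ... | no ne   = inj₂ (λ p eq → ne (subst (λ i → deg X i ≡ 2) eq (C.sound p)))

    member : ∀ {X} → KBase E A X → (∀ i → deg X i ≤ 2) → ∃ λ P → Matching P × Member P X
    member {X} kb small = from-doubles
        (subst (Listing (λ i → deg X i ≡ 2)) (double-count kb small) (list (double? kb small)))
      where
      from-doubles : Listing (λ i → deg X i ≡ 2) t → ∃ λ P → Matching P × Member P X
      from-doubles doubles = M.P , M.P-matching , M.P-member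
        where module M = FromListing kb small doubles
                (λ p → subst (Listing (At X (Listing.at doubles p))) (Listing.sound doubles p) (list (at? X (Listing.at doubles p))))

  -- A vertex of degree below 2 k

  module _ {L : Set} ⦃ fL : Finite L ⦄ (E : L → V × V) {A : L → Set} (A? : Decidable A)
    {X : L → Fin k} (kb : KBase E A X) (i₀ : Fin k) {e₀ : L} (a₀ : A e₀) where

    private
      star-at? : ∀ v → Decidable (AtVertex.Star-v E A? kb v)
      star-at? = AtVertex.star? E A? kb

      touched? : Decidable (λ v → ∃ λ e → AtVertex.Star-v E A? kb v e)
      touched? v = some? (star-at? v)

      size : ℕ
      size = card (cls? A? X i₀)

      r : V
      r = proj₁ (E e₀)

      spoke? : Decidable (λ u → (∃ λ e → AtVertex.Star-v E A? kb u e) × u ≢ r)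
      spoke? u = touched? u ×-dec ¬? (u ≟ r)

      -- A base is spanned by a star on the touched vertices, which has one edge less than there are vertices.
      size<touched : size < card touched?
      size<touched = ≤-<-trans
        (steinitz {E = E} {E′ = λ u → r , u} (cls? A? X i₀) spoke? (KBase.acyclic kb i₀)
          (λ (a , _) l → rev (spoke (AtVertex.star-intro E A? kb _ a l)) ⋯ spoke (AtVertex.star-intro E A? kb _ a (flip-link l))))
        (card-mono-< spoke? touched? (λ _ → proj₁) r (e₀ , AtVertex.star-intro E A? kb r a₀ (link e₀)) (λ (_ , ne) → ne refl))
        where
        spoke : ∀ {u e} → AtVertex.Star-v E A? kb u e → Conn (λ u → r , u) (λ u → (∃ λ e → AtVertex.Star-v E A? kb u e) × u ≢ r) r u
        spoke {u} {e} s = case u ≟ r of λ where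
          (yes refl) → nil
          (no ne)    → single ((e , s) , ne) (along refl)

      edge-count : card A? ≡ k * size
      edge-count = trans (sym (∑-fibres A? X)) (trans (∑-cong (λ j → base-size A? kb j i₀)) (∑-const size))

      degree-sum : ∑ (λ v → card (star-at? v)) ≤ card A? * 2
      degree-sum = ≤-trans (≤-reflexive (∑-swap (λ v e → ind (star-at? v e))))
        (≤-trans (∑-mono-≤ per-edge) (≤-reflexive (∑-scale (λ e → ind (A? e)) 2)))
        where
        at-most-two : ∀ e → card (λ v → star-at? v e) ≤ 2
        at-most-two e = ≤-trans
          (card-∪ (proj₁ (E e) ≟_) (proj₂ (E e) ≟_) (λ v → star-at? v e) (λ _ → proj₂))
          (≤-reflexive (cong₂ _+_ (card-singleton (proj₁ (E e))) (card-singleton (proj₂ (E e)))))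
        per-edge : ∀ e → ∑ (λ v → ind (star-at? v e)) ≤ ind (A? e) * 2
        per-edge e = bound (A? e)
          where
          bound : (a? : Dec (A e)) → ∑ (λ v → ind (star-at? v e)) ≤ ind a? * 2
          bound (yes _) = at-most-two e
          bound (no ¬a) = ≤-reflexive (card-empty (λ v → star-at? v e) (λ _ (a , _) → ¬a a))

    -- The average degree: `k * size` edges on more than `size` touched vertices. Untouched vertices
    -- weigh 0 in the upper bound, so the strict inequality can only single out a touched one.
    low-degree : ∃ λ v → ∃ (AtVertex.Star-v E A? kb v) × card (star-at? v) < k + k
    low-degree = found (∑-<⇒∃< (begin-strict
      ∑ (λ v → card (star-at? v))                ≤⟨ degree-sum ⟩
      card A? * 2                                ≡⟨ cong (_* 2) edge-count ⟩
      k * size * 2                               ≡⟨ arrange size ⟩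
      size * (k + k)                             <⟨ *-monoˡ-< (k + k) ⦃ nonZero ⦄ size<touched ⟩
      card touched? * (k + k)                    ≡⟨ ∑-scale (λ v → ind (touched? v)) (k + k) ⟨
      ∑ (λ v → ind (touched? v) * (k + k))       ∎))
      where
      open ≤-Reasoning
      arrange : ∀ n → k * n * 2 ≡ n * (k + k)
      arrange n = solve 2 (λ k n → k :* n :* con 2 := n :* (k :+ k)) refl k n
        where open +-*-Solver
      nonZero : NonZero (k + k)
      nonZero = >-nonZero (≤-trans (Fin⇒positive i₀) (m≤m+n k k))
        where
        Fin⇒positive : ∀ {n} → Fin n → 1 ≤ n
        Fin⇒positive {suc n} _ = s≤s z≤n
      found : (∃ λ v → card (star-at? v) < ind (touched? v) * (k + k)) →
              ∃ λ v → ∃ (AtVertex.Star-v E A? kb v) × card (star-at? v) < k + k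
      found (v , lt) = v , unwrap (touched? v) lt
        where
        unwrap : (d : Dec (∃ (AtVertex.Star-v E A? kb v))) → card (star-at? v) < ind d * (k + k) →
                 ∃ (AtVertex.Star-v E A? kb v) × card (star-at? v) < k + k
        unwrap (yes s) lt = s , ≤-trans lt (≤-reflexive (*-identityˡ (k + k)))

  -- The induction on the number of edges

  all-linked : Fin k → ∀ n {L : Set} ⦃ fL : Finite L ⦄ (E : L → V × V) {A : L → Set} (A? : Decidable A) → card A? ≤ n →
               ∀ {X Y} → KBase E A X → KBase E A Y → Linked E A X Y
  all-linked i₀ n {L} E {A} A? le {X} {Y} kX kY = case some? A? of λ where
      (no none)     → step kX kY (i₀ , i₀ , λ a → contradiction (_ , a) none) ◅ ε
      (yes (e , a)) → let v , (_ , s) , lt = low-degree E A? kX i₀ a in at-vertex n le v s lt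
    where
    at-vertex : ∀ n → card A? ≤ n → ∀ v {e₀} → AtVertex.Star-v E A? kX v e₀ → card (AtVertex.star? E A? kX v) < k + k → Linked E A X Y
    at-vertex zero le v {e₀} s lt = contradiction (≤-trans (card-positive A? (proj₁ s)) le) λ ()
    at-vertex (suc n) le v {e₀} s lt =
        let X₁ , kX₁ , XX₁ , smallX = lower-all kX
            Y₁ , kY₁ , YY₁ , smallY = lower-all kY
            P , mP , memberP@(_ , spP , _) = member kX₁ smallX
            Q , mQ , memberQ@(_ , spQ , _) = member kY₁ smallY
            Z , memberZ , X₁Z = pairings-linked mP spP mQ spQ memberP
        in XX₁ ◅◅ X₁Z ◅◅ members-linked mQ memberZ memberQ ◅◅ linked-sym YY₁
      where
      open AtVertex E A? kX v
      t : ℕ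
      t = card star? ∸ k
      k≤degree : k ≤ card star?
      k≤degree = begin
        k                                                     ≡⟨ trans (∑-const 1) (*-identityʳ k) ⟨
        ∑ {Fin k} (λ _ → 1)                                   ≤⟨ ∑-mono-≤ {Fin k} (λ i → let f , f∈ = meets-star kX s i in
                                                                   card-positive (λ e → star? e ×-dec (X e ≟ i)) {f} f∈) ⟩
        ∑ (λ i → card (λ e → star? e ×-dec (X e ≟ i)))        ≡⟨ ∑-fibres star? X ⟩
        card star?                                            ∎
        where open ≤-Reasoning
      degree : card star? ≡ k + t
      degree = sym (m+[n∸m]≡n k≤degree)
      t<k : t < k
      t<k = +-cancelˡ-< k t k (subst (_< k + k) degree lt)
      open Pairings t
      open Degrees E A? kX v s t degree t<k

      -- `v` is isolated in the split graph, so each member of `D` remains a forest when an edge at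
      -- `v` is added, and this larger forest is spanned by a base of the original graph.
      fewer : ∀ {P D} → Matching P → KBase (Split-ends P) Split-edges D → card split-edges? < card A?
      fewer {P} {D} mP kD = begin-strict
        card split-edges?                                   ≡⟨ ∑-fibres split-edges? D ⟨
        ∑ (λ j → card (cls? split-edges? D j))              <⟨ ∑-mono-< (λ j → <⇒≤ (class j)) i₀ (class i₀) ⟩
        ∑ (λ j → card (cls? A? X j))                        ≡⟨ ∑-fibres A? X ⟩
        card A?                                             ∎
        where
        open ≤-Reasoning
        v-isolated : ∀ {j} → ¬ Conn (Split-ends P) (cls Split-edges D j) v (far e₀)
        v-isolated π with first-edge π (λ eq → far≢v s (sym eq))
        ... | inj₁ e , _ , (o , _) , l = proj₁ (off-ends o (drop₁ {P} l)) refl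
        ... | inj₂ p , _ , _ , along eq   = far≢v (Matching.at-star mP p false) (cong proj₁ eq)
        ... | inj₂ p , _ , _ , against eq = far≢v (Matching.at-star mP p true) (cong proj₂ eq)
        spanned : ∀ j {e u w} → (cls Split-edges D j ⊕ inj₁ e₀) e → Link (Split-ends P) e u w → Conn E (cls A X j) u w
        spanned j {inj₁ e} (inj₁ (o , _)) l = KBase.spanning kX j (proj₁ o) (drop₁ {P} l)
        spanned j {inj₁ e} (inj₂ refl) l    = KBase.spanning kX j (proj₁ s) (drop₁ {P} l)
        spanned j {inj₂ p} _ l              = link-conn (pair-link P p false) l
          (KBase.spanning-conn kX j (far-far (Matching.at-star mP p false) (Matching.at-star mP p true)))
        class : ∀ j → card (cls? split-edges? D j) < card (cls? A? X j)
        class j = ≤-trans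
          (card-mono-< (cls? split-edges? D j) (⊕? (cls? split-edges? D j) (inj₁ e₀)) (λ _ → inj₁) (inj₁ e₀) (inj₂ refl)
            (λ (o , _) → proj₂ o s))
          (steinitz (⊕? (cls? split-edges? D j) (inj₁ e₀)) (cls? A? X j)
            (acyc-⊕ (KBase.acyclic kD j) (lift₁ {P} (far-link s)) v-isolated) (spanned j))

      connected : ∀ {P} → Matching P → ∀ {D D′} → KBase (Split-ends P) Split-edges D →
                  KBase (Split-ends P) Split-edges D′ → Linked (Split-ends P) Split-edges D D′
      connected {P} mP kD kD′ =
        all-linked i₀ n (Split-ends P) split-edges? (s≤s⁻¹ (≤-trans (fewer mP kD) le)) kD kD′

      open Alignment E A? kX v t degree t<k connected

-- Colourings and k-bases of the cycle matroid

opaque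
  unfolding ∑

  card≡∣∣ : ∀ {n} (S : Subset n) → card (_∈? S) ≡ ∣ S ∣
  card≡∣∣ Vec.[]            = refl
  card≡∣∣ (Subset.inside Vec.∷ S)  = cong suc (trans (∑-cong λ i → ind-there i) (card≡∣∣ S))
    where
    ind-there : ∀ i → ind (suc i ∈? (Subset.inside Vec.∷ S)) ≡ ind (i ∈? S)
    ind-there i = ≤-antisym (ind-mono (λ { (Vec.there p) → p }) _ _) (ind-mono Vec.there _ _)
  card≡∣∣ (Subset.outside Vec.∷ S) = trans (∑-cong λ i → ind-there i) (card≡∣∣ S)
    where
    ind-there : ∀ i → ind (suc i ∈? (Subset.outside Vec.∷ S)) ≡ ind (i ∈? S)
    ind-there i = ≤-antisym (ind-mono (λ { (Vec.there p) → p }) _ _) (ind-mono Vec.there _ _)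

deleted-∉ : ∀ {n} (S : Subset n) e → ¬ e ∈ S - e
deleted-∉ (_ Vec.∷ S) zero    ()
deleted-∉ (_ Vec.∷ S) (suc e) (Vec.there s) = deleted-∉ S e s

module _ (G : Graph) where

  reach⇒conn : ∀ {S u w} → Reach G S u w → Conn (ends G) (_∈ S) u w
  reach⇒conn here           = nil
  reach⇒conn (fwd e s eq ρ) = cons s (along eq) (reach⇒conn ρ)
  reach⇒conn (bwd e s eq ρ) = cons s (against eq) (reach⇒conn ρ)

  conn⇒reach : ∀ {S u w} → Conn (ends G) (_∈ S) u w → Reach G S u w
  conn⇒reach nil                    = here
  conn⇒reach (cons s (along eq) π)   = fwd _ s eq (conn⇒reach π)
  conn⇒reach (cons s (against eq) π) = bwd _ s eq (conn⇒reach π)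

  ∈-∖⁺ : ∀ {S : EdgeSet G} {e} → (_∈ S) ∖ e ⊆ (_∈ (S - e))
  ∈-∖⁺ (s , ne) = x∈p∧x≢y⇒x∈p-y s ne

  ∈-∖⁻ : ∀ {S : EdgeSet G} {e} → (_∈ (S - e)) ⊆ (_∈ S) ∖ e
  ∈-∖⁻ {S} {e} s = p─q⊆p S Subset.⁅ e ⁆ s , λ { refl → deleted-∉ S e s }

  forest⇒acyclic : ∀ {S} → Forest G S → Acyc (ends G) (_∈ S)
  forest⇒acyclic f s (along eq)   π = f _ s eq (conn⇒reach (conn-⊆ ∈-∖⁺ π))
  forest⇒acyclic f s (against eq) π = f _ s eq (conn⇒reach (conn-⊆ ∈-∖⁺ (rev π)))

  acyclic⇒forest : ∀ {S} → Acyc (ends G) (_∈ S) → Forest G S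
  acyclic⇒forest acyc e s eq ρ = acyc s (along eq) (conn-⊆ ∈-∖⁻ (reach⇒conn ρ))

  base-spans : ∀ {S} → IsBase G S → ∀ {e u w} → Link (ends G) e u w → Conn (ends G) (_∈ S) u w
  base-spans (_ , spanning) l = reach⇒conn (spanning _ _ (conn⇒reach (single ∈⊤ l)))

  base-card : ∀ {S T} → IsBase G S → IsBase G T → card (_∈? S) ≤ card (_∈? T)
  base-card {S} {T} bS bT = steinitz (_∈? S) (_∈? T) (forest⇒acyclic (proj₁ bS)) (λ _ → base-spans bT)

  module Translate (k r : ℕ) (third : (i j : Fin k) → ∃ λ l → l ≢ i × l ≢ j) (i₀ : Fin k)
    (rank : IsRank G r) (size : m G ≡ k * r) where

    open KBases {Fin (n G)} k third

    All : Fin (m G) → Set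
    All _ = ⊤

    base-size-rank : ∀ {S} → IsBase G S → card (_∈? S) ≡ r
    base-size-rank {S} b = let B , bB , eq = rank in
      trans (≤-antisym (base-card b bB) (base-card bB b)) (trans (card≡∣∣ B) eq)

    module _ (X : KBaseVertex G k) where

      private
        B : Fin k → EdgeSet G
        B = proj₁ X

        bases : ∀ i → IsBase G (B i)
        bases = proj₁ (proj₂ X)

        disjoint : ∀ i j e → e ∈ B i → e ∈ B j → i ≡ j
        disjoint = proj₂ (proj₂ X)

      member? : ∀ e → Decidable (λ i → e ∈ B i)
      member? e i = e ∈? B i

      -- `k` disjoint bases of size `r` fill all `k * r` edges; this is what turns a family of bases
      -- into a colouring.
      covered : ∀ e → ∃ λ i → e ∈ B i
      covered e = case some? (member? e) of λ where
          (yes found) → found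
          (no none)   → contradiction (begin-strict
            m G                                       ≡⟨ size ⟩
            k * r                                     ≡⟨ ∑-const r ⟨
            ∑ {Fin k} (λ _ → r)                       ≡⟨ ∑-cong (λ i → base-size-rank (bases i)) ⟨
            ∑ (λ i → card (_∈? B i))                  ≡⟨ ∑-swap (λ i e → ind (e ∈? B i)) ⟩
            ∑ (λ e → card (member? e))                <⟨ ∑-mono-< at-most-one e (s≤s (≤-reflexive (card-empty (member? e) (λ i s → none (i , s))))) ⟩
            ∑ {Fin (m G)} (λ _ → 1)                   ≡⟨ ∑-const 1 ⟩
            m G * 1                                   ≡⟨ *-identityʳ (m G) ⟩
            m G                                       ∎) (<-irrefl refl)
        where
        open ≤-Reasoning
        at-most-one : ∀ e → card (member? e) ≤ 1
        at-most-one e = s≤s⁻¹ (≰⇒> λ two →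
          let i , j , ei , ej , i≢j = two-elements (member? e) two in i≢j (disjoint i j e ei ej))

      colouring : Fin (m G) → Fin k
      colouring e = proj₁ (covered e)

      colour⇒∈ : ∀ {e j} → colouring e ≡ j → e ∈ B j
      colour⇒∈ {e} refl = proj₂ (covered e)

      ∈⇒colour : ∀ {e j} → e ∈ B j → colouring e ≡ j
      ∈⇒colour {e} s = disjoint _ _ e (proj₂ (covered e)) s

      colouring-KBase : KBase (ends G) All colouring
      colouring-KBase = record
        { acyclic  = λ j → acyc-⊆ (λ (_ , eq) → colour⇒∈ eq) (forest⇒acyclic (proj₁ (bases j)))
        ; spanning = λ j _ l → conn-⊆ (λ s → tt , ∈⇒colour s) (base-spans (bases j) l) }

    class : (Fin (m G) → Fin k) → Fin k → EdgeSet G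
    class c i = Vec.tabulate (λ e → does (c e ≟ i))

    ∈-class⁺ : ∀ {c i e} → c e ≡ i → e ∈ class c i
    ∈-class⁺ {c} {i} {e} eq = Vec.lookup⇒[]= e _ (trans (Vec.lookup∘tabulate _ e) (dec-true (c e ≟ i) eq))

    ∈-class⁻ : ∀ {c i e} → e ∈ class c i → c e ≡ i
    ∈-class⁻ {c} {i} {e} s with c e ≟ i | trans (sym (Vec.lookup∘tabulate (λ e → does (c e ≟ i)) e)) (Vec.[]=⇒lookup s)
    ... | yes eq | _  = eq
    ... | no _   | ()

    vertex : ∀ {c} → KBase (ends G) All c → KBaseVertex G k
    vertex {c} kb = class c
      , (λ i → acyclic⇒forest (acyc-⊆ (λ s → tt , ∈-class⁻ {c} s) (KBase.acyclic kb i))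
             , λ u w ρ → conn⇒reach (conn-⊆ (λ (_ , eq) → ∈-class⁺ {c} eq)
                 (KBase.spanning-conn kb i (conn-⊆ (λ _ → tt) (reach⇒conn ρ)))))
      , λ i j e s s′ → trans (sym (∈-class⁻ {c} s)) (∈-class⁻ {c} s′)

    -- A family and the one tabulated from its colouring need not be equal as functions, but one
    -- common class makes them adjacent.
    to-colouring : ∀ X → class (colouring X) i₀ ≡ proj₁ X i₀
    to-colouring X = ⊆-antisym (λ s → colour⇒∈ X (∈-class⁻ {colouring X} s)) (λ s → ∈-class⁺ {colouring X} (∈⇒colour X s))

    path : ∀ {c c′} → Linked (ends G) All c c′ → (kb : KBase (ends G) All c) (kb′ : KBase (ends G) All c′) →
           Star (KBaseAdj G k) (vertex kb) (vertex kb′)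
    -- The two vertices may carry different proofs for the same colouring; sharing a class, they are
    -- one step apart.
    path ε kb kb′ = (i₀ , i₀ , refl) ◅ ε
    path {c} (_◅_ {j = c₁} (step _ kb₁ (i , j , same)) rest) kb kb′ =
      (i , j , ⊆-antisym (λ s → ∈-class⁺ {c₁} (proj₁ (same tt) (∈-class⁻ {c} s)))
                         (λ s → ∈-class⁺ {c} (proj₂ (same tt) (∈-class⁻ {c₁} s)))) ◅ path rest kb₁ kb′

    k-base-connected : KBaseConnected G k
    k-base-connected X Y = (i₀ , i₀ , sym (to-colouring X)) ◅
      path (all-linked i₀ _ (ends G) (λ _ → yes tt) ≤-refl (colouring-KBase X) (colouring-KBase Y))
           (colouring-KBase X) (colouring-KBase Y)
      ◅◅ (i₀ , i₀ , to-colouring Y) ◅ ε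

third-of-three : ∀ {k} (i j : Fin (3 + k)) → ∃ λ l → l ≢ i × l ≢ j
third-of-three zero          zero          = suc zero , (λ ()) , λ ()
third-of-three zero          (suc zero)    = suc (suc zero) , (λ ()) , λ ()
third-of-three zero          (suc (suc _)) = suc zero , (λ ()) , λ ()
third-of-three (suc zero)    zero          = suc (suc zero) , (λ ()) , λ ()
third-of-three (suc _)       (suc _)       = zero , (λ ()) , λ ()
third-of-three (suc (suc _)) zero          = suc zero , (λ ()) , λ ()

theorem3p1 : (G : Graph) (k r : ℕ) → 3 ≤ k → IsRank G r → m G ≡ k * r →
    KBaseConnected G k
theorem3p1 G (suc (suc (suc k))) r (s≤s (s≤s (s≤s _))) rank size =
  Translate.k-base-connected G (3 + k) r third-of-three zero rank size
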